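{- For every real $\epsilon>0$ there exists $k_\epsilon$ such that for every integer $k\geq k_\epsilon$ there exists $n_k$ such that the following holds: if $G$ is a graph of order at least $n_k$ and average degree at least $k^2+3k-2+\epsilon$, then $G$ contains $k$ vertex-disjoint cycles of consecutive even lengths.
   Context: All graphs are finite and simple. A collection of $k$ cycles has consecutive even lengths if their lengths are $2r, 2r+2, \dots, 2r+2k-2$ for some integer $r\geq 2$. -}

module Defs where

open import Data.Nat using (ℕ; zero; suc; _+_; _*_; _≤_; _<_)
import Data.Nat
import Data.Fin
import Relation.Nullary
open import Data.Bool using (Bool; true; false)
open import Data.Fin using (Fin; toℕ)
open import Data.List using (List; sum; map; length; filter)
open import Data.Product using (Σ; ∃; _×_; _,_)
open import Relation.Binary.PropositionalEquality using (_≡_; _≢_)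
open import Function.Definitions using (Injective)

record Graph (n : ℕ) : Set where
  field
    adj   : Fin n → Fin n → Bool
    sym   : ∀ u v → adj u v ≡ adj v u
    irrefl : ∀ v → adj v v ≡ false

open Graph public

countTrue : ∀ {n} → (Fin n → Bool) → ℕ
countTrue {zero} f = 0
countTrue {suc n} f with f Data.Fin.zero
... | true  = suc (countTrue (λ i → f (Data.Fin.suc i)))
... | false = countTrue (λ i → f (Data.Fin.suc i))

sumFin : ∀ {n} → (Fin n → ℕ) → ℕ
sumFin {zero} f = 0
sumFin {suc n} f = f Data.Fin.zero + sumFin (λ i → f (Data.Fin.suc i))

degree : ∀ {n} → Graph n → Fin n → ℕ
degree G v = countTrue (adj G v)

degreeSum : ∀ {n} → Graph n → ℕ
degreeSum G = sumFin (degree G)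

nextIdx : ∀ {L} → Fin L → Fin L
nextIdx {suc L} i with Data.Fin.toℕ i Data.Nat.<? L
... | Relation.Nullary.yes p = Data.Fin.fromℕ< (Data.Nat.s≤s p)
... | Relation.Nullary.no _  = Data.Fin.zero
  where open import Relation.Nullary using (yes; no)

record Cycle {n : ℕ} (G : Graph n) (L : ℕ) : Set where
  field
    len≥3 : 3 ≤ L
    vert  : Fin L → Fin n
    inj   : Injective _≡_ _≡_ vert
    edges : ∀ i → adj G (vert i) (vert (nextIdx i)) ≡ true

open Cycle public

HasConsecutiveEvenCycles : ∀ {n} → Graph n → ℕ → Set
HasConsecutiveEvenCycles G k =
  Σ ℕ λ r → 2 ≤ r ×
  Σ ((i : Fin k) → Cycle G (2 * r + 2 * toℕ i)) λ C →
    ∀ i j (a : Fin (2 * r + 2 * toℕ i)) (b : Fin (2 * r + 2 * toℕ j)) →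
      i ≢ j → vert (C i) a ≢ vert (C j) b

{-# OPTIONS --safe #-}
-- Put K = k(k + 3)/2, half the total length of cycles of lengths 4, 6, …, 2k + 2. Fix a set S of
-- polylog(n) vertices and consider, for each length up to O(log n), the cycles of that length outside S
-- and, for each pair of vertices of S, the paths on 1, 2 or 3 vertices outside S that link them. Such a
-- class is rich if no small vertex set meets all its members; let U be the union of small hitting sets
-- of the classes that are not rich. A class with a member outside S ∪ U is rich, so its members can be
-- picked greedily, disjointly from anything chosen before. This yields the k cycles as soon as
--   * a vertex outside S ∪ U has K neighbours in S: link these neighbours cyclically;
--   * two vertices outside S ∪ U with at least K - O(k) neighbours in S are adjacent or have a common
--     neighbour outside S ∪ U: if their neighbourhoods differ much, divide the cycles among them,
--     otherwise use the longer links to save vertices of S;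
--   * a set W outside S ∪ U spans more than O(k)|W| edges: two consecutive levels of a breadth-first
--     search tree contain a long theta graph, whose vertices in the upper level are not all below the
--     same child of their last common ancestor, and a theta graph has paths of every even length
--     2, 4, …, 2k between two colour classes.
-- If none of this happens, the edges outside S ∪ U and those from there to S contribute at most
-- (2K - 2)n to the degree sum, so there are Ω(n) edges between U and the rest. Replacing S by S ∪ U
-- then adds Ω(n) to the number of edges at S, which is at most O(Kn): this happens O(1) times.
module Submission where

open import Defs
open import Data.Nat
  using (ℕ; zero; suc; _+_; _*_; _∸_; _^_; _≤_; _<_; z≤n; s≤s; _≤?_; _<?_; _%_; NonZero; nonZero;
    >-nonZero)
open import Data.Nat using () renaming (_≟_ to _≟ℕ_)
open import Data.Nat.Properties
  using (≤-refl; ≤-trans; ≤-reflexive; <⇒≤; ≤-pred; n≤1+n; m≤m+n; m≤n+m; +-mono-≤; *-monoʳ-≤;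
    *-monoˡ-≤; *-mono-≤; +-monoʳ-≤; +-monoˡ-≤; +-cancelʳ-≤; +-identityʳ; +-suc; +-comm; +-assoc;
    *-comm; *-distribˡ-+; *-zeroʳ; *-identityʳ; ≰⇒>; ≮⇒≥; <⇒≱; <-irrefl; m∸n≤m; m∸n+n≡m; m+n∸n≡m;
    m+n∸m≡n; <-cmp; ≤-total; ≤-<-trans; suc-injective; +-cancelˡ-≡; +-cancelʳ-≡; ^-monoʳ-≤; ^-monoˡ-≤;
    ^-distribˡ-+-*; ^-*-assoc; m≤n⇒m<n∨m≡n; <⇒≢; ≤-antisym; *-cancelˡ-≤; *-cancelˡ-<; 1+n≰n;
    m≤n⇒∃[o]m+o≡n; *-monoʳ-<; ∸-monoʳ-≤; n∸n≡0)
open import Data.Nat.Tactic.RingSolver using (solve; solve-∀)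
open import Data.Bool using (Bool; true; false; _∧_; _∨_; not; _xor_)
open import Data.Bool.Properties using (∧-comm; xor-comm)
open import Data.Fin using (Fin; toℕ; fromℕ<)
open import Data.Fin.Properties
  using (any?; all?; toℕ<n; toℕ-injective; toℕ-fromℕ<; injective⇒≤) renaming (_≟_ to _≟F_)
open import Data.List
  using (List; []; _∷_; _++_; length; applyUpTo; lookup; replicate; map; cartesianProductWith; upTo)
open import Data.List.Properties using (length-++; length-applyUpTo; length-replicate; length-map)
open import Data.List.Membership.Propositional using (_∈_; _∉_)
open import Data.List.Membership.Propositional.Properties
  using (∈-++⁺ˡ; ∈-++⁺ʳ; ∈-++⁻; ∈-lookup; ∈-applyUpTo⁻; ∈-applyUpTo⁺; ∈-cartesianProductWith⁺; ∈-map⁺;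
    ∈-upTo⁺)
open import Data.List.Relation.Unary.Any using (here; there)
open import Data.List.Relation.Unary.All using (All)
open import Data.List.Relation.Unary.Unique.Propositional using (Unique)
open import Data.Product using (Σ; ∃; _×_; _,_; proj₁; proj₂)
open import Data.Sum using (_⊎_; inj₁; inj₂; [_,_]′)
open import Data.Empty using (⊥; ⊥-elim)
open import Data.Unit using (⊤; tt)
open import Relation.Nullary using (¬_; Dec; yes; no)
open import Relation.Nullary.Decidable using (⌊_⌋; decidable-stable; _×-dec_; _→-dec_; ¬?)
open import Relation.Binary.PropositionalEquality
  using (_≡_; _≢_; refl; cong; cong₂; trans; subst; module ≡-Reasoning) renaming (sym to ≡-sym)
open import Function using (_∘_; id)
open import Relation.Binary.Definitions using (tri<; tri≈; tri>)
import Data.List.Relation.Unary.All as All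
import Data.List.Relation.Unary.AllPairs as AllPairs
import Data.List.Relation.Unary.Unique.Propositional.Properties as Uniq
import Data.Bool.Properties as Bool

-- The bound (2K - 2)n is an exact trade. An edge to S counts twice, so a vertex with K - 1
-- neighbours in S already spends 2K - 2 and has nothing left for edges outside S ∪ U. A vertex that
-- falls short of K by more than a slack linear in k can pay for such edges, and the O(k)|W| bound
-- is charged to these vertices. The others may be unable to pay for anything: edges among them must
-- be excluded, and a low vertex can afford one edge to them. The configurations with two vertices
-- enforce both. Their difficulty is that neither vertex alone need have enough neighbours for the
-- whole family. The second constraint is size. Pairs inside S ∪ U are bounded crudely by a square,
-- so |S ∪ U| must stay below a small multiple of √n. Breadth-first search keeps the cycles of the
-- dense case logarithmically short: there are only O(log n) classes of cycles, and k cycles occupy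
-- O(log n) vertices. A stage enlarges S polynomially, so after boundedly many stages S is still
-- polylogarithmic.

infixl 6 _⊕_
infixl 7 _⊗_

_⊕_ : ∀ {a b c d} → a ≤ b → c ≤ d → a + c ≤ b + d
_⊕_ = +-mono-≤

_⊗_ : ∀ c {a b} → a ≤ b → c * a ≤ c * b
c ⊗ h = *-monoʳ-≤ c h

-- Linear arithmetic: X ≤ Y is a combination of hypotheses, and the equation is left to the ring solver.
le-by : ∀ {X Y a b} d → X ≤ Y → a + Y + d ≡ b + X → a ≤ b
le-by {X} {Y} {a} {b} d h e = +-cancelʳ-≤ X a b
  (≤-trans (≤-trans (+-monoʳ-≤ a h) (m≤m+n (a + Y) d)) (≤-reflexive e))

-- Truth values, finite sums and cardinalities

true≢false : ∀ {b} → b ≡ true → b ≡ false → ⊥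
true≢false refl ()

not-true : ∀ {b} → ¬ (b ≡ true) → b ≡ false
not-true {true}  h = ⊥-elim (h refl)
not-true {false} h = refl

∧-intro : ∀ {a b} → a ≡ true → b ≡ true → a ∧ b ≡ true
∧-intro refl refl = refl

∧-elimˡ : ∀ {a b} → a ∧ b ≡ true → a ≡ true
∧-elimˡ {true} h = refl

∧-elimʳ : ∀ {a b} → a ∧ b ≡ true → b ≡ true
∧-elimʳ {true} h = h

∨-elim : ∀ {a b} → a ∨ b ≡ true → (a ≡ true) ⊎ (b ≡ true)
∨-elim {true}  h = inj₁ refl
∨-elim {false} h = inj₂ h

∨-introˡ : ∀ {a b} → a ≡ true → a ∨ b ≡ true
∨-introˡ refl = refl

∨-introʳ : ∀ {a b} → b ≡ true → a ∨ b ≡ true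
∨-introʳ {true}  _ = refl
∨-introʳ {false} h = h

not-elim : ∀ {a} → not a ≡ true → a ≡ false
not-elim {false} _ = refl

not-intro : ∀ {a} → a ≡ false → not a ≡ true
not-intro refl = refl

bool-cases : ∀ b → (b ≡ true) ⊎ (b ≡ false)
bool-cases true  = inj₁ refl
bool-cases false = inj₂ refl

⌊⌋-true : ∀ {p} {P : Set p} (d : Dec P) → P → ⌊ d ⌋ ≡ true
⌊⌋-true (yes _) _ = refl
⌊⌋-true (no ¬p) p = ⊥-elim (¬p p)

⌊⌋-sound : ∀ {p} {P : Set p} (d : Dec P) → ⌊ d ⌋ ≡ true → P
⌊⌋-sound (yes p) _ = p

infix 5 _==_
_==_ : ∀ {n} → Fin n → Fin n → Bool
u == v = ⌊ u ≟F v ⌋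

ι : Bool → ℕ
ι true  = 1
ι false = 0

ι≤1 : ∀ b → ι b ≤ 1
ι≤1 true  = ≤-refl
ι≤1 false = z≤n

ι-mono : ∀ {a b} → (a ≡ true → b ≡ true) → ι a ≤ ι b
ι-mono {true}  h rewrite h refl = ≤-refl
ι-mono {false} h = z≤n

∑-cong : ∀ {n} {f g : Fin n → ℕ} → (∀ i → f i ≡ g i) → sumFin f ≡ sumFin g
∑-cong {zero}  h = refl
∑-cong {suc n} h = cong₂ _+_ (h Fin.zero) (∑-cong (λ i → h (Fin.suc i)))

∑-mono : ∀ {n} {f g : Fin n → ℕ} → (∀ i → f i ≤ g i) → sumFin f ≤ sumFin g
∑-mono {zero}  h = z≤n
∑-mono {suc n} h = h Fin.zero ⊕ ∑-mono (λ i → h (Fin.suc i))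

interchange : ∀ a b c d → (a + b) + (c + d) ≡ (a + c) + (b + d)
interchange = solve-∀

∑-+ : ∀ {n} (f g : Fin n → ℕ) → sumFin (λ i → f i + g i) ≡ sumFin f + sumFin g
∑-+ {zero}  f g = refl
∑-+ {suc n} f g = trans (cong (f Fin.zero + g Fin.zero +_) (∑-+ (f ∘ Fin.suc) (g ∘ Fin.suc)))
  (interchange (f Fin.zero) (g Fin.zero) (sumFin (f ∘ Fin.suc)) (sumFin (g ∘ Fin.suc)))

∑-const : ∀ n c → sumFin {n} (λ _ → c) ≡ n * c
∑-const zero    c = refl
∑-const (suc n) c = cong (c +_) (∑-const n c)

∑-zero : ∀ n → sumFin {n} (λ _ → 0) ≡ 0
∑-zero n = trans (∑-const n 0) (*-zeroʳ n)

∑-* : ∀ {n} c (f : Fin n → ℕ) → sumFin (λ i → c * f i) ≡ c * sumFin f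
∑-* {zero}  c f = ≡-sym (*-zeroʳ c)
∑-* {suc n} c f = trans (cong (c * f Fin.zero +_) (∑-* c (f ∘ Fin.suc)))
  (≡-sym (*-distribˡ-+ c (f Fin.zero) _))

∑-swap : ∀ {m n} (f : Fin m → Fin n → ℕ) →
  sumFin (λ i → sumFin (λ j → f i j)) ≡ sumFin (λ j → sumFin (λ i → f i j))
∑-swap {zero}  {n} f = ≡-sym (∑-zero n)
∑-swap {suc m} {n} f = trans (cong (sumFin (f Fin.zero) +_) (∑-swap (f ∘ Fin.suc)))
  (≡-sym (∑-+ (f Fin.zero) (λ j → sumFin (λ i → f (Fin.suc i) j))))

∑-pick : ∀ {n} (w : Fin n) (f : Fin n → ℕ) → sumFin (λ u → ι (u == w) * f u) ≡ f w
∑-pick {suc n} Fin.zero f = trans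
  (cong₂ _+_ (+-identityʳ (f Fin.zero)) (trans (∑-cong {n} (λ _ → refl)) (∑-zero n)))
  (+-identityʳ (f Fin.zero))
∑-pick {suc n} (Fin.suc w) f = trans (∑-cong (λ i → cong (λ b → ι b * f (Fin.suc i)) (shift i w)))
  (∑-pick w (f ∘ Fin.suc))
  where
  shift : ∀ {n} (i w : Fin n) → (Fin.suc i == Fin.suc w) ≡ (i == w)
  shift i w with i ≟F w
  ... | yes _ = refl
  ... | no _  = refl

card : ∀ {n} → (Fin n → Bool) → ℕ
card P = sumFin (λ v → ι (P v))

card-mono : ∀ {n} {P Q : Fin n → Bool} → (∀ v → P v ≡ true → Q v ≡ true) → card P ≤ card Q
card-mono h = ∑-mono (λ v → ι-mono (h v))

card≤n : ∀ {n} (P : Fin n → Bool) → card P ≤ n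
card≤n {n} P = ≤-trans (∑-mono (λ v → ι≤1 (P v))) (≤-reflexive (trans (∑-const n 1) (*-identityʳ n)))

card-pos : ∀ {n} {P : Fin n → Bool} → 0 < card P → ∃ λ v → P v ≡ true
card-pos {n} {P} h with any? (λ v → P v Bool.≟ true)
... | yes p = p
... | no ¬p = ⊥-elim (<-irrefl (≡-sym (trans (∑-cong (λ v → cong ι (not-true (λ e → ¬p (v , e))))) (∑-zero n))) h)

card-single : ∀ {n} (w : Fin n) → card (_== w) ≡ 1
card-single w = trans (∑-cong (λ u → ≡-sym (*-identityʳ (ι (u == w))))) (∑-pick w (λ _ → 1))

card-∨ : ∀ {n} (P Q : Fin n → Bool) → card (λ v → P v ∨ Q v) ≤ card P + card Q
card-∨ P Q = ≤-trans (∑-mono (λ v → go (P v) (Q v))) (≤-reflexive (∑-+ (λ v → ι (P v)) (λ v → ι (Q v))))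
  where
  go : ∀ a b → ι (a ∨ b) ≤ ι a + ι b
  go true  b = m≤m+n 1 (ι b)
  go false b = ≤-refl

card≤1 : ∀ {n} (P : Fin n → Bool) → (∀ u v → P u ≡ true → P v ≡ true → u ≡ v) → card P ≤ 1
card≤1 P h with 1 ≤? card P
... | no ¬p = <⇒≤ (≰⇒> ¬p)
... | yes p with card-pos p
...   | w , pw = ≤-trans (card-mono (λ v pv → ⌊⌋-true (v ≟F w) (h v w pv pw))) (≤-reflexive (card-single w))

countTrue≡card : ∀ {n} (f : Fin n → Bool) → countTrue f ≡ card f
countTrue≡card {zero}  f = refl
countTrue≡card {suc n} f with f Fin.zero
... | true  = cong suc (countTrue≡card (f ∘ Fin.suc))
... | false = countTrue≡card (f ∘ Fin.suc)

module _ {n : ℕ} where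

  open import Data.List.Membership.DecPropositional (_≟F_ {n}) public using (_∈?_)

  memb : List (Fin n) → Fin n → Bool
  memb l v = ⌊ v ∈? l ⌋

  memb-true : ∀ {l v} → v ∈ l → memb l v ≡ true
  memb-true {l} {v} = ⌊⌋-true (v ∈? l)

  memb-sound : ∀ {l v} → memb l v ≡ true → v ∈ l
  memb-sound {l} {v} = ⌊⌋-sound (v ∈? l)

  card-memb : ∀ l → card (memb l) ≤ length l
  card-memb []      = ≤-reflexive (∑-zero n)
  card-memb (x ∷ l) = ≤-trans (card-mono {P = memb (x ∷ l)} {Q = λ v → (v == x) ∨ memb l v} go)
    (≤-trans (card-∨ (_== x) (memb l)) (≤-reflexive (card-single x) ⊕ card-memb l))
    where
    go : ∀ v → memb (x ∷ l) v ≡ true → (v == x) ∨ memb l v ≡ true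
    go v h with memb-sound {x ∷ l} h
    ... | here e  = ∨-introˡ (⌊⌋-true (v ≟F x) e)
    ... | there m = ∨-introʳ {v == x} (memb-true m)

  card≤length : ∀ (P : Fin n → Bool) l → (∀ v → P v ≡ true → v ∈ l) → card P ≤ length l
  card≤length P l h = ≤-trans (card-mono (λ v p → memb-true (h v p))) (card-memb l)

  -- An infinite sequence, meaningful below `M` and padded with `d`: successive cycles can take
  -- successive stretches of it by an offset alone.
  enumerate : (d : Fin n) (M : ℕ) (P : Fin n → Bool) → M ≤ card P →
    Σ (ℕ → Fin n) λ a → (∀ i → i < M → P (a i) ≡ true) × (∀ i j → i < M → j < M → a i ≡ a j → i ≡ j)
  enumerate d zero    P h = (λ _ → d) , (λ _ ()) , (λ _ _ ())
  enumerate d (suc M) P h with card-pos {P = P} (≤-trans (s≤s z≤n) h)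
  ... | w , pw with enumerate d M (λ v → P v ∧ not (v == w)) bound
    where
    go : ∀ p e → ι p ≤ ι e + ι (p ∧ not e)
    go true  true  = s≤s z≤n
    go true  false = ≤-refl
    go false e     = z≤n
    split : card P ≤ 1 + card (λ v → P v ∧ not (v == w))
    split = ≤-trans (∑-mono (λ v → go (P v) (v == w)))
      (≤-reflexive (trans (∑-+ (λ v → ι (v == w)) (λ v → ι (P v ∧ not (v == w)))) (cong (_+ card (λ v → P v ∧ not (v == w))) (card-single w))))
    bound : M ≤ card (λ v → P v ∧ not (v == w))
    bound = ≤-pred (≤-trans h split)
  ...   | a , aP , inj = b , bP , b-inj
    where
    b : ℕ → Fin n
    b zero    = w
    b (suc i) = a i
    bP : ∀ i → i < suc M → P (b i) ≡ true
    bP zero    _       = pw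
    bP (suc i) (s≤s l) = ∧-elimˡ (aP i l)
    ≢w : ∀ i → i < M → a i ≢ w
    ≢w i l e = true≢false (⌊⌋-true (a i ≟F w) e) (not-elim (∧-elimʳ {P (a i)} (aP i l)))
    b-inj : ∀ i j → i < suc M → j < suc M → b i ≡ b j → i ≡ j
    b-inj zero    zero    _ _ _ = refl
    b-inj zero    (suc j) _ (s≤s l) e = ⊥-elim (≢w j l (≡-sym e))
    b-inj (suc i) zero    (s≤s l) _ e = ⊥-elim (≢w i l e)
    b-inj (suc i) (suc j) (s≤s l) (s≤s l') e = cong suc (inj i j l l' e)

-- Exhaustive search and hitting sets

search : ∀ {n} m {Q : List (Fin n) → Set} → (∀ l → Dec (Q l)) → Dec (∃ λ l → length l ≡ m × Q l)
search zero Q? with Q? []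
... | yes q = yes ([] , refl , q)
... | no ¬q = no λ { ([] , _ , q) → ¬q q }
search (suc m) {Q} Q? with any? (λ x → search m {λ l → Q (x ∷ l)} (λ l → Q? (x ∷ l)))
... | yes (x , l , e , q) = yes (x ∷ l , cong suc e , q)
... | no ¬q = no λ { (x ∷ l , e , q) → ¬q (x , l , suc-injective e , q) }

search≤ : ∀ {n} m {Q : List (Fin n) → Set} → (∀ l → Dec (Q l)) → Dec (∃ λ l → length l ≤ m × Q l)
search≤ zero Q? with Q? []
... | yes q = yes ([] , z≤n , q)
... | no ¬q = no λ { ([] , _ , q) → ¬q q }
search≤ (suc m) {Q} Q? with Q? [] | any? (λ x → search≤ m {λ l → Q (x ∷ l)} (λ l → Q? (x ∷ l)))
... | yes q | _ = yes ([] , z≤n , q)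
... | no _  | yes (x , l , e , q) = yes (x ∷ l , s≤s e , q)
... | no ¬r | no ¬q = no λ { ([] , _ , q) → ¬r q ; (x ∷ l , s≤s e , q) → ¬q (x , l , e , q) }

Avoids : ∀ {n} → List (Fin n) → List (Fin n) → Set
Avoids X l = ∀ v → v ∈ l → v ∉ X

avoids? : ∀ {n} (X l : List (Fin n)) → Dec (Avoids X l)
avoids? X l with All.all? (λ v → ¬? (v ∈? X)) l
... | yes p = yes (λ v m → All.lookup p m)
... | no ¬p = no (λ h → ¬p (All.tabulate (λ {v} m → h v m)))

avoids-++ˡ : ∀ {n} X {Y l : List (Fin n)} → Avoids (X ++ Y) l → Avoids X l
avoids-++ˡ X h v m x = h v m (∈-++⁺ˡ x)

avoids-++ʳ : ∀ {n} X {Y l : List (Fin n)} → Avoids (X ++ Y) l → Avoids Y l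
avoids-++ʳ X h v m x = h v m (∈-++⁺ʳ X x)

unique-++ : ∀ {n} {xs ys : List (Fin n)} → Unique xs → Unique ys → (∀ v → v ∈ xs → v ∉ ys) → Unique (xs ++ ys)
unique-++ u u' d = Uniq.++⁺ u u' (λ { {v} (m , m') → d v m m' })

unique-∷ : ∀ {n} {x : Fin n} {xs} → x ∉ xs → Unique xs → Unique (x ∷ xs)
unique-∷ h u = All.tabulate (λ m e → h (subst (_∈ _) (≡-sym e) m)) AllPairs.∷ u

lookup-inj : ∀ {n} (l : List (Fin n)) → Unique l → ∀ i j → lookup l i ≡ lookup l j → i ≡ j
lookup-inj (x ∷ l) (p AllPairs.∷ u) Fin.zero    Fin.zero    e = refl
lookup-inj (x ∷ l) (p AllPairs.∷ u) Fin.zero    (Fin.suc j) e = ⊥-elim (All.lookup p (∈-lookup j) e)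
lookup-inj (x ∷ l) (p AllPairs.∷ u) (Fin.suc i) Fin.zero    e = ⊥-elim (All.lookup p (∈-lookup i) (≡-sym e))
lookup-inj (x ∷ l) (p AllPairs.∷ u) (Fin.suc i) (Fin.suc j) e = cong Fin.suc (lookup-inj l u i j e)

module Hitting {n : ℕ} (Q : List (Fin n) → Set) (Q? : ∀ l → Dec (Q l)) (m N : ℕ) (S : List (Fin n)) where

  Witness : List (Fin n) → Set
  Witness X = ∃ λ l → length l ≡ m × Q l × Avoids S l × Avoids X l

  -- With `N` at least the number of vertices on all the cycles together, the part of the family
  -- built so far is always an admissible `X`.
  Rich : Set
  Rich = ∀ X → length X ≤ N → Witness X

  -- Exhaustive search over hitting sets replaces the choice of a maximal disjoint family of witnesses.
  rich-or-hit : Rich ⊎ (∃ λ X → length X ≤ N × ¬ Witness X)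
  rich-or-hit with search≤ N {λ X → ¬ Witness X} (λ X → ¬? (W? X))
    where
    W? : ∀ X → Dec (Witness X)
    W? X = search m (λ l → Q? l ×-dec (avoids? S l ×-dec avoids? X l))
  ... | yes (X , b , h) = inj₂ (X , b , h)
  ... | no ¬h = inj₁ (λ X b → decidable-stable
          (search m (λ l → Q? l ×-dec (avoids? S l ×-dec avoids? X l))) (λ ¬w → ¬h (X , b , ¬w)))

-- Cycles as vertex lists, and disjoint families

module Cycles {n : ℕ} (G : Graph n) where

  V : Set
  V = Fin n

  -- The list holds interior vertices only: a connector between vertices of S can then avoid S
  -- altogether, and a cycle is a chain from a vertex back to itself.
  Chain : V → List V → V → Set
  Chain a []      b = adj G a b ≡ true
  Chain a (x ∷ l) b = adj G a x ≡ true × Chain x l b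

  chain? : ∀ a l b → Dec (Chain a l b)
  chain? a []      b = adj G a b Bool.≟ true
  chain? a (x ∷ l) b = (adj G a x Bool.≟ true) ×-dec chain? x l b

  chain-++ : ∀ a l b l' c → Chain a l b → Chain b l' c → Chain a (l ++ b ∷ l') c
  chain-++ a []      b l' c h h'       = h , h'
  chain-++ a (x ∷ l) b l' c (e , h) h' = e , chain-++ x l b l' c h h'

  IsCyc : ℕ → List V → Set
  IsCyc L []      = ⊥
  IsCyc L (a ∷ l) = length (a ∷ l) ≡ L × Unique (a ∷ l) × Chain a l a

  isCyc? : ∀ L l → Dec (IsCyc L l)
  isCyc? L []      = no (λ ())
  isCyc? L (a ∷ l) = (length (a ∷ l) ≟ℕ L) ×-dec (unique? (a ∷ l) ×-dec chain? a l a)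
    where
    open import Data.List.Relation.Unary.Unique.DecPropositional (_≟F_ {n}) using (unique?)

  chain-step : ∀ a l b → Chain a l b → (i : Fin (suc (length l))) (p : toℕ i < length l) →
    adj G (lookup (a ∷ l) i) (lookup (a ∷ l) (fromℕ< (s≤s p))) ≡ true
  chain-step a (x ∷ l) b (e , h) Fin.zero    (s≤s z≤n) = e
  chain-step a (x ∷ l) b (e , h) (Fin.suc i) (s≤s p)   = chain-step x l b h i p

  chain-last : ∀ a l b → Chain a l b → (i : Fin (suc (length l))) → ¬ (toℕ i < length l) →
    adj G (lookup (a ∷ l) i) b ≡ true
  chain-last a []      b h       Fin.zero    p = h
  chain-last a (x ∷ l) b (e , h) Fin.zero    p = ⊥-elim (p (s≤s z≤n))
  chain-last a (x ∷ l) b (e , h) (Fin.suc i) p = chain-last x l b h i (λ q → p (s≤s q))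

  toCycle : ∀ L c → 3 ≤ L → IsCyc L c → Σ (Cycle G L) λ C → ∀ i → vert C i ∈ c
  toCycle .(length (a ∷ l)) (a ∷ l) 3≤L (refl , u , ch) =
    record { len≥3 = 3≤L ; vert = lookup (a ∷ l) ; inj = λ {i} {j} → lookup-inj (a ∷ l) u i j ; edges = edge }
    , (λ i → ∈-lookup i)
    where
    edge : ∀ i → adj G (lookup (a ∷ l) i) (lookup (a ∷ l) (nextIdx i)) ≡ true
    edge i with toℕ i <? length l
    ... | yes p = chain-step a l a ch i p
    ... | no ¬p = chain-last a l a ch i ¬p

  -- `Fam X f k`: k disjoint cycles of lengths f 0, …, f (k - 1), all avoiding X.
  Fam : List V → (ℕ → ℕ) → ℕ → Set
  Fam X f zero    = ⊤
  Fam X f (suc k) = ∃ λ c → IsCyc (f 0) c × Avoids X c × Fam (c ++ X) (f ∘ suc) k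

  fam-cycle : ∀ {X} f k → Fam X f k → (i : Fin k) → ∃ λ c → IsCyc (f (toℕ i)) c
  fam-cycle f (suc k) (c , h , _ , F) Fin.zero    = c , h
  fam-cycle f (suc k) (c , h , _ , F) (Fin.suc i) = fam-cycle (f ∘ suc) k F i

  fam-avoids : ∀ {X} f k (F : Fam X f k) (i : Fin k) → Avoids X (proj₁ (fam-cycle f k F i))
  fam-avoids f (suc k) (c , h , d , F) Fin.zero    = d
  fam-avoids f (suc k) (c , h , d , F) (Fin.suc i) = avoids-++ʳ c (fam-avoids (f ∘ suc) k F i)

  fam-disjoint : ∀ {X} f k (F : Fam X f k) (i j : Fin k) → i ≢ j →
    Avoids (proj₁ (fam-cycle f k F i)) (proj₁ (fam-cycle f k F j))
  fam-disjoint f (suc k) F Fin.zero Fin.zero ne = ⊥-elim (ne refl)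
  fam-disjoint f (suc k) (c , h , d , F) Fin.zero (Fin.suc j) ne = avoids-++ˡ c (fam-avoids (f ∘ suc) k F j)
  fam-disjoint f (suc k) (c , h , d , F) (Fin.suc i) Fin.zero ne v m m' =
    avoids-++ˡ c (fam-avoids (f ∘ suc) k F i) v m' m
  fam-disjoint f (suc k) (c , h , d , F) (Fin.suc i) (Fin.suc j) ne =
    fam-disjoint (f ∘ suc) k F i j (λ e → ne (cong Fin.suc e))

  fam-result : ∀ k r → 2 ≤ r → Fam [] (λ i → 2 * r + 2 * i) k → HasConsecutiveEvenCycles G k
  fam-result k r 2≤r F = r , 2≤r , (λ i → proj₁ (C i)) ,
    λ i j a b ne e → fam-disjoint f k F i j ne (vert (proj₁ (C j)) b) (proj₂ (C j) b)
      (subst (_∈ proj₁ (fam-cycle f k F i)) e (proj₂ (C i) a))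
    where
    f : ℕ → ℕ
    f i = 2 * r + 2 * i
    C : ∀ i → Σ (Cycle G (f (toℕ i))) λ C → ∀ j → vert C j ∈ proj₁ (fam-cycle f k F i)
    C i = toCycle (f (toℕ i)) (proj₁ (fam-cycle f k F i))
      (≤-trans (n≤1+n 3) (≤-trans (2 ⊗ 2≤r) (m≤m+n (2 * r) (2 * toℕ i)))) (proj₂ (fam-cycle f k F i))

-- Cycles through prescribed vertices of S

-- `(m , ms)` prescribes a cycle through suc (length ms) vertices of S, consecutive ones being
-- joined through paths of m, resp. of the entries of ms, vertices outside S.
Spec : Set
Spec = ℕ × List ℕ

steps : List ℕ → ℕ
steps []       = 0
steps (m ∷ ms) = suc m + steps ms

cycLen : Spec → ℕ
cycLen (m , ms) = suc (m + steps ms)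

anchors : Spec → ℕ
anchors (m , ms) = suc (length ms)

total : (ℕ → ℕ) → ℕ → ℕ
total f zero    = 0
total f (suc c) = f 0 + total (f ∘ suc) c

total-cong : ∀ {f g} c → (∀ i → f i ≡ g i) → total f c ≡ total g c
total-cong zero    h = refl
total-cong (suc c) h = cong₂ _+_ (h 0) (total-cong c (h ∘ suc))

total-+ : ∀ f c d → total f (c + d) ≡ total f c + total (λ i → f (c + i)) d
total-+ f zero    d = refl
total-+ f (suc c) d = trans (cong (f 0 +_) (total-+ (f ∘ suc) c d)) (≡-sym (+-assoc (f 0) _ _))

fits : ∀ o t r {M} → o + (suc t + r) ≤ M → o + t < M
fits o t r {M} h = le-by r h (solve (o ∷ t ∷ r ∷ M ∷ []))

fits₀ : ∀ o t r {M} → o + (suc t + r) ≤ M → o < M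
fits₀ o t r h = ≤-<-trans (m≤m+n o t) (fits o t r h)

module Linked {n : ℕ} (G : Graph n) (S : List (Fin n)) (N : ℕ) where

  open Cycles G

  Conn : V → V → List V → Set
  Conn a b l = Unique l × Chain a l b

  conn? : ∀ a b l → Dec (Conn a b l)
  conn? a b l = unique? l ×-dec chain? a l b
    where open import Data.List.Relation.Unary.Unique.DecPropositional (_≟F_ {n}) using (unique?)

  RichConn : V → V → ℕ → Set
  RichConn a b m = Hitting.Rich (Conn a b) (conn? a b) m N S

  module Realize
    (a : ℕ → V) (M : ℕ) (Ok : ℕ → Set)
    (inj-a : ∀ i j → i < M → j < M → a i ≡ a j → i ≡ j)
    (a∈S : ∀ i → i < M → a i ∈ S)
    (rich : ∀ i j m → i < M → j < M → Ok m → RichConn (a i) (a j) m)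
    where

    LinkElement : ℕ → ℕ → V → Set
    LinkElement o t v = v ∉ S ⊎ (∃ λ i → o < i × i ≤ o + t × v ≡ a i)

    link : ∀ f o m ms X → f < M → o + length ms < M → Ok m → All Ok ms →
      length X + (m + steps ms) ≤ N → (∀ i → o < i → i < M → a i ∉ X) →
      ∃ λ l → length l ≡ m + steps ms × Unique l × Chain (a o) l (a f) × Avoids X l ×
        (∀ v → v ∈ l → LinkElement o (length ms) v)
    link f o m [] X f< o< okm All.[] budget fresh
      with rich o f m (subst (_< M) (+-identityʳ o) o<) f< okm X (≤-trans (m≤m+n _ _) budget)
    ... | l , len , (u , ch) , avS , avX =
      l , trans len (≡-sym (+-identityʳ m)) , u , ch , avX , λ v v∈ → inj₁ (avS v v∈)
    link f o m (m' ∷ ms) X f< o< okm (okm' All.∷ okms) budget fresh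
      with link f (suc o) m' ms X f< o<' okm' okms (≤-trans shorter budget)
             (λ i l → fresh i (≤-trans (n≤1+n _) l))
      where
      o<' : suc o + length ms < M
      o<' = subst (_< M) (+-suc o (length ms)) o<
      shorter : length X + (m' + steps ms) ≤ length X + (m + steps (m' ∷ ms))
      shorter = +-monoʳ-≤ (length X) (≤-trans (n≤1+n _) (m≤n+m _ m))
    ... | l' , len' , u' , ch' , avX' , el'
      with rich o (suc o) m (≤-trans (s≤s (m≤m+n o _)) o<) so<M okm (X ++ l')
             (≤-trans (≤-reflexive (trans (length-++ X) (cong (length X +_) len')))
               (≤-trans (+-monoʳ-≤ (length X) (≤-trans (n≤1+n _) (m≤n+m _ m))) budget))
      where
      so<M : suc o < M
      so<M = ≤-trans (s≤s (≤-trans (m≤m+n (suc o) (length ms)) (≤-reflexive (≡-sym (+-suc o (length ms)))))) o<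
    ... | l , len , (u , ch) , avS , avX =
      l ++ a (suc o) ∷ l' , len″ , u″ , chain-++ (a o) l (a (suc o)) l' (a f) ch ch' , av″ , el″
      where
      so<M : suc o < M
      so<M = ≤-trans (s≤s (≤-trans (m≤m+n (suc o) (length ms)) (≤-reflexive (≡-sym (+-suc o (length ms)))))) o<
      len″ : length (l ++ a (suc o) ∷ l') ≡ m + steps (m' ∷ ms)
      len″ = trans (length-++ l) (cong₂ _+_ len (cong suc len'))
      anchor∉l' : a (suc o) ∉ l'
      anchor∉l' h with el' _ h
      ... | inj₁ ∉S = ∉S (a∈S (suc o) so<M)
      ... | inj₂ (i , lt , le , e) = <-irrefl (inj-a (suc o) i so<M
                (≤-trans (s≤s (≤-trans le (≤-reflexive (≡-sym (+-suc o (length ms)))))) o<) e) lt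
      u″ : Unique (l ++ a (suc o) ∷ l')
      u″ = unique-++ u (unique-∷ anchor∉l' u') λ
        { v v∈ (here e) → avS v v∈ (subst (_∈ S) (≡-sym e) (a∈S (suc o) so<M))
        ; v v∈ (there h) → avoids-++ʳ X avX v v∈ h }
      av″ : Avoids X (l ++ a (suc o) ∷ l')
      av″ v h with ∈-++⁻ l h
      ... | inj₁ h₁         = avoids-++ˡ X avX v h₁
      ... | inj₂ (here refl) = fresh (suc o) ≤-refl so<M
      ... | inj₂ (there h₂) = avX' v h₂
      el″ : ∀ v → v ∈ l ++ a (suc o) ∷ l' → LinkElement o (suc (length ms)) v
      el″ v h with ∈-++⁻ l h
      ... | inj₁ h₁         = inj₁ (avS v h₁)
      ... | inj₂ (here e)   = inj₂ (suc o , ≤-refl , ≤-trans (s≤s (m≤m+n o _)) (≤-reflexive (≡-sym (+-suc o _))) , e)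
      ... | inj₂ (there h₂) with el' v h₂
      ...   | inj₁ ∉S = inj₁ ∉S
      ...   | inj₂ (i , lt , le , e) = inj₂ (i , ≤-trans (n≤1+n _) lt , ≤-trans le (≤-reflexive (≡-sym (+-suc o _))) , e)

    -- `next` supplies `d` further cycles by other means, for instance from a second anchor
    -- sequence. It learns that every vertex used comes from `X`, lies outside S or is an anchor of
    -- this sequence, and so can keep its own anchors fresh.
    realize : (spec : ℕ → Spec) (L : ℕ → ℕ) → (∀ i → L i ≡ cycLen (spec i)) →
      (∀ i → Ok (proj₁ (spec i)) × All Ok (proj₂ (spec i))) →
      ∀ c d o X → o + total (anchors ∘ spec) c ≤ M → length X + total L c ≤ N →
      (∀ i → o ≤ i → i < M → a i ∉ X) →
      (∀ X' → length X' ≤ length X + total L c →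
        (∀ v → v ∈ X' → v ∈ X ⊎ (v ∉ S ⊎ (∃ λ i → i < M × v ≡ a i))) → Fam X' (λ i → L (c + i)) d) →
      Fam X L (c + d)
    realize spec L eqL ok zero d o X bo bX fresh next =
      next X (m≤m+n _ _) (λ v → inj₁)
    realize spec L eqL ok (suc c) d o X bo bX fresh next
      with link o o (proj₁ (spec 0)) (proj₂ (spec 0)) X
             (fits₀ o (length (proj₂ (spec 0))) (total (anchors ∘ spec ∘ suc) c) bo)
             (fits o (length (proj₂ (spec 0))) (total (anchors ∘ spec ∘ suc) c) bo)
             (proj₁ (ok 0)) (proj₂ (ok 0))
             (≤-trans (+-monoʳ-≤ (length X) (≤-trans (n≤1+n _) (≤-trans (≤-reflexive (≡-sym (eqL 0))) (m≤m+n _ _)))) bX)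
             (λ i l → fresh i (<⇒≤ l))
    ... | l , len , u , ch , av , el =
      a o ∷ l , (trans (cong suc len) (≡-sym (eqL 0)) , unique-∷ anchor∉l u , ch) , av' ,
      realize (spec ∘ suc) (L ∘ suc) (eqL ∘ suc) (ok ∘ suc) c d (o + anchors (spec 0)) (a o ∷ l ++ X)
        (≤-trans (≤-reflexive (+-assoc o _ _)) bo) (≤-trans (≤-reflexive budget) bX) fresh'
        (λ X' b h → next X' (≤-trans b (≤-reflexive budget)) (λ v m → origin v (h v m)))
      where
      o<M : o < M
      o<M = fits₀ o (length (proj₂ (spec 0))) (total (anchors ∘ spec ∘ suc) c) bo
      i<M : ∀ {i} → i ≤ o + length (proj₂ (spec 0)) → i < M
      i<M h = ≤-<-trans h (fits o (length (proj₂ (spec 0))) (total (anchors ∘ spec ∘ suc) c) bo)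
      budget : length (a o ∷ l ++ X) + total (L ∘ suc) c ≡ length X + total L (suc c)
      budget = trans (cong (λ z → suc z + total (L ∘ suc) c) (trans (length-++ l) (cong (_+ length X) len)))
        (trans (shuffle (proj₁ (spec 0) + steps (proj₂ (spec 0))) (length X) (total (L ∘ suc) c))
          (cong (λ z → length X + (z + total (L ∘ suc) c)) (≡-sym (eqL 0))))
        where
        shuffle : ∀ x y z → suc (x + y) + z ≡ y + (suc x + z)
        shuffle = solve-∀
      anchor∉l : a o ∉ l
      anchor∉l h with el _ h
      ... | inj₁ ∉S = ∉S (a∈S o o<M)
      ... | inj₂ (i , lt , le , e) = <-irrefl (inj-a o i o<M (i<M le) e) lt
      av' : Avoids X (a o ∷ l)
      av' v (here refl) = fresh o ≤-refl o<M
      av' v (there h)   = av v h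
      fresh' : ∀ i → o + anchors (spec 0) ≤ i → i < M → a i ∉ a o ∷ l ++ X
      fresh' i le lt (here e) = <-irrefl (inj-a o i o<M lt (≡-sym e))
        (≤-trans (≤-trans (s≤s (m≤m+n o _)) (≤-reflexive (≡-sym (+-suc o _)))) le)
      fresh' i le lt (there h) with ∈-++⁻ l h
      ... | inj₂ hX = fresh i (≤-trans (m≤m+n o _) le) lt hX
      ... | inj₁ hl with el _ hl
      ...   | inj₁ ∉S = ∉S (a∈S i lt)
      ...   | inj₂ (j , _ , le' , e) = <-irrefl (inj-a j i (i<M le') lt (≡-sym e))
                (≤-trans (s≤s le') (≤-trans (≤-reflexive (≡-sym (+-suc o _))) le))
      origin : ∀ v → v ∈ a o ∷ l ++ X ⊎ (v ∉ S ⊎ (∃ λ i → i < M × v ≡ a i)) →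
        v ∈ X ⊎ (v ∉ S ⊎ (∃ λ i → i < M × v ≡ a i))
      origin v (inj₂ r) = inj₂ r
      origin v (inj₁ (here e)) = inj₂ (inj₂ (o , o<M , e))
      origin v (inj₁ (there h)) with ∈-++⁻ l h
      ... | inj₂ hX = inj₁ hX
      ... | inj₁ hl with el _ hl
      ...   | inj₁ ∉S = inj₂ (inj₁ ∉S)
      ...   | inj₂ (i , _ , le , e) = inj₂ (inj₂ (i , i<M le , e))

-- How many vertices of S a family of cycles consumes

total-* : ∀ a f c → total (λ i → a * f i) c ≡ a * total f c
total-* a f zero    = ≡-sym (*-zeroʳ a)
total-* a f (suc c) = trans (cong (a * f 0 +_) (total-* a (f ∘ suc) c)) (≡-sym (*-distribˡ-+ a (f 0) _))

total-mono : ∀ {f g} c → (∀ i → f i ≤ g i) → total f c ≤ total g c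
total-mono zero    h = z≤n
total-mono (suc c) h = h 0 ⊕ total-mono c (h ∘ suc)

total-arith : ∀ a c → 2 * total (λ i → a + i) c + c ≡ 2 * a * c + c * c
total-arith a zero    = ≡-sym (trans (+-identityʳ _) (*-zeroʳ (2 * a)))
total-arith a (suc c) = begin
  2 * (a + 0 + total (λ i → a + suc i) c) + suc c  ≡⟨ cong (λ z → 2 * (a + 0 + z) + suc c) (total-cong c (+-suc a)) ⟩
  2 * (a + 0 + T) + suc c                          ≡⟨ regroup a T c ⟩
  (2 * T + c) + (2 * a + 1)                        ≡⟨ cong (_+ (2 * a + 1)) (total-arith (suc a) c) ⟩
  (2 * suc a * c + c * c) + (2 * a + 1)            ≡⟨ finish a c ⟩
  2 * a * suc c + suc c * suc c                    ∎
  where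
  open ≡-Reasoning
  T = total (λ i → suc a + i) c
  regroup : ∀ a T c → 2 * (a + 0 + T) + suc c ≡ (2 * T + c) + (2 * a + 1)
  regroup = solve-∀
  finish : ∀ a c → (2 * suc a * c + c * c) + (2 * a + 1) ≡ 2 * a * suc c + suc c * suc c
  finish = solve-∀

-- half the total length of cycles of lengths 4, 6, …, 2k + 2
halfTotal : ℕ → ℕ
halfTotal k = total (λ i → 2 + i) k

halfTotal-closed : ∀ k → 2 * halfTotal k ≡ k * k + 3 * k
halfTotal-closed k = +-cancelʳ-≡ k _ _ (trans (total-arith 2 k) (lemma k))
  where
  lemma : ∀ k → 2 * 2 * k + k * k ≡ k * k + 3 * k + k
  lemma = solve-∀

evenLen : ℕ → ℕ
evenLen i = 2 * 2 + 2 * i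

total-evenLen : ∀ k → total evenLen k ≡ 2 * halfTotal k
total-evenLen k = trans (total-cong k (λ i → ≡-sym (*-distribˡ-+ 2 2 i))) (total-* 2 (λ i → 2 + i) k)

-- With `(1 , ones i)` the cycle alternates between S and single outside vertices; its `2 * i + 4`
-- vertices include `i + 2` anchors, so `k` such cycles use exactly `halfTotal k`.
ones : ℕ → List ℕ
ones i = replicate (suc i) 1

ones-len : ∀ i → evenLen i ≡ cycLen (1 , ones i)
ones-len zero    = refl
ones-len (suc i) = trans (lemma i) (cong (2 +_) (ones-len i))
  where
  lemma : ∀ i → 2 * 2 + 2 * suc i ≡ 2 + (2 * 2 + 2 * i)
  lemma = solve-∀

ones-all : ∀ i → All (_≡ 1) (ones i)
ones-all zero    = refl All.∷ All.[]
ones-all (suc i) = refl All.∷ ones-all i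

ones-anchors : ∀ i → anchors (1 , ones i) ≡ 2 + i
ones-anchors i = cong suc (length-replicate (suc i))

-- A connector of two vertices and its anchor make three steps, an odd number, so these come in
-- pairs: six steps with two anchors instead of three.
tail₂ : ℕ → List ℕ
tail₂ 0 = 1 ∷ []
tail₂ 1 = 1 ∷ 1 ∷ []
tail₂ 2 = 1 ∷ 1 ∷ 1 ∷ []
tail₂ (suc (suc (suc i))) = 2 ∷ 2 ∷ tail₂ i

-- A connector of three vertices covers with one anchor the four steps that otherwise take two.
tail₃ : ℕ → List ℕ
tail₃ 0 = 1 ∷ []
tail₃ 1 = 1 ∷ 1 ∷ []
tail₃ (suc (suc i)) = 3 ∷ tail₃ i

OneOr : ℕ → ℕ → Set
OneOr m x = x ≡ 1 ⊎ x ≡ m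

-- Long connectors let the cycles be realised with only about two thirds of the anchors.
record Saving (m : ℕ) : Set where
  field
    tails    : ℕ → List ℕ
    tail-len : ∀ i → evenLen i ≡ cycLen (1 , tails i)
    tail-all : ∀ i → All (OneOr m) (tails i)
    tail-few : ∀ i → 3 * anchors (1 , tails i) ≤ 2 * (4 + i)

saving₂ : Saving 2
saving₂ = record { tails = tail₂ ; tail-len = len ; tail-all = all ; tail-few = few }
  where
  len : ∀ i → evenLen i ≡ cycLen (1 , tail₂ i)
  len 0 = refl
  len 1 = refl
  len 2 = refl
  len (suc (suc (suc i))) = trans (lemma i) (cong (6 +_) (len i))
    where
    lemma : ∀ i → 2 * 2 + 2 * suc (suc (suc i)) ≡ 6 + (2 * 2 + 2 * i)
    lemma = solve-∀
  all : ∀ i → All (OneOr 2) (tail₂ i)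
  all 0 = inj₁ refl All.∷ All.[]
  all 1 = inj₁ refl All.∷ inj₁ refl All.∷ All.[]
  all 2 = inj₁ refl All.∷ inj₁ refl All.∷ inj₁ refl All.∷ All.[]
  all (suc (suc (suc i))) = inj₂ refl All.∷ inj₂ refl All.∷ all i
  few : ∀ i → 3 * anchors (1 , tail₂ i) ≤ 2 * (4 + i)
  few 0 = m≤m+n 6 2
  few 1 = m≤m+n 9 1
  few 2 = m≤m+n 12 0
  few (suc (suc (suc i))) = le-by 0 (few i) (lemma (length (tail₂ i)) i)
    where
    lemma : ∀ t i → 3 * suc (suc (suc t)) + 2 * (4 + i) + 0 ≡ 2 * (4 + suc (suc (suc i))) + 3 * suc t
    lemma = solve-∀

saving₃ : Saving 3
saving₃ = record { tails = tail₃ ; tail-len = len ; tail-all = all ; tail-few = few }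
  where
  len : ∀ i → evenLen i ≡ cycLen (1 , tail₃ i)
  len 0 = refl
  len 1 = refl
  len (suc (suc i)) = trans (lemma i) (cong (4 +_) (len i))
    where
    lemma : ∀ i → 2 * 2 + 2 * suc (suc i) ≡ 4 + (2 * 2 + 2 * i)
    lemma = solve-∀
  all : ∀ i → All (OneOr 3) (tail₃ i)
  all 0 = inj₁ refl All.∷ All.[]
  all 1 = inj₁ refl All.∷ inj₁ refl All.∷ All.[]
  all (suc (suc i)) = inj₂ refl All.∷ all i
  few : ∀ i → 3 * anchors (1 , tail₃ i) ≤ 2 * (4 + i)
  few 0 = m≤m+n 6 2
  few 1 = m≤m+n 9 1
  few (suc (suc i)) = le-by 1 (few i) (lemma (length (tail₃ i)) i)
    where
    lemma : ∀ t i → 3 * suc (suc t) + 2 * (4 + i) + 1 ≡ 2 * (4 + suc (suc i)) + 3 * suc t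
    lemma = solve-∀

saving-total : ∀ {m} (s : Saving m) k → 3 * total (λ i → anchors (1 , Saving.tails s i)) k ≤ k * k + 7 * k
saving-total s k = ≤-trans (≤-reflexive (≡-sym (total-* 3 _ k)))
  (≤-trans (total-mono k (Saving.tail-few s))
    (≤-reflexive (+-cancelʳ-≡ k _ _ (trans (cong (_+ k) (total-* 2 (λ i → 4 + i) k)) (trans (total-arith 4 k) (lemma k))))))
  where
  lemma : ∀ k → 2 * 4 * k + k * k ≡ k * k + 7 * k + k
  lemma = solve-∀

-- Literals are kept on the right of products, where they do not unfold.
infixl 7 _⊗ʳ_
_⊗ʳ_ : ∀ {a b} → a ≤ b → ∀ c → a * c ≤ b * c
h ⊗ʳ c = *-monoˡ-≤ c h

-- 2 * slack k = 20 * c + 2, where c = 2 * (2 * k + 1) is the degree that forces a long theta graph.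
slack : ℕ → ℕ
slack k = k * 40 + 21

-- The 42 longest cycles use `42 * j + 945` anchors and the slack is `40 * j + 1701`, hence 378 =
-- 756 / 2. Any number of cycles above 40 would overtake the slack eventually.
top-total : ∀ j T → 378 ≤ j → 2 * T + 42 ≡ 2 * (2 + j) * 42 + 42 * 42 → slack (j + 42) ≤ T
top-total j T h e = *-cancelˡ-≤ 2 (le-by 0 (h ⊗ʳ 4 ⊕ ≤-reflexive (≡-sym e)) (lemma j T))
  where
  lemma : ∀ j t → 2 * ((j + 42) * 40 + 21) + (j * 4 + (2 * t + 42)) + 0 ≡ 2 * t + (1512 + (2 * (2 + j) * 42 + 42 * 42))
  lemma = solve-∀

top-total≤ : ∀ j T → 2 * T + 42 ≡ 2 * (2 + j) * 42 + 42 * 42 → T ≤ (j + 43) * 42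
top-total≤ j T e = *-cancelˡ-≤ 2 (le-by 1722 (≤-reflexive e) (lemma j T))
  where
  lemma : ∀ j t → 2 * t + (2 * (2 + j) * 42 + 42 * 42) + 1722 ≡ 2 * ((j + 43) * 42) + (2 * t + 42)
  lemma = solve-∀

-- Cycles through the neighbourhoods of one or two vertices

module Structured {n : ℕ} (G : Graph n) (S U : List (Fin n)) (N k σ : ℕ) where

  open Cycles G
  open Linked G S N

  module _
    (enough : total evenLen k ≤ N)
    (linked : ∀ a b m l → a ∈ S → b ∈ S → 1 ≤ m → m ≤ 3 → length l ≡ m → Conn a b l → Avoids (S ++ U) l → RichConn a b m)
    where

    nbr : V → V → Bool
    nbr v a = memb S a ∧ adj G v a

    degS : V → ℕ
    degS v = card (nbr v)

    nbr-S : ∀ v a → nbr v a ≡ true → a ∈ S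
    nbr-S v a h = memb-sound (∧-elimˡ h)

    nbr-adj : ∀ v a → nbr v a ≡ true → adj G v a ≡ true
    nbr-adj v a h = ∧-elimʳ {memb S a} h

    adj-sym : ∀ {u v} → adj G u v ≡ true → adj G v u ≡ true
    adj-sym {u} {v} h = trans (sym G v u) h

    via : ∀ v a b → v ∉ S ++ U → nbr v a ≡ true → nbr v b ≡ true → RichConn a b 1
    via v a b v∉ ha hb = linked a b 1 (v ∷ []) (nbr-S v a ha) (nbr-S v b hb) ≤-refl (s≤s z≤n) refl
      ((All.[] AllPairs.∷ AllPairs.[]) , adj-sym (nbr-adj v a ha) , nbr-adj v b hb) (λ { _ (here refl) → v∉ })

    star : ∀ v → v ∉ S ++ U → halfTotal k ≤ degS v → Fam [] evenLen k
    star v v∉ h with enumerate v (halfTotal k) (nbr v) h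
    ... | a , aP , inj = subst (Fam [] evenLen) (+-identityʳ k)
      (realize (λ i → 1 , ones i) evenLen ones-len (λ i → refl , ones-all i) k 0 0 []
        (≤-reflexive (total-cong k ones-anchors)) enough (λ _ _ _ ()) (λ _ _ _ → tt))
      where
      rich : ∀ i j m → i < halfTotal k → j < halfTotal k → m ≡ 1 → RichConn (a i) (a j) m
      rich i j m li lj refl = via v (a i) (a j) v∉ (aP i li) (aP j lj)
      open Realize a (halfTotal k) (_≡ 1) inj (λ i l → nbr-S v (a i) (aP i l)) rich

    -- `b` may lack σ of the neighbours needed for the whole family. The `g` longest cycles, which
    -- need at least σ, move to neighbours of `b'` that `b` does not have; `b` then suffices for the
    -- other `j`, and the two anchor sets are disjoint.
    twoStars : ∀ j g b b' → j + g ≡ k → b ∉ S ++ U → b' ∉ S ++ U →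
      halfTotal k ≤ degS b + σ → σ ≤ total (λ i → 2 + (j + i)) g →
      total (λ i → 2 + (j + i)) g ≤ card (λ a → nbr b' a ∧ not (nbr b a)) → Fam [] evenLen k
    twoStars j g b b' refl b∉ b'∉ big enough-top large
      with enumerate b (total (λ i → 2 + i) j) (nbr b) first | enumerate b' (total (λ i → 2 + (j + i)) g) (λ a → nbr b' a ∧ not (nbr b a)) large
      where
      first : total (λ i → 2 + i) j ≤ degS b
      first = +-cancelʳ-≤ (total (λ i → 2 + (j + i)) g) _ _
        (≤-trans (≤-reflexive (≡-sym (total-+ (λ i → 2 + i) j g))) (≤-trans big (+-monoʳ-≤ (degS b) enough-top)))
    ... | a , aP , inj | a' , aP' , inj' =
      R.realize (λ i → 1 , ones i) evenLen ones-len (λ i → refl , ones-all i) j g 0 []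
        (≤-reflexive (total-cong j ones-anchors)) (≤-trans (≤-trans (m≤m+n _ _) (≤-reflexive (≡-sym splitLen))) enough) (λ _ _ _ ()) second
      where
      lower upper : ℕ
      lower = total (λ i → 2 + i) j
      upper = total (λ i → 2 + (j + i)) g
      rich : ∀ x y m → x < lower → y < lower → m ≡ 1 → RichConn (a x) (a y) m
      rich x y m lx ly refl = via b (a x) (a y) b∉ (aP x lx) (aP y ly)
      rich' : ∀ x y m → x < upper → y < upper → m ≡ 1 → RichConn (a' x) (a' y) m
      rich' x y m lx ly refl = via b' (a' x) (a' y) b'∉ (∧-elimˡ (aP' x lx)) (∧-elimˡ (aP' y ly))
      module R = Realize a lower (_≡ 1) inj (λ i l → nbr-S b (a i) (aP i l)) rich
      module R' = Realize a' upper (_≡ 1) inj' (λ i l → nbr-S b' (a' i) (∧-elimˡ (aP' i l))) rich'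
      splitLen : total evenLen (j + g) ≡ total evenLen j + total (λ i → evenLen (j + i)) g
      splitLen = total-+ evenLen j g
      second : ∀ X' → length X' ≤ total evenLen j →
        (∀ v → v ∈ X' → v ∈ [] ⊎ (v ∉ S ⊎ (∃ λ i → i < total (λ i → 2 + i) j × v ≡ a i))) →
        Fam X' (λ i → evenLen (j + i)) g
      second X' len orig = subst (Fam X' (λ i → evenLen (j + i))) (+-identityʳ g)
        (R'.realize (λ i → 1 , ones (j + i)) (λ i → evenLen (j + i)) (λ i → ones-len (j + i))
        (λ i → refl , ones-all (j + i)) g 0 0 X' (≤-reflexive (total-cong g (λ i → ones-anchors (j + i))))
        (≤-trans (+-monoˡ-≤ _ len) (≤-trans (≤-reflexive (≡-sym splitLen)) enough)) fresh (λ _ _ _ → tt))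
        where
        fresh : ∀ i → 0 ≤ i → i < total (λ i → 2 + (j + i)) g → a' i ∉ X'
        fresh i _ li h with orig (a' i) h
        ... | inj₁ ()
        ... | inj₂ (inj₁ ∉S) = ∉S (nbr-S b' (a' i) (∧-elimˡ (aP' i li)))
        ... | inj₂ (inj₂ (i' , l' , e)) = true≢false (aP i' l')
          (subst (λ v → nbr b v ≡ false) e (not-elim (∧-elimʳ {nbr b' (a' i)} (aP' i li))))

    -- Between common neighbours both kinds of connector are available: single vertices because of
    -- `b`, and `m` vertices because each common neighbour can be attached to either of `b` and
    -- `b'`.
    commonStar : ∀ m → Saving m → ∀ b b' → b ∉ S ++ U →
      (∀ a a' → nbr b a ≡ true → nbr b' a' ≡ true → RichConn a a' m) →
      k * k + 7 * k ≤ 3 * card (λ a → nbr b' a ∧ nbr b a) → Fam [] evenLen k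
    commonStar m s b b' b∉ across large
      with enumerate b (card (λ a → nbr b' a ∧ nbr b a)) (λ a → nbr b' a ∧ nbr b a) ≤-refl
    ... | a , aP , inj = subst (Fam [] evenLen) (+-identityʳ k)
      (realize (λ i → 1 , Saving.tails s i) evenLen (Saving.tail-len s) (λ i → inj₁ refl , Saving.tail-all s i) k 0 0 []
        (*-cancelˡ-≤ 3 (≤-trans (saving-total s k) large)) enough (λ _ _ _ ()) (λ _ _ _ → tt))
      where
      common : ℕ
      common = card (λ a → nbr b' a ∧ nbr b a)
      rich : ∀ i j x → i < common → j < common → OneOr m x → RichConn (a i) (a j) x
      rich i j x li lj (inj₁ refl) = via b (a i) (a j) b∉ (∧-elimʳ {nbr b' (a i)} (aP i li)) (∧-elimʳ {nbr b' (a j)} (aP j lj))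
      rich i j x li lj (inj₂ refl) = across (a i) (a j) (∧-elimʳ {nbr b' (a i)} (aP i li)) (∧-elimˡ (aP j lj))
      open Realize a common (OneOr m) inj (λ i l → nbr-S b' (a i) (∧-elimˡ (aP i l))) rich

    -- If `b'` has fewer than T neighbours of its own, at least K - σ - T are common. That is about
    -- k²/2, while long connectors need only about k²/3 anchors; `numeric` is this margin.
    twoBig : ∀ m → Saving m → ∀ j g b b' → j + g ≡ k → b ∉ S ++ U → b' ∉ S ++ U →
      halfTotal k ≤ degS b + σ → halfTotal k ≤ degS b' + σ → σ ≤ total (λ i → 2 + (j + i)) g →
      6 * (total (λ i → 2 + (j + i)) g + σ) + 2 * (k * k + 7 * k) ≤ 3 * (k * k + 3 * k) →
      (∀ a a' → nbr b a ≡ true → nbr b' a' ≡ true → RichConn a a' m) → Fam [] evenLen k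
    twoBig m s j g b b' j+g≡k b∉ b'∉ big big' enough-top numeric across
      with total (λ i → 2 + (j + i)) g ≤? card (λ a → nbr b' a ∧ not (nbr b a))
    ... | yes large = twoStars j g b b' j+g≡k b∉ b'∉ big enough-top large
    ... | no small = commonStar m s b b' b∉ across common
      where
      T D I : ℕ
      T = total (λ i → 2 + (j + i)) g
      D = card (λ a → nbr b' a ∧ not (nbr b a))
      I = card (λ a → nbr b' a ∧ nbr b a)
      parts : degS b' ≤ D + I
      parts = ≤-trans (∑-mono (λ a → go (nbr b' a) (nbr b a)))
        (≤-reflexive (∑-+ (λ a → ι (nbr b' a ∧ not (nbr b a))) (λ a → ι (nbr b' a ∧ nbr b a))))
        where
        go : ∀ x y → ι x ≤ ι (x ∧ not y) + ι (x ∧ y)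
        go true  true  = ≤-refl
        go true  false = ≤-refl
        go false y     = z≤n
      common : k * k + 7 * k ≤ 3 * I
      common = *-cancelˡ-≤ 2 (le-by 0 (6 ⊗ big' ⊕ 6 ⊗ parts ⊕ 6 ⊗ <⇒≤ (≰⇒> small) ⊕ 3 ⊗ ≤-reflexive (≡-sym (halfTotal-closed k)) ⊕ numeric)
        (lemma (k * k + 7 * k) (k * k + 3 * k) (halfTotal k) (degS b') D I T σ))
        where
        lemma : ∀ x y h d D I T s →
          2 * x + (6 * (d + s) + 6 * (D + I) + 6 * T + 3 * (2 * h) + 3 * y) + 0
          ≡ 2 * (3 * I) + (6 * h + 6 * d + 6 * D + 3 * y + (6 * (T + s) + 2 * x))
        lemma = solve-∀

-- Dense subgraphs contain consecutive even cycles

-- Ordered pairs are counted, so an edge inside `A` counts twice in `pairs E A A`; hence the factor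
-- 2 in `peel`.
pairs : ∀ {n} → (Fin n → Fin n → Bool) → (Fin n → Bool) → (Fin n → Bool) → ℕ
pairs E A B = sumFin λ u → sumFin λ v → ι (A u ∧ (B v ∧ E u v))

pairs-mono : ∀ {n} {E E' : Fin n → Fin n → Bool} {A A' B B'} →
  (∀ u v → A u ≡ true → B v ≡ true → E u v ≡ true → (A' u ∧ (B' v ∧ E' u v)) ≡ true) → pairs E A B ≤ pairs E' A' B'
pairs-mono {E = E} {A = A} {B = B} h = ∑-mono λ u → ∑-mono λ v → ι-mono λ t →
  h u v (∧-elimˡ t) (∧-elimˡ (∧-elimʳ {A u} t)) (∧-elimʳ {B v} (∧-elimʳ {A u} t))

pairs-sym : ∀ {n} {E : Fin n → Fin n → Bool} {A B} → (∀ u v → E u v ≡ E v u) → pairs E A B ≡ pairs E B A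
pairs-sym {E = E} {A} {B} s = trans (∑-swap (λ u v → ι (A u ∧ (B v ∧ E u v))))
  (∑-cong λ v → ∑-cong λ u → cong ι (trans (cong (λ e → A u ∧ (B v ∧ e)) (s u v)) (rot (A u) (B v) (E v u))))
  where
  rot : ∀ a b e → a ∧ (b ∧ e) ≡ b ∧ (a ∧ e)
  rot true  true  e = refl
  rot true  false e = refl
  rot false true  e = refl
  rot false false e = refl

pairs-row : ∀ {n} (E : Fin n → Fin n → Bool) A B → pairs E A B ≡ sumFin (λ u → ι (A u) * card (λ v → B v ∧ E u v))
pairs-row {n} E A B = ∑-cong go
  where
  go : ∀ u → sumFin (λ v → ι (A u ∧ (B v ∧ E u v))) ≡ ι (A u) * card (λ v → B v ∧ E u v)
  go u with A u
  ... | true  = ≡-sym (+-identityʳ _)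
  ... | false = ∑-zero n

pairs-≤ : ∀ {n} (E : Fin n → Fin n → Bool) A B c → (∀ u → A u ≡ true → card (λ v → B v ∧ E u v) ≤ c) → pairs E A B ≤ c * card A
pairs-≤ E A B c h = ≤-trans (≤-reflexive (pairs-row E A B))
  (≤-trans (∑-mono go) (≤-reflexive (∑-* c (λ u → ι (A u)))))
  where
  go : ∀ u → ι (A u) * card (λ v → B v ∧ E u v) ≤ c * ι (A u)
  go u with A u in eq
  ... | true  = ≤-trans (≤-reflexive (+-identityʳ _)) (≤-trans (h u eq) (≤-reflexive (≡-sym (*-identityʳ c))))
  ... | false = z≤n

pairs-≥ : ∀ {n} (E : Fin n → Fin n → Bool) A B c → (∀ u → A u ≡ true → c ≤ card (λ v → B v ∧ E u v)) → c * card A ≤ pairs E A B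
pairs-≥ E A B c h = ≤-trans (≤-reflexive (≡-sym (∑-* c (λ u → ι (A u)))))
  (≤-trans (∑-mono go) (≤-reflexive (≡-sym (pairs-row E A B))))
  where
  go : ∀ u → c * ι (A u) ≤ ι (A u) * card (λ v → B v ∧ E u v)
  go u with A u in eq
  ... | true  = ≤-trans (≤-reflexive (*-identityʳ c)) (≤-trans (h u eq) (≤-reflexive (≡-sym (+-identityʳ _))))
  ... | false = ≤-reflexive (*-zeroʳ c)

pairs-∨ : ∀ {n} (E : Fin n → Fin n → Bool) A B C → pairs E A (λ v → B v ∨ C v) ≤ pairs E A B + pairs E A C
pairs-∨ E A B C = ≤-trans (∑-mono λ u → ≤-trans (∑-mono λ v → go (A u) (B v) (C v) (E u v))
    (≤-reflexive (∑-+ (λ v → ι (A u ∧ (B v ∧ E u v))) (λ v → ι (A u ∧ (C v ∧ E u v))))))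
  (≤-reflexive (∑-+ (λ u → sumFin λ v → ι (A u ∧ (B v ∧ E u v))) (λ u → sumFin λ v → ι (A u ∧ (C v ∧ E u v)))))
  where
  go : ∀ a b c e → ι (a ∧ ((b ∨ c) ∧ e)) ≤ ι (a ∧ (b ∧ e)) + ι (a ∧ (c ∧ e))
  go true  true  c e = m≤m+n (ι e) _
  go true  false c e = ≤-refl
  go false b     c e = z≤n

module Peel {n : ℕ} (E : Fin n → Fin n → Bool) (E-sym : ∀ u v → E u v ≡ E v u) where

  remove : (Fin n → Bool) → Fin n → Fin n → Bool
  remove W u v = W v ∧ not (v == u)

  card-remove : ∀ W u → W u ≡ true → suc (card (remove W u)) ≤ card W
  card-remove W u Wu = ≤-trans (≤-reflexive (cong (_+ card (remove W u)) (≡-sym (card-single u))))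
    (≤-trans (≤-reflexive (≡-sym (∑-+ (λ v → ι (v == u)) (λ v → ι (remove W u v))))) (∑-mono go))
    where
    go : ∀ v → ι (v == u) + ι (W v ∧ not (v == u)) ≤ ι (W v)
    go v with v ≟F u
    ... | yes refl rewrite Wu = ≤-refl
    ... | no _ with W v
    ...   | true  = ≤-refl
    ...   | false = z≤n

  pairs-remove : ∀ W u → W u ≡ true →
    pairs E W W ≤ pairs E (remove W u) (remove W u) + 2 * card (λ v → W v ∧ E u v)
  pairs-remove W u Wu = ≤-trans (∑-mono λ x → ∑-mono λ v → go x v) (≤-reflexive sums)
    where
    f : Fin n → ℕ
    f v = ι (W v ∧ E u v)
    W' = remove W u
    mid₁ : ∀ p q r → p ≤ q + (p + 0 + r)
    mid₁ p q r = ≤-trans (m≤m+n p (q + r)) (≤-reflexive (lemma p q r))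
      where
      lemma : ∀ p q r → p + (q + r) ≡ q + (p + 0 + r)
      lemma = solve-∀
    mid₂ : ∀ p q r → p ≤ q + (r + (p + 0))
    mid₂ p q r = ≤-trans (m≤m+n p (q + r)) (≤-reflexive (lemma p q r))
      where
      lemma : ∀ p q r → p + (q + r) ≡ q + (r + (p + 0))
      lemma = solve-∀
    go : ∀ x v → ι (W x ∧ (W v ∧ E x v)) ≤ ι (W' x ∧ (W' v ∧ E x v)) + (ι (x == u) * f v + ι (v == u) * f x)
    go x v with x ≟F u | v ≟F u
    ... | yes refl | yes refl rewrite Wu = mid₁ (ι (E u u)) 0 (ι (E u u) + 0)
    ... | yes refl | no _ rewrite Wu = mid₁ (ι (W v ∧ E x v)) 0 0
    ... | no _ | yes refl rewrite Wu | E-sym x u = mid₂ (ι (W x ∧ E u x)) (ι ((W x ∧ true) ∧ false)) 0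
    ... | no _ | no _ = ≤-trans (≤-reflexive (cong₂ (λ a b → ι (a ∧ (b ∧ E x v))) (≡-sym (Bool.∧-identityʳ (W x))) (≡-sym (Bool.∧-identityʳ (W v))))) (m≤m+n _ _)
    sums : sumFin (λ x → sumFin λ v → ι (W' x ∧ (W' v ∧ E x v)) + (ι (x == u) * f v + ι (v == u) * f x))
      ≡ pairs E W' W' + 2 * sumFin f
    sums = begin
      sumFin (λ x → sumFin λ v → ι (W' x ∧ (W' v ∧ E x v)) + (ι (x == u) * f v + ι (v == u) * f x))
        ≡⟨ ∑-cong (λ x → trans (∑-+ (λ v → ι (W' x ∧ (W' v ∧ E x v))) (λ v → ι (x == u) * f v + ι (v == u) * f x))
             (cong (sumFin (λ v → ι (W' x ∧ (W' v ∧ E x v))) +_)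
               (trans (∑-+ (λ v → ι (x == u) * f v) (λ v → ι (v == u) * f x))
                 (cong₂ _+_ (∑-* (ι (x == u)) f) (∑-pick u (λ _ → f x)))))) ⟩
      sumFin (λ x → sumFin (λ v → ι (W' x ∧ (W' v ∧ E x v))) + (ι (x == u) * sumFin f + f x))
        ≡⟨ ∑-+ (λ x → sumFin (λ v → ι (W' x ∧ (W' v ∧ E x v)))) (λ x → ι (x == u) * sumFin f + f x) ⟩
      pairs E W' W' + sumFin (λ x → ι (x == u) * sumFin f + f x)
        ≡⟨ cong (pairs E W' W' +_) (trans (∑-+ (λ x → ι (x == u) * sumFin f) f)
             (cong₂ _+_ (∑-pick u (λ _ → sumFin f)) (≡-sym (+-identityʳ (sumFin f))))) ⟩
      pairs E W' W' + 2 * sumFin f ∎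
      where open ≡-Reasoning

  record Core (W : Fin n → Bool) (c : ℕ) : Set where
    field
      core   : Fin n → Bool
      core⊆  : ∀ v → core v ≡ true → W v ≡ true
      seed   : Fin n
      seed∈  : core seed ≡ true
      core-deg : ∀ u → core u ≡ true → c < card (λ v → core v ∧ E u v)

  -- Deleting a vertex with at most `c` neighbours costs at most `2 * c` ordered pairs, so the
  -- strict density is inherited and the deletions stop before the set is empty.
  peel : ∀ c fuel W → card W ≤ fuel → 2 * c * card W < pairs E W W → Core W c
  peel c fuel W bound dense with any? (λ u → (W u Bool.≟ true) ×-dec (card (λ v → W v ∧ E u v) ≤? c))
  peel c fuel W bound dense | no none with any? (λ u → W u Bool.≟ true)
  ... | yes (s , s∈) = record { core = W ; core⊆ = λ _ h → h ; seed = s ; seed∈ = s∈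
                              ; core-deg = λ u h → ≰⇒> (λ le → none (u , h , le)) }
  ... | no empty = ⊥-elim (<⇒≱ dense (≤-trans (pairs-≤ E W W 0 (λ u h → ⊥-elim (empty (u , h)))) z≤n))
  peel c zero W bound dense | yes (u , Wu , low) =
    ⊥-elim (<⇒≱ (card-remove W u Wu) (≤-trans bound z≤n))
  peel c (suc fuel) W bound dense | yes (u , Wu , low)
    with peel c fuel (remove W u) (≤-pred (≤-trans (card-remove W u Wu) bound)) dense'
    where
    dense' : 2 * c * card (remove W u) < pairs E (remove W u) (remove W u)
    dense' = le-by 0 (dense ⊕ pairs-remove W u Wu ⊕ 2 ⊗ low ⊕ (2 * c) ⊗ card-remove W u Wu)
      (lemma c (card (remove W u)) (card W) (pairs E W W) (pairs E (remove W u) (remove W u)) (card (λ v → W v ∧ E u v)))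
      where
      lemma : ∀ c r w e e' d → suc (2 * c * r) + (e + (e' + 2 * d) + 2 * c + 2 * c * w) + 0
        ≡ e' + (suc (2 * c * w) + e + 2 * d + 2 * c * suc r)
      lemma = solve-∀
  ... | K = record { core = Core.core K ; core⊆ = λ v h → ∧-elimˡ (Core.core⊆ K v h) ; seed = Core.seed K
                   ; seed∈ = Core.seed∈ K ; core-deg = Core.core-deg K }

-- Vertices are added one at a time, each on the side that cuts at least half of its edges backwards.
cut : ∀ {n} (R : Fin n → Fin n → Bool) → (∀ u v → R u v ≡ R v u) → (∀ v → R v v ≡ false) →
  Σ (Fin n → Bool) λ side → sumFin (λ u → sumFin λ v → ι (R u v)) ≤ 2 * sumFin (λ u → sumFin λ v → ι (R u v ∧ (side u xor side v)))
cut {zero}  R s i = (λ ()) , z≤n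
cut {suc n} R s i with cut {n} (λ u v → R (Fin.suc u) (Fin.suc v)) (λ u v → s (Fin.suc u) (Fin.suc v)) (λ v → i (Fin.suc v))
... | side , h = extend (≤-total (across true) (across false))
  where
  R' : Fin n → Fin n → Bool
  R' u v = R (Fin.suc u) (Fin.suc v)
  row : Fin n → Bool
  row v = R Fin.zero (Fin.suc v)
  across : Bool → ℕ
  across b = sumFin λ v → ι (row v ∧ (b xor side v))
  halves : sumFin (λ v → ι (row v)) ≡ across true + across false
  halves = trans (∑-cong (λ v → go (row v) (side v))) (∑-+ (λ v → ι (row v ∧ (true xor side v))) (λ v → ι (row v ∧ (false xor side v))))
    where
    go : ∀ r s → ι r ≡ ι (r ∧ (true xor s)) + ι (r ∧ (false xor s))
    go true  true  = refl
    go true  false = refl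
    go false s     = refl
  side⁺ : Bool → Fin (suc n) → Bool
  side⁺ b Fin.zero    = b
  side⁺ b (Fin.suc v) = side v
  goal : ∀ b → sumFin (λ v → ι (row v)) ≤ 2 * across b →
    sumFin (λ u → sumFin λ v → ι (R u v)) ≤ 2 * sumFin (λ u → sumFin λ v → ι (R u v ∧ (side⁺ b u xor side⁺ b v)))
  goal b large = ≤-trans (≤-reflexive lhs) (≤-trans (le-by 0 (h ⊕ 2 ⊗ large) (lemma (sumFin (λ v → ι (row v))) (across b) _ _))
      (*-monoʳ-≤ 2 (≤-reflexive (≡-sym rhs))))
    where
    lemma : ∀ r a x y → (2 * r + x) + (2 * y + 2 * (2 * a)) + 0 ≡ 2 * (2 * a + y) + (x + 2 * r)
    lemma = solve-∀
    twice : ∀ x y → 0 + x + (x + y) ≡ 2 * x + y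
    twice = solve-∀
    lhs : sumFin (λ u → sumFin λ v → ι (R u v)) ≡ 2 * sumFin (λ v → ι (row v)) + sumFin (λ u → sumFin λ v → ι (R' u v))
    lhs = trans (cong₂ (λ z w → ι z + sumFin (λ v → ι (row v)) + w) (i Fin.zero)
        (trans (∑-+ (λ u → ι (R (Fin.suc u) Fin.zero)) (λ u → sumFin λ v → ι (R' u v)))
          (cong (_+ sumFin (λ u → sumFin λ v → ι (R' u v))) (∑-cong (λ u → cong ι (s (Fin.suc u) Fin.zero))))))
      (twice (sumFin (λ v → ι (row v))) _)
    rhs : sumFin (λ u → sumFin λ v → ι (R u v ∧ (side⁺ b u xor side⁺ b v)))
      ≡ 2 * across b + sumFin (λ u → sumFin λ v → ι (R' u v ∧ (side u xor side v)))
    rhs = trans (cong₂ (λ z w → ι (z ∧ (b xor b)) + across b + w) (i Fin.zero)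
        (trans (∑-+ (λ u → ι (R (Fin.suc u) Fin.zero ∧ (side u xor b))) (λ u → sumFin λ v → ι (R' u v ∧ (side u xor side v))))
          (cong (_+ sumFin (λ u → sumFin λ v → ι (R' u v ∧ (side u xor side v))))
            (∑-cong (λ u → cong₂ (λ x y → ι (x ∧ y)) (s (Fin.suc u) Fin.zero) (xor-comm (side u) b))))))
      (twice (across b) _)
  extend : across true ≤ across false ⊎ across false ≤ across true →
    Σ (Fin (suc n) → Bool) λ side → sumFin (λ u → sumFin λ v → ι (R u v)) ≤ 2 * sumFin (λ u → sumFin λ v → ι (R u v ∧ (side u xor side v)))
  extend (inj₁ le) = side⁺ false , goal false (≤-trans (≤-reflexive halves) (le-by 0 le (lemma (across true) (across false))))
    where
    lemma : ∀ t f → t + f + f + 0 ≡ 2 * f + t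
    lemma = solve-∀
  extend (inj₂ le) = side⁺ true , goal true (≤-trans (≤-reflexive halves) (le-by 0 le (lemma (across true) (across false))))
    where
    lemma : ∀ t f → t + f + t + 0 ≡ 2 * t + f
    lemma = solve-∀

-- Breadth-first levels of a bipartite graph

module Levels {n : ℕ} (E : Fin n → Fin n → Bool) (E-sym : ∀ u v → E u v ≡ E v u)
  (W : Fin n → Bool) (root : Fin n) (root∈W : W root ≡ true)
  (side : Fin n → Bool) (bipartite : ∀ u v → E u v ≡ true → side u xor side v ≡ true) where

  vis : ℕ → Fin n → Bool
  touched? : ∀ i v → Dec (∃ λ u → vis i u ∧ E u v ≡ true)
  vis zero    v = v == root
  vis (suc i) v = vis i v ∨ (W v ∧ ⌊ touched? i v ⌋)
  touched? i v = any? (λ u → (vis i u ∧ E u v) Bool.≟ true)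

  lev : ℕ → Fin n → Bool
  lev zero    v = vis zero v
  lev (suc i) v = vis (suc i) v ∧ not (vis i v)

  vis-W : ∀ i v → vis i v ≡ true → W v ≡ true
  vis-W zero v h = subst (λ u → W u ≡ true) (≡-sym (⌊⌋-sound (v ≟F root) h)) root∈W
  vis-W (suc i) v h with ∨-elim {vis i v} h
  ... | inj₁ h' = vis-W i v h'
  ... | inj₂ h' = ∧-elimˡ h'

  vis-mono : ∀ {i j} v → i ≤ j → vis i v ≡ true → vis j v ≡ true
  vis-mono {i} {zero} v z≤n h = h
  vis-mono {i} {suc j} v le h with m≤n⇒m<n∨m≡n le
  ... | inj₁ (s≤s le') = ∨-introˡ (vis-mono v le' h)
  ... | inj₂ refl      = h

  vis-step : ∀ i u v → vis i u ≡ true → W v ≡ true → E u v ≡ true → vis (suc i) v ≡ true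
  vis-step i u v h w e = ∨-introʳ {vis i v} (∧-intro w (⌊⌋-true (touched? i v) (u , ∧-intro h e)))

  lev-vis : ∀ i v → lev i v ≡ true → vis i v ≡ true
  lev-vis zero    v h = h
  lev-vis (suc i) v h = ∧-elimˡ h

  lev-W : ∀ i v → lev i v ≡ true → W v ≡ true
  lev-W i v h = vis-W i v (lev-vis i v h)

  lev≰vis : ∀ i j v → lev (suc j) v ≡ true → vis i v ≡ true → ¬ (i ≤ j)
  lev≰vis i j v hl hv le = true≢false (vis-mono v le hv) (not-elim (∧-elimʳ {vis (suc j) v} hl))

  lev-≤ : ∀ i j v → lev i v ≡ true → vis j v ≡ true → i ≤ j
  lev-≤ zero    j v hl hv = z≤n
  lev-≤ (suc i) j v hl hv = ≰⇒> (lev≰vis j i v hl hv)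

  lev-unique : ∀ i j v → lev i v ≡ true → lev j v ≡ true → i ≡ j
  lev-unique i j v hi hj = ≤-antisym (lev-≤ i j v hi (lev-vis j v hj)) (lev-≤ j i v hj (lev-vis i v hi))

  vis-lev : ∀ i v → vis i v ≡ true → ∃ λ j → j ≤ i × lev j v ≡ true
  vis-lev zero v h = zero , z≤n , h
  vis-lev (suc i) v h with bool-cases (vis i v)
  ... | inj₁ h' = let (j , le , l) = vis-lev i v h' in j , ≤-trans le (n≤1+n i) , l
  ... | inj₂ h' = suc i , ≤-refl , ∧-intro h (not-intro h')

  parent : ∀ i v → lev (suc i) v ≡ true → ∃ λ u → lev i u ≡ true × E u v ≡ true
  parent i v h with ∨-elim {vis i v} (∧-elimˡ h)
  ... | inj₁ h' = ⊥-elim (true≢false h' (not-elim (∧-elimʳ {vis (suc i) v} h)))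
  ... | inj₂ h' with ⌊⌋-sound (touched? i v) (∧-elimʳ {W v} h')
  ...   | u , t with vis-lev i u (∧-elimˡ t)
  ...     | j , le , l with m≤n⇒m<n∨m≡n le
  ...       | inj₂ refl = u , l , ∧-elimʳ {vis i u} t
  ...       | inj₁ lt   = ⊥-elim (lev≰vis (suc j) i v h
                (vis-step j u v (lev-vis j u l) (vis-W (suc i) v (∧-elimˡ h)) (∧-elimʳ {vis i u} t)) lt)

  levelSide : ℕ → Bool
  levelSide zero    = side root
  levelSide (suc i) = not (levelSide i)

  lev-side : ∀ i v → lev i v ≡ true → side v ≡ levelSide i
  lev-side zero    v h = cong side (⌊⌋-sound (v ≟F root) h)
  lev-side (suc i) v h with parent i v h
  ... | u , l , e = opposite (side u) (side v) (levelSide i) (bipartite u v e) (lev-side i u l)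
    where
    opposite : ∀ a b c → a xor b ≡ true → a ≡ c → b ≡ not c
    opposite true  false .true  _ refl = refl
    opposite false true  .false _ refl = refl

  -- The bipartition excludes edges inside a level, since by `lev-side` a whole level lies on one
  -- side. Jumps over a level are excluded because a neighbour of a visited vertex is visited one
  -- step later.
  nbr-level : ∀ i u v → lev i u ≡ true → W v ≡ true → E u v ≡ true →
    lev (suc i) v ≡ true ⊎ (∃ λ j → i ≡ suc j × lev j v ≡ true)
  nbr-level i u v l w e with bool-cases (vis i v)
  ... | inj₂ h = inj₁ (∧-intro (vis-step i u v (lev-vis i u l) w e) (not-intro h))
  ... | inj₁ h with vis-lev i v h
  ...   | j , le , l' with m≤n⇒m<n∨m≡n le
  ...     | inj₂ refl = ⊥-elim (same (side u) (side v) (bipartite u v e) (trans (lev-side i u l) (≡-sym (lev-side i v l'))))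
    where
    same : ∀ a b → a xor b ≡ true → a ≡ b → ⊥
    same true  .true  () refl
    same false .false () refl
  ...     | inj₁ lt   = inj₂ (j , ≤-antisym (lev-≤ i (suc j) u l
              (vis-step j v u (lev-vis j v l') (lev-W i u l) (trans (E-sym v u) e))) lt , l')

  Dense : ℕ → ℕ → Set
  Dense c i = c * (card (lev i) + card (lev (suc i))) < pairs E (lev i) (lev (suc i))

  module Growth (c : ℕ) (c-pos : 0 < c) (deg : ∀ u → W u ≡ true → 5 * c < card (λ v → W v ∧ E u v)) where

    level-degree : ∀ i → 5 * c * card (lev i) ≤ pairs E (lev i) W
    level-degree i = pairs-≥ E (lev i) W (5 * c) (λ u h → <⇒≤ (deg u (lev-W i u h)))

    private
      cancel : ∀ {x y} → c * x ≤ c * y → x ≤ y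
      cancel {x} {y} = *-cancelˡ-≤ c ⦃ >-nonZero c-pos ⦄

    -- All edges at the middle one of three consecutive levels go to the outer two. For the sizes
    -- x₀, x₁, x₂, sparseness thus gives 5x₁ ≤ (x₀ + x₁) + (x₁ + x₂) after division by `c`, and with
    -- 2x₀ ≤ x₁ by induction this leaves 2x₂ ≥ 5x₁.
    doubling : ∀ i → (∀ j → j ≤ i → ¬ Dense c j) → 2 * card (lev i) ≤ card (lev (suc i))
    doubling zero sparse = cancel (le-by (2 * c * card (lev 0)) (level-degree 0 ⊕ pairs-mono {E = E} {E' = E} {A = lev 0} {A' = lev 0} {B = W} {B' = lev 1} next ⊕ ≮⇒≥ (sparse 0 z≤n))
        (lemma c (card (lev 0)) (card (lev 1)) (pairs E (lev 0) W) (pairs E (lev 0) (lev 1))))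
      where
      next : ∀ u v → lev 0 u ≡ true → W v ≡ true → E u v ≡ true → lev 0 u ∧ (lev 1 v ∧ E u v) ≡ true
      next u v hu hv e with nbr-level 0 u v hu hv e
      ... | inj₁ l = ∧-intro hu (∧-intro l e)
      lemma : ∀ c x y p q → c * (2 * x) + (p + q + c * (x + y)) + 2 * c * x ≡ c * y + (5 * c * x + p + q)
      lemma = solve-∀
    doubling (suc i) sparse = cancel (*-cancelˡ-≤ 2 (le-by (c * x₁)
        (2 ⊗ (level-degree (suc i) ⊕ split ⊕ ≮⇒≥ (sparse (suc i) ≤-refl)
            ⊕ ≤-trans (≤-reflexive (pairs-sym {E = E} {A = lev (suc i)} {B = lev i} E-sym)) (≮⇒≥ (sparse i (n≤1+n i))))
          ⊕ c ⊗ doubling i (λ j le → sparse j (≤-trans le (n≤1+n i))))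
        (lemma c x₀ x₁ x₂ (pairs E (lev (suc i)) W) (pairs E (lev (suc i)) (lev (suc (suc i)))) (pairs E (lev (suc i)) (lev i)))))
      where
      x₀ = card (lev i)
      x₁ = card (lev (suc i))
      x₂ = card (lev (suc (suc i)))
      next : ∀ u v → lev (suc i) u ≡ true → W v ≡ true → E u v ≡ true →
        lev (suc i) u ∧ ((lev (suc (suc i)) v ∨ lev i v) ∧ E u v) ≡ true
      next u v hu hv e with nbr-level (suc i) u v hu hv e
      ... | inj₁ l = ∧-intro hu (∧-intro (∨-introˡ l) e)
      ... | inj₂ (.i , refl , l) = ∧-intro hu (∧-intro (∨-introʳ {lev (suc (suc i)) v} l) e)
      split : pairs E (lev (suc i)) W ≤ pairs E (lev (suc i)) (lev (suc (suc i))) + pairs E (lev (suc i)) (lev i)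
      split = ≤-trans (pairs-mono {E = E} {E' = E} {A = lev (suc i)} {A' = lev (suc i)} {B = W} {B' = λ v → lev (suc (suc i)) v ∨ lev i v} next)
        (pairs-∨ E (lev (suc i)) (lev (suc (suc i))) (lev i))
      lemma : ∀ c x y z p q r → 2 * (c * (2 * y)) + (2 * (p + (q + r) + c * (y + z) + c * (x + y)) + c * y) + c * y
        ≡ 2 * (c * z) + (2 * (5 * c * y + p + q + r) + c * (2 * x))
      lemma = solve-∀

    size : ∀ i → (∀ j → j < i → ¬ Dense c j) → 2 ^ i ≤ card (lev i)
    size zero    _      = ≤-reflexive (≡-sym (card-single root))
    size (suc i) sparse = ≤-trans (2 ⊗ size i (λ j lt → sparse j (≤-trans lt (n≤1+n i)))) (doubling i (λ j le → sparse j (s≤s le)))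

    -- Doubling as far as level R + 1 would exceed n. The bound on the level is what keeps the
    -- cycles logarithmically short.
    dense-level : ∀ R → n < 2 ^ suc R → ∃ λ i → i ≤ R × Dense c i
    dense-level R big with any? {suc R} (λ i → c * (card (lev (toℕ i)) + card (lev (suc (toℕ i)))) <? pairs E (lev (toℕ i)) (lev (suc (toℕ i))))
    ... | yes (i , d) = toℕ i , ≤-pred (toℕ<n i) , d
    ... | no none = ⊥-elim (<⇒≱ big (≤-trans (size (suc R) λ j lt d →
            none (fromℕ< lt , subst (Dense c) (≡-sym (toℕ-fromℕ< lt)) d)) (card≤n (lev (suc R)))))

-- Paths as functions of position

∸-step : ∀ {s a} → s < a → a ∸ s ≡ suc (a ∸ suc s)
∸-step {zero}  {suc a} _       = refl
∸-step {suc s} {suc a} (s≤s h) = ∸-step h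

split-≤ : ∀ s a → s ≤ a ⊎ (∃ λ t → s ≡ suc a + t)
split-≤ s a with s ≤? a
... | yes h = inj₁ h
... | no ¬h = let (t , e) = m≤n⇒∃[o]m+o≡n (≰⇒> ¬h) in inj₂ (t , ≡-sym e)

record IsPath {V : Set} (F : V → V → Bool) (f : ℕ → V) (ℓ : ℕ) : Set where
  field
    step     : ∀ s → s < ℓ → F (f s) (f (suc s)) ≡ true
    distinct : ∀ s t → s < t → t ≤ ℓ → f s ≢ f t

open IsPath public

module _ {V : Set} where

  -- The edge from `f a` to `g 0` is a step of its own, so lengths `a` and `b` give `a + suc b`.
  glue : (ℕ → V) → ℕ → (ℕ → V) → ℕ → V
  glue f a g s with s ≤? a
  ... | yes _ = f s
  ... | no _  = g (s ∸ suc a)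

  glue-left : ∀ f a g {s} → s ≤ a → glue f a g s ≡ f s
  glue-left f a g {s} h with s ≤? a
  ... | yes _ = refl
  ... | no ¬h = ⊥-elim (¬h h)

  glue-right : ∀ f a g t → glue f a g (suc a + t) ≡ g t
  glue-right f a g t with suc a + t ≤? a
  ... | yes h = ⊥-elim (1+n≰n (≤-trans (m≤m+n (suc a) t) h))
  ... | no _  = cong g (m+n∸m≡n (suc a) t)

  glue-end : ∀ f a g b → glue f a g (a + suc b) ≡ g b
  glue-end f a g b = trans (cong (glue f a g) (+-suc a b)) (glue-right f a g b)

  glue-values : ∀ f a g b {P : V → Set} → (∀ s → s ≤ a → P (f s)) → (∀ s → s ≤ b → P (g s)) →
    ∀ s → s ≤ a + suc b → P (glue f a g s)
  glue-values f a g b {P} hf hg s le with split-≤ s a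
  ... | inj₁ h = subst P (≡-sym (glue-left f a g h)) (hf s h)
  ... | inj₂ (t , refl) = subst P (≡-sym (glue-right f a g t))
        (hg t (le-by 0 le (lemma a b t)))
    where
    lemma : ∀ a b t → t + (a + suc b) + 0 ≡ b + (suc a + t)
    lemma = solve-∀

  glue-path : ∀ {F} f a g b → IsPath F f a → IsPath F g b → F (f a) (g 0) ≡ true →
    (∀ s t → s ≤ a → t ≤ b → f s ≢ g t) → IsPath F (glue f a g) (a + suc b)
  glue-path {F} f a g b pf pg link disj = record { step = st ; distinct = ds }
    where
    bound : ∀ {t} → suc a + t ≤ a + suc b → t ≤ b
    bound {t} le = le-by 0 le (lemma a b t)
      where
      lemma : ∀ a b t → t + (a + suc b) + 0 ≡ b + (suc a + t)
      lemma = solve-∀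
    st : ∀ s → s < a + suc b → F (glue f a g s) (glue f a g (suc s)) ≡ true
    st s le with split-≤ s a
    ... | inj₂ (t , refl) = trans (cong₂ F (glue-right f a g t)
            (trans (cong (glue f a g) (≡-sym (+-suc (suc a) t))) (glue-right f a g (suc t))))
          (step pg t (bound (≤-trans (≤-reflexive (+-suc (suc a) t)) le)))
    ... | inj₁ h with m≤n⇒m<n∨m≡n h
    ...   | inj₁ lt   = trans (cong₂ F (glue-left f a g h) (glue-left f a g lt)) (step pf s lt)
    ...   | inj₂ refl = trans (cong₂ F (glue-left f a g h)
              (trans (cong (glue f a g) (cong suc (≡-sym (+-identityʳ a)))) (glue-right f a g 0))) link
    ds : ∀ s t → s < t → t ≤ a + suc b → glue f a g s ≢ glue f a g t
    ds s t lt le e with split-≤ s a | split-≤ t a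
    ... | inj₁ h | inj₁ h' = distinct pf s t lt h' (trans (≡-sym (glue-left f a g h)) (trans e (glue-left f a g h')))
    ... | inj₁ h | inj₂ (t' , refl) = disj s t' h (bound le) (trans (≡-sym (glue-left f a g h)) (trans e (glue-right f a g t')))
    ... | inj₂ (s' , refl) | inj₁ h' = 1+n≰n (≤-trans (≤-trans (m≤m+n (suc a) s') (<⇒≤ lt)) h')
    ... | inj₂ (s' , refl) | inj₂ (t' , refl) = distinct pg s' t' (le-by 0 lt (lemma a s' t')) (bound le)
            (trans (≡-sym (glue-right f a g s')) (trans e (glue-right f a g t')))
      where
      lemma : ∀ a s t → suc s + (suc a + t) + 0 ≡ t + suc (suc a + s)
      lemma = solve-∀

module _ {n : ℕ} (G : Graph n) where

  open Cycles G

  chain-applyUpTo : ∀ (f : ℕ → V) t b → (∀ s → s < t → adj G (f s) (f (suc s)) ≡ true) →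
    adj G (f t) b ≡ true → Chain (f 0) (applyUpTo (f ∘ suc) t) b
  chain-applyUpTo f zero    b st e = e
  chain-applyUpTo f (suc t) b st e = st 0 (s≤s z≤n) , chain-applyUpTo (f ∘ suc) t b (λ s lt → st (suc s) (s≤s lt)) e

  close : ∀ f ℓ → IsPath (adj G) f ℓ → adj G (f ℓ) (f 0) ≡ true → IsCyc (suc ℓ) (applyUpTo f (suc ℓ))
  close f ℓ p e = length-applyUpTo f (suc ℓ)
    , Uniq.applyUpTo⁺₁ f (suc ℓ) (λ lt le → distinct p _ _ lt (≤-pred le))
    , chain-applyUpTo f ℓ (f 0) (step p) e

-- Colourings of theta graphs

by-period : ∀ {P : ℕ → Set} j → 0 < j → (∀ t → t < j → P t) → (∀ t → P t → P (t + j)) → ∀ t → P t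
by-period {P} j j>0 base next t = go t t ≤-refl
  where
  go : ∀ fuel t → t ≤ fuel → P t
  go fuel t le with j ≤? t
  go fuel t le | no ¬h = base t (≰⇒> ¬h)
  go zero t le | yes h = ⊥-elim (<⇒≱ j>0 (≤-trans h le))
  go (suc fuel) t le | yes h = subst P (m∸n+n≡m h) (next (t ∸ j) (go fuel (t ∸ j) smaller))
    where
    smaller : t ∸ j ≤ fuel
    smaller = ≤-pred (≤-trans (le-by 0 (j>0 ⊕ ≤-reflexive (m∸n+n≡m h)) (lemma (t ∸ j) j t)) le)
      where
      lemma : ∀ d j t → suc d + (j + t) + 0 ≡ t + (1 + (d + j))
      lemma = solve-∀

-- Walking along the cycle makes j a period of the colouring; the two ways through the chord then
-- make b + 1 and b periods as well.
theta-constant : ∀ {A : Set} (c : ℕ → A) b m j → 0 < j → j ≤ b → b + j < m →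
  (∀ t → c (t + m) ≡ c t) → (∀ t → c (t + j) ≡ c t) →
  (∀ i e → i < j → e + j ≡ suc (b + i) → c i ≡ c e) →
  (∀ i x y → i < j → x + i ≡ m → y + i ≡ b + j → c x ≡ c y) →
  ∀ t → c (suc t) ≡ c t
theta-constant c b m j j>0 j≤b b+j<m per shift down up t =
  trans (U t) (trans (cong c (+-suc b t)) (≡-sym (D t)))
  where
  D : ∀ t → c t ≡ c (suc (b + t))
  D = by-period j j>0 base (λ t h → trans (shift t) (trans h (trans (≡-sym (shift (suc (b + t)))) (cong (c ∘ suc) (+-assoc b t j)))))
    where
    base : ∀ t → t < j → c t ≡ c (suc (b + t))
    base t lt = trans (down t (suc (b + t) ∸ j) lt e) (trans (≡-sym (shift _)) (cong c e))
      where
      e : suc (b + t) ∸ j + j ≡ suc (b + t)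
      e = m∸n+n≡m (≤-trans j≤b (≤-trans (m≤m+n b t) (n≤1+n _)))
  U : ∀ t → c (suc t) ≡ c (b + suc t)
  U = by-period j j>0 base (λ t h → trans (shift (suc t)) (trans h (trans (≡-sym (shift (b + suc t))) (cong c (+-assoc b (suc t) j)))))
    where
    base : ∀ t → t < j → c (suc t) ≡ c (b + suc t)
    base t lt with m≤n⇒∃[o]m+o≡n lt | m≤n⇒∃[o]m+o≡n (<⇒≤ b+j<m)
    ... | i , refl | y , refl = trans (trans (≡-sym (per (suc t))) (trans (cong c (arith b t i y)) (shift (b + suc t + y))))
        (up i (b + suc t + y) (b + suc t) (s≤s (m≤n+m i t)) (arith' b t i y) (arith'' b t i))
      where
      arith : ∀ b t i y → suc t + (b + (suc t + i) + y) ≡ b + suc t + y + (suc t + i)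
      arith = solve-∀
      arith' : ∀ b t i y → b + suc t + y + i ≡ b + (suc t + i) + y
      arith' = solve-∀
      arith'' : ∀ b t i → b + suc t + i ≡ b + (suc t + i)
      arith'' = solve-∀

-- A closed walk w of period N visiting N distinct vertices, together with a chord from w 0 to w q.
record Theta {V : Set} (F : V → V → Bool) (N q : ℕ) : Set where
  field
    w      : ℕ → V
    w-step : ∀ t → F (w t) (w (suc t)) ≡ true
    w-inj  : ∀ s t → s < t → t < s + N → w s ≢ w t
    w-per  : ∀ t → w (t + N) ≡ w t
    chord  : F (w 0) (w q) ≡ true

module _ {V : Set} {F : V → V → Bool} (F-sym : ∀ u v → F u v ≡ F v u) where

  -- Reads the chord from its other end, which exchanges the two arcs; this lets a theta graph start
  -- in the upper level.
  rotate : ∀ {N q r} → q + r ≡ N → Theta F N q → Theta F N r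
  rotate {N} {q} {r} e θ = record
    { w = λ t → w (q + t)
    ; w-step = λ t → trans (cong (F (w (q + t)) ∘ w) (+-suc q t)) (w-step (q + t))
    ; w-inj = λ s t lt lt' → w-inj (q + s) (q + t)
        (≤-trans (≤-reflexive (≡-sym (+-suc q s))) (+-monoʳ-≤ q lt))
        (≤-trans (≤-reflexive (≡-sym (+-suc q t))) (≤-trans (+-monoʳ-≤ q lt') (≤-reflexive (≡-sym (+-assoc q s N)))))
    ; w-per = λ t → trans (cong w (≡-sym (+-assoc q t N))) (w-per (q + t))
    ; chord = trans (cong₂ F (cong w (+-identityʳ q)) (trans (cong w e) (w-per 0))) (trans (F-sym _ _) chord)
    }
    where open Theta θ

  module ThetaPaths {m b : ℕ} (θ : Theta F (2 * m) (suc (2 * b))) where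

    open Theta θ

    ascending : ∀ p ℓ → ℓ < 2 * m → IsPath F (λ s → w (p + s)) ℓ
    ascending p ℓ small = record
      { step = λ s _ → trans (cong (F (w (p + s)) ∘ w) (+-suc p s)) (w-step (p + s))
      ; distinct = λ s t lt le → w-inj (p + s) (p + t)
          (≤-trans (≤-reflexive (≡-sym (+-suc p s))) (+-monoʳ-≤ p lt))
          (le-by s (le ⊕ small) (lemma p s t ℓ (2 * m))) }
      where
      lemma : ∀ p s t l m → suc (p + t) + (l + m) + s ≡ p + s + m + (t + suc l)
      lemma = solve-∀

    descending : ∀ p ℓ → ℓ ≤ p → p < 2 * m → IsPath F (λ s → w (p ∸ s)) ℓ
    descending p ℓ ℓ≤p small = record
      { step = λ s lt → trans (F-sym _ _) (trans (cong (F (w (p ∸ suc s)) ∘ w) (∸-step (≤-trans lt ℓ≤p))) (w-step (p ∸ suc s)))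
      ; distinct = λ s t lt le e → w-inj (p ∸ t) (p ∸ s) (∸-strict lt (≤-trans le ℓ≤p))
          (≤-trans (s≤s (m∸n≤m p s)) (≤-trans small (m≤n+m (2 * m) (p ∸ t)))) (≡-sym e) }
      where
      ∸-strict : ∀ {s t p} → s < t → t ≤ p → p ∸ t < p ∸ s
      ∸-strict {zero}  {suc t} {suc p} _       (s≤s le) = s≤s (m∸n≤m p t)
      ∸-strict {suc s} {suc t} {suc p} (s≤s lt) (s≤s le) = ∸-strict lt le

    module _ {A : Set} (colour : V → A) (j : ℕ) (j>0 : 0 < j) (j≤b : j ≤ b) (b+j<m : b + j < m)
      (mono : ∀ f → IsPath F f (2 * j) → ∀ x y → f 0 ≡ w (2 * x) → f (2 * j) ≡ w (2 * y) → colour (f 0) ≡ colour (f (2 * j))) where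

      c : ℕ → A
      c t = colour (w (2 * t))

      along : ∀ f → IsPath F f (2 * j) → ∀ x y → f 0 ≡ w (2 * x) → f (2 * j) ≡ w (2 * y) → c x ≡ c y
      along f p x y e e' = trans (cong colour (≡-sym e)) (trans (mono f p x y e e') (cong colour e'))

      shift : ∀ t → c (t + j) ≡ c t
      shift t = ≡-sym (along _ (ascending (2 * t) (2 * j) (*-monoʳ-< 2 (≤-trans (s≤s (m≤n+m j b)) b+j<m))) t (t + j)
        (cong w (+-identityʳ _)) (cong w (≡-sym (*-distribˡ-+ 2 t j))))

      -- The path descends from `w (2 * i)` to `w 0`, crosses the chord and descends from
      -- `w (2 * b + 1)` to `w (2 * e)`; its length `2 * i + 1 + (2 * b + 1 - 2 * e)` is `2 * j`.
      down : ∀ i e → i < j → e + j ≡ suc (b + i) → c i ≡ c e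
      down i e lt eq with m≤n⇒∃[o]m+o≡n lt
      ... | d , refl = along _ (subst (IsPath F _) (len i d) path) i e
              (trans (glue-left f (2 * i) g z≤n) refl)
              (trans (cong (glue f (2 * i) g) (≡-sym (len i d))) (trans (glue-end f (2 * i) g (suc (2 * d))) (cong w end)))
        where
        b≡ : b ≡ e + d
        b≡ = +-cancelʳ-≡ (suc i) _ _ (trans (trans (+-suc b i) (≡-sym eq)) (arith e i d))
          where
          arith : ∀ e i d → e + (suc i + d) ≡ e + d + suc i
          arith = solve-∀
        f g : ℕ → V
        f s = w (2 * i ∸ s)
        g s = w (suc (2 * b) ∸ s)
        len : ∀ i d → 2 * i + suc (suc (2 * d)) ≡ 2 * (suc i + d)
        len = solve-∀
        end : suc (2 * b) ∸ suc (2 * d) ≡ 2 * e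
        end = trans (cong (λ z → 2 * z ∸ 2 * d) b≡) (trans (cong (_∸ 2 * d) (*-distribˡ-+ 2 e d)) (m+n∸n≡m (2 * e) (2 * d)))
        d≤b : d ≤ b
        d≤b = subst (d ≤_) (≡-sym b≡) (m≤n+m d e)
        b<2m : suc (2 * b) < 2 * m
        b<2m = le-by (2 * (i + d) + 2) (2 ⊗ b+j<m) (arith b i d m)
          where
          arith : ∀ b i d m → suc (suc (2 * b)) + 2 * m + (2 * (i + d) + 2) ≡ 2 * m + 2 * suc (b + (suc i + d))
          arith = solve-∀
        i<e : i < e
        i<e = le-by 0 (j≤b ⊕ ≤-reflexive b≡) (arith i d b e)
          where
          arith : ∀ i d b e → suc i + (b + (e + d)) + 0 ≡ e + (suc i + d + b)
          arith = solve-∀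
        apart : ∀ s t → s ≤ 2 * i → t ≤ suc (2 * d) → f s ≢ g t
        apart s t _ le = w-inj (2 * i ∸ s) (suc (2 * b) ∸ t)
          (≤-trans (s≤s (m∸n≤m (2 * i) s)) (≤-trans low (∸-monoʳ-≤ (suc (2 * b)) le)))
          (≤-trans (s≤s (m∸n≤m (suc (2 * b)) t)) (≤-trans b<2m (m≤n+m (2 * m) (2 * i ∸ s))))
          where
          low : suc (2 * i) ≤ suc (2 * b) ∸ suc (2 * d)
          low = ≤-trans (≤-trans (n≤1+n _) (≤-trans (≤-reflexive (arith i)) (2 ⊗ i<e))) (≤-reflexive (≡-sym end))
            where
            arith : ∀ i → suc (suc (2 * i)) ≡ 2 * suc i
            arith = solve-∀
        path : IsPath F (glue f (2 * i) g) (2 * i + suc (suc (2 * d)))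
        path = glue-path f (2 * i) g (suc (2 * d))
          (descending (2 * i) (2 * i) ≤-refl (≤-trans (s≤s (≤-trans (2 ⊗ (≤-trans (<⇒≤ i<e) (subst (e ≤_) (≡-sym b≡) (m≤m+n e d)))) (n≤1+n _))) b<2m))
          (descending (suc (2 * b)) (suc (2 * d)) (s≤s (2 ⊗ d≤b)) b<2m)
          (trans (cong (λ z → F (w z) (w (suc (2 * b)))) (n∸n≡0 (2 * i))) chord) apart

      -- The path ascends from `w (2 * x)` to `w (2 * m)`, which is `w 0`, crosses the chord and
      -- ascends from `w (2 * b + 1)` to `w (2 * y)`.
      up : ∀ i x y → i < j → x + i ≡ m → y + i ≡ b + j → c x ≡ c y
      up i x y lt eq eq' with m≤n⇒∃[o]m+o≡n lt
      ... | d , refl = along _ (subst (IsPath F _) (len i d) path) x y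
              (trans (glue-left f (2 * i) g z≤n) (cong w (+-identityʳ _)))
              (trans (cong (glue f (2 * i) g) (≡-sym (len i d))) (trans (glue-end f (2 * i) g (suc (2 * d))) (cong w end)))
        where
        f g : ℕ → V
        f s = w (2 * x + s)
        g s = w (suc (2 * b) + s)
        len : ∀ i d → 2 * i + suc (suc (2 * d)) ≡ 2 * (suc i + d)
        len = solve-∀
        y≡ : y ≡ suc (b + d)
        y≡ = +-cancelʳ-≡ i _ _ (trans eq' (arith b i d))
          where
          arith : ∀ b i d → b + (suc i + d) ≡ suc (b + d) + i
          arith = solve-∀
        end : suc (2 * b) + suc (2 * d) ≡ 2 * y
        end = trans (arith b d) (cong (2 *_) (≡-sym y≡))
          where
          arith : ∀ b d → suc (2 * b) + suc (2 * d) ≡ 2 * suc (b + d)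
          arith = solve-∀
        y<x : y < x
        y<x = +-cancelʳ-≤ i (suc y) x (≤-trans (≤-reflexive (cong suc eq')) (≤-trans b+j<m (≤-reflexive (≡-sym eq))))
        2x+2i : 2 * x + 2 * i ≡ 2 * m
        2x+2i = trans (≡-sym (*-distribˡ-+ 2 x i)) (cong (2 *_) eq)
        apart : ∀ s t → s ≤ 2 * i → t ≤ suc (2 * d) → f s ≢ g t
        apart s t le le' e = w-inj (suc (2 * b) + t) (2 * x + s)
          (≤-trans (s≤s (≤-trans (+-monoʳ-≤ (suc (2 * b)) le') (≤-reflexive end)))
            (≤-trans (≤-trans (n≤1+n _) (≤-trans (≤-reflexive (arith y)) (2 ⊗ y<x))) (m≤m+n _ s)))
          (s≤s (≤-trans (≤-trans (+-monoʳ-≤ (2 * x) le) (≤-reflexive 2x+2i)) (m≤n+m (2 * m) (2 * b + t)))) (≡-sym e)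
          where
          arith : ∀ i → suc (suc (2 * i)) ≡ 2 * suc i
          arith = solve-∀
        path : IsPath F (glue f (2 * i) g) (2 * i + suc (suc (2 * d)))
        path = glue-path f (2 * i) g (suc (2 * d))
          (ascending (2 * x) (2 * i) short) (ascending (suc (2 * b)) (suc (2 * d)) short')
          (trans (cong₂ F (trans (cong w 2x+2i) (w-per 0)) (cong w (+-identityʳ _))) chord) apart
          where
          short : 2 * i < 2 * m
          short = ≤-trans (≤-trans (+-monoˡ-≤ (2 * i) (≤-trans (s≤s z≤n) (2 ⊗ ≤-trans (s≤s z≤n) y<x))) (≤-reflexive 2x+2i)) ≤-refl
          short' : suc (2 * d) < 2 * m
          short' = le-by (2 * b + 2 * i + 2) (2 ⊗ b+j<m) (arith b i d m)
            where
            arith : ∀ b i d m → suc (suc (2 * d)) + 2 * m + (2 * b + 2 * i + 2) ≡ 2 * m + 2 * suc (b + (suc i + d))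
            arith = solve-∀

      period : ∀ t → c (t + m) ≡ c t
      period t = cong colour (trans (cong w (*-distribˡ-+ 2 t m)) (w-per (2 * t)))

      -- Applied in the contrapositive: if two even positions differ in colour, some path of length
      -- `2 * j` joins even positions of different colours.
      monochromatic : ∀ t → colour (w (2 * t)) ≡ colour (w 0)
      monochromatic zero    = refl
      monochromatic (suc t) = trans (theta-constant c b m j j>0 j≤b b+j<m period shift down up t) (monochromatic t)

-- Long theta graphs from maximal paths

record MaximalPath {n : ℕ} (F : Fin n → Fin n → Bool) : Set where
  field
    v      : ℕ → Fin n
    ℓ      : ℕ
    path   : IsPath F v ℓ
    closed : ∀ u → F (v 0) u ≡ true → u ∈ applyUpTo v (suc ℓ)

path-bound : ∀ {n} {F : Fin n → Fin n → Bool} {v ℓ} → IsPath F v ℓ → ℓ < n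
path-bound {n} {F} {v} {ℓ} p = injective⇒≤ {suc ℓ} {n} {λ i → v (toℕ i)} inj'
  where
  inj' : ∀ {i j : Fin (suc ℓ)} → v (toℕ i) ≡ v (toℕ j) → i ≡ j
  inj' {i} {j} e with <-cmp (toℕ i) (toℕ j)
  ... | tri< lt _ _ = ⊥-elim (distinct p (toℕ i) (toℕ j) lt (≤-pred (toℕ<n j)) e)
  ... | tri≈ _ eq _ = toℕ-injective eq
  ... | tri> _ _ gt = ⊥-elim (distinct p (toℕ j) (toℕ i) gt (≤-pred (toℕ<n i)) (≡-sym e))

cons : ∀ {A : Set} → A → (ℕ → A) → ℕ → A
cons u v zero    = u
cons u v (suc s) = v s

-- The last component says that the first vertex is the initial one or has an edge of `F`. When `F`
-- is confined to a core, this places it in the core, where its degree is large.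
maximal : ∀ {n} {F : Fin n → Fin n → Bool} → (∀ u v → F u v ≡ F v u) →
  ∀ fuel v ℓ → IsPath F v ℓ → n ≤ ℓ + fuel → Σ (MaximalPath F) λ M → (∃ λ x → MaximalPath.v M 0 ≡ x × (x ≡ v 0 ⊎ (∃ λ y → F x y ≡ true)))
maximal {F = F} F-sym fuel v ℓ p bound with any? (λ u → (F (v 0) u Bool.≟ true) ×-dec ¬? (u ∈? applyUpTo v (suc ℓ)))
... | no none = record { v = v ; ℓ = ℓ ; path = p ; closed = λ u e → decidable-stable (u ∈? applyUpTo v (suc ℓ)) (λ ∉ → none (u , e , ∉)) }
              , v 0 , refl , inj₁ refl
maximal {F = F} F-sym zero v ℓ p bound | yes _ =
  ⊥-elim (1+n≰n (≤-trans (path-bound p) (≤-trans bound (≤-reflexive (+-identityʳ ℓ)))))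
maximal {F = F} F-sym (suc fuel) v ℓ p bound | yes (u , e , u∉)
  with maximal {F = F} F-sym fuel (cons u v) (suc ℓ) p' (≤-trans bound (≤-reflexive (+-suc ℓ fuel)))
  where
  st : ∀ s → s < suc ℓ → F (cons u v s) (cons u v (suc s)) ≡ true
  st zero    _        = trans (F-sym u (v 0)) e
  st (suc s) (s≤s lt) = step p s lt
  ds : ∀ s t → s < t → t ≤ suc ℓ → cons u v s ≢ cons u v t
  ds zero (suc t) _ le eq = u∉ (subst (_∈ applyUpTo v (suc ℓ)) (≡-sym eq) (∈-applyUpTo⁺ v le))
  ds (suc s) (suc t) (s≤s lt) (s≤s le) eq = distinct p s t lt le eq
  p' : IsPath F (cons u v) (suc ℓ)
  p' = record { step = st ; distinct = ds }
... | M , x , eq , inj₂ h = M , x , eq , inj₂ h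
... | M , x , eq , inj₁ refl = M , x , eq , inj₂ (v 0 , trans (F-sym u (v 0)) e)

first : ∀ {P : ℕ → Set} → (∀ s → Dec (P s)) → ∀ a d →
  (∃ λ s → a ≤ s × s < a + d × P s × (∀ t → a ≤ t → t < s → ¬ P t)) ⊎ (∀ t → a ≤ t → t < a + d → ¬ P t)
first P? a zero = inj₂ (λ t le lt _ → <⇒≱ lt (≤-trans (≤-reflexive (+-identityʳ a)) le))
first P? a (suc d) with P? a
... | yes pa = inj₁ (a , ≤-refl , ≤-trans (s≤s (m≤m+n a d)) (≤-reflexive (≡-sym (+-suc a d))) , pa , λ t le lt → ⊥-elim (<⇒≱ lt le))
... | no ¬pa with first P? (suc a) d
...   | inj₁ (s , le , lt , ps , none) = inj₁ (s , <⇒≤ le , ≤-trans lt (≤-reflexive (≡-sym (+-suc a d))) , ps , earlier)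
  where
  earlier : ∀ t → a ≤ t → t < s → ¬ _
  earlier t le' lt' with m≤n⇒m<n∨m≡n le'
  ... | inj₁ a<t  = none t a<t lt'
  ... | inj₂ refl = ¬pa
...   | inj₂ none = inj₂ later
  where
  later : ∀ t → a ≤ t → t < a + suc d → ¬ _
  later t le' lt' with m≤n⇒m<n∨m≡n le'
  ... | inj₁ a<t  = none t a<t (≤-trans lt' (≤-reflexive (+-suc a d)))
  ... | inj₂ refl = ¬pa

-- The edge from `v 0` to `v p₂` closes the path, and positions modulo `p₂ + 1` turn it into an
-- endless walk.
close-theta : ∀ {V : Set} {F : V → V → Bool} → (∀ u v → F u v ≡ F v u) → ∀ {v p₂} q → IsPath F v p₂ → 0 < p₂ → q ≤ p₂ →
  F (v 0) (v p₂) ≡ true → F (v 0) (v q) ≡ true → Theta F (suc p₂) q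
close-theta {V} {F} F-sym {v} {p₂} q p pos q≤ e₂ e₁ = record
  { w = w ; w-step = w-step ; w-inj = w-inj ; w-per = λ t → cong v ([m+n]%n≡m%n t N)
  ; chord = trans (cong (F (v 0) ∘ v) (m<n⇒m%n≡m (s≤s q≤))) e₁ }
  where
  open import Data.Nat.DivMod using (_/_; m%n<n; m≡m%n+[m/n]*n; [m+n]%n≡m%n; [m+kn]%n≡m%n; m<n⇒m%n≡m; n%n≡0)
  N = suc p₂
  w : ℕ → V
  w t = v (t % N)
  suc% : ∀ t → suc t % N ≡ suc (t % N) % N
  suc% t = trans (cong (λ z → suc z % N) (m≡m%n+[m/n]*n t N)) ([m+kn]%n≡m%n (suc (t % N)) (t / N) N)
  w-step : ∀ t → F (w t) (w (suc t)) ≡ true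
  w-step t with m≤n⇒m<n∨m≡n (≤-pred (m%n<n t N))
  ... | inj₁ lt = trans (cong (F (w t) ∘ v) (trans (suc% t) (m<n⇒m%n≡m (s≤s lt)))) (step p (t % N) lt)
  ... | inj₂ eq = trans (cong₂ (λ x y → F (v x) (v y)) eq (trans (suc% t) (trans (cong (λ z → suc z % N) eq) (n%n≡0 N)))) (trans (F-sym _ _) e₂)
  w-inj : ∀ s t → s < t → t < s + N → w s ≢ w t
  w-inj s t lt lt' e with <-cmp (s % N) (t % N)
  ... | tri< l _ _ = distinct p _ _ l (≤-pred (m%n<n t N)) e
  ... | tri> _ _ l = distinct p _ _ l (≤-pred (m%n<n s N)) (≡-sym e)
  ... | tri≈ _ eq _ = <⇒≱ lt' (far (s / N) (t / N) (t % N) (trans (m≡m%n+[m/n]*n s N) (cong (_+ s / N * N) eq)) (m≡m%n+[m/n]*n t N))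
    where
    far : ∀ a b r → s ≡ r + a * N → t ≡ r + b * N → s + N ≤ t
    far a b r refl refl with suc a ≤? b
    ... | yes h = ≤-trans (≤-reflexive (arith r a N)) (+-monoʳ-≤ r (*-monoˡ-≤ N h))
      where
      arith : ∀ r a N → r + a * N + N ≡ r + suc a * N
      arith = solve-∀
    ... | no ¬h = ⊥-elim (<⇒≱ lt (+-monoʳ-≤ r (*-monoˡ-≤ N (≤-pred (≰⇒> ¬h)))))

record LongTheta {V : Set} (F : V → V → Bool) (k : ℕ) : Set where
  field
    {N q r} : ℕ
    q+r≡N   : q + r ≡ N
    theta   : Theta F N q
    long    : 2 * k < q
    long'   : 2 * k < r

-- All neighbours of the first vertex lie on the path. With K = 2k + 1, take the first one at a
-- position p₁ ≥ K and another at p₂ ≥ p₁ + K; if one is missing, all neighbours lie in at most two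
-- windows of K positions, against the degree. The edge to p₂ closes a cycle, and the edge to p₁ is
-- a chord with more than 2k steps on both sides.
long-theta : ∀ {n} {F : Fin n → Fin n → Bool} → (∀ u v → F u v ≡ F v u) → ∀ k (M : MaximalPath F) →
  2 * (2 * k + 1) < card (F (MaximalPath.v M 0)) → LongTheta F k
long-theta {n} {F} F-sym k M deg = find (first P? K (suc ℓ))
  where
  open MaximalPath M
  K = 2 * k + 1
  P : ℕ → Set
  P s = s ≤ ℓ × F (v 0) (v s) ≡ true
  P? : ∀ s → Dec (P s)
  P? s = (s ≤? ℓ) ×-dec (F (v 0) (v s) Bool.≟ true)
  find₂ : ∀ p₁ → K ≤ p₁ → P p₁ → (∀ t → K ≤ t → t < p₁ → ¬ P t) →
    (∃ λ s → p₁ + K ≤ s × s < p₁ + K + suc ℓ × P s × (∀ t → p₁ + K ≤ t → t < s → ¬ P t)) ⊎ (∀ t → p₁ + K ≤ t → t < p₁ + K + suc ℓ → ¬ P t) →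
    LongTheta F k
  find₂ p₁ K≤p₁ (_ , e₁) before (inj₁ (p₂ , le , _ , (p₂≤ℓ , e₂) , _)) with m≤n⇒∃[o]m+o≡n (≤-trans (m≤m+n p₁ K) le)
  ... | r , refl = record
    { q+r≡N = +-suc p₁ r
    ; theta = close-theta F-sym p₁ shorter (≤-trans (m≤n+m 1 (2 * k)) (≤-trans K≤p₁ (m≤m+n p₁ r))) (m≤m+n p₁ r) e₂ e₁
    ; long = ≤-trans (≤-reflexive (+-comm 1 (2 * k))) K≤p₁
    ; long' = s≤s (le-by 1 le (lemma p₁ r (2 * k))) }
    where
    shorter : IsPath F v (p₁ + r)
    shorter = record { step = λ s lt → step path s (≤-trans lt p₂≤ℓ) ; distinct = λ s t lt lt' → distinct path s t lt (≤-trans lt' p₂≤ℓ) }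
    lemma : ∀ p r x → x + (p + r) + 1 ≡ r + (p + (x + 1))
    lemma = solve-∀
  find₂ p₁ K≤p₁ _ before (inj₂ none) = ⊥-elim (<⇒≱ deg (≤-trans (card≤length _ near-list near) (≤-reflexive len)))
    where
    near-list = applyUpTo v K ++ applyUpTo (λ t → v (p₁ + t)) K
    len : length near-list ≡ 2 * K
    len = trans (length-++ (applyUpTo v K)) (cong₂ _+_ (length-applyUpTo v K) (trans (length-applyUpTo _ K) (≡-sym (+-identityʳ K))))
    near : ∀ u → F (v 0) u ≡ true → u ∈ near-list
    near u e with ∈-applyUpTo⁻ v (closed u e)
    ... | s , lt , refl with K ≤? s
    ...   | no ¬le = ∈-++⁺ˡ (∈-applyUpTo⁺ v (≰⇒> ¬le))
    ...   | yes le with p₁ ≤? s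
    ...     | no ¬le' = ⊥-elim (before s le (≰⇒> ¬le') (≤-pred lt , e))
    ...     | yes le' with m≤n⇒∃[o]m+o≡n le'
    ...       | t , refl with K ≤? t
    ...         | yes le″ = ⊥-elim (none (p₁ + t) (+-monoʳ-≤ p₁ le″) (≤-trans lt (m≤n+m _ (p₁ + K))) (≤-pred lt , e))
    ...         | no ¬le″ = ∈-++⁺ʳ (applyUpTo v K) (∈-applyUpTo⁺ (λ t → v (p₁ + t)) (≰⇒> ¬le″))
  find : (∃ λ s → K ≤ s × s < K + suc ℓ × P s × (∀ t → K ≤ t → t < s → ¬ P t)) ⊎ (∀ t → K ≤ t → t < K + suc ℓ → ¬ P t) → LongTheta F k
  find (inj₁ (p₁ , K≤p₁ , _ , Pp₁ , before)) = find₂ p₁ K≤p₁ Pp₁ before (first P? (p₁ + K) (suc ℓ))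
  find (inj₂ none) = ⊥-elim (<⇒≱ deg (≤-trans (card≤length _ (applyUpTo v K) near) (≤-trans (≤-reflexive (length-applyUpTo v K)) (m≤m+n K _))))
    where
    near : ∀ u → F (v 0) u ≡ true → u ∈ applyUpTo v K
    near u e with ∈-applyUpTo⁻ v (closed u e)
    ... | s , lt , refl with K ≤? s
    ...   | yes le = ⊥-elim (none s le (≤-trans lt (m≤n+m _ K)) (≤-pred lt , e))
    ...   | no ¬le = ∈-applyUpTo⁺ v (≰⇒> ¬le)

-- Cycles from two dense consecutive levels

parity : ∀ t → (∃ λ x → t ≡ 2 * x) ⊎ (∃ λ x → t ≡ suc (2 * x))
parity zero = inj₁ (0 , refl)
parity (suc t) with parity t
... | inj₁ (x , refl) = inj₂ (x , refl)
... | inj₂ (x , refl) = inj₁ (suc x , lemma x)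
  where
  lemma : ∀ x → suc (suc (2 * x)) ≡ 2 * suc x
  lemma = solve-∀

last-failure : ∀ {P : ℕ → Set} → (∀ s → Dec (P s)) → ∀ I → ¬ P 0 → P I → ∃ λ h → h < I × ¬ P h × P (suc h)
last-failure P? zero    ¬p0 pI = ⊥-elim (¬p0 pI)
last-failure P? (suc I) ¬p0 pI with P? I
... | no ¬p = I , ≤-refl , ¬p , pI
... | yes p = let (h , lt , r) = last-failure P? I ¬p0 p in h , ≤-trans lt (n≤1+n I) , r

module DenseLevels {n : ℕ} (G : Graph n) (W : Fin n → Bool)
  (E : Fin n → Fin n → Bool) (E-sym : ∀ u v → E u v ≡ E v u) (E-adj : ∀ u v → E u v ≡ true → adj G u v ≡ true)
  (B : Fin n → Bool) (B⊆W : ∀ v → B v ≡ true → W v ≡ true) (root : Fin n) (root∈B : B root ≡ true)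
  (side : Fin n → Bool) (bipartite : ∀ u v → E u v ≡ true → side u xor side v ≡ true)
  (k I : ℕ) where

  open Cycles G
  open Levels E E-sym B root root∈B side bipartite

  between : V → V → Bool
  between u v = (lev I u ∧ lev (suc I) v) ∨ (lev (suc I) u ∧ lev I v)

  between-sym : ∀ u v → between u v ≡ between v u
  between-sym u v = flip (lev I u) (lev (suc I) v) (lev (suc I) u) (lev I v)
    where
    flip : ∀ a b c d → (a ∧ b) ∨ (c ∧ d) ≡ (d ∧ c) ∨ (b ∧ a)
    flip a b c d = trans (Bool.∨-comm (a ∧ b) (c ∧ d)) (cong₂ _∨_ (∧-comm c d) (∧-comm a b))

  F₀ : V → V → Bool
  F₀ u v = E u v ∧ between u v

  F₀-sym : ∀ u v → F₀ u v ≡ F₀ v u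
  F₀-sym u v = cong₂ _∧_ (E-sym u v) (between-sym u v)

  layer : V → Bool
  layer v = lev I v ∨ lev (suc I) v

  dense-layer : ∀ c → Dense c I → 2 * c * card layer < pairs F₀ layer layer
  dense-layer c d = ≤-trans (s≤s (*-monoʳ-≤ (2 * c) (card-∨ (lev I) (lev (suc I)))))
    (le-by 1 (2 ⊗ d ⊕ twice) (lemma c (card (lev I)) (card (lev (suc I))) (pairs E (lev I) (lev (suc I))) (pairs F₀ layer layer)))
    where
    lemma : ∀ c x y p q → suc (2 * c * (x + y)) + (2 * p + q) + 1 ≡ q + (2 * suc (c * (x + y)) + 2 * p)
    lemma = solve-∀
    pointwise : ∀ u v → ι (lev I u ∧ (lev (suc I) v ∧ E u v)) + ι (lev (suc I) u ∧ (lev I v ∧ E u v)) ≤ ι (layer u ∧ (layer v ∧ F₀ u v))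
    pointwise u v = go (lev I u) (lev (suc I) u) (lev I v) (lev (suc I) v) (E u v)
      (λ h h' → 1+n≰n (≤-reflexive (lev-unique (suc I) I u h' h)))
      where
      go : ∀ a b c d e → (a ≡ true → b ≡ true → ⊥) →
        ι (a ∧ (d ∧ e)) + ι (b ∧ (c ∧ e)) ≤ ι ((a ∨ b) ∧ ((c ∨ d) ∧ (e ∧ ((a ∧ d) ∨ (b ∧ c)))))
      go true  true  c     d     e     x = ⊥-elim (x refl refl)
      go true  false true  true  true  x = ≤-refl
      go true  false true  true  false x = ≤-refl
      go true  false true  false e     x = z≤n
      go true  false false true  true  x = ≤-refl
      go true  false false true  false x = ≤-refl
      go true  false false false e     x = z≤n
      go false true  true  d     true  x = ≤-refl
      go false true  true  d     false x = z≤n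
      go false true  false d     e     x = z≤n
      go false false c     d     e     x = z≤n
    twice : 2 * pairs E (lev I) (lev (suc I)) ≤ pairs F₀ layer layer
    twice = ≤-trans (≤-reflexive (trans (cong (p +_) (trans (+-identityʳ p) (pairs-sym {E = E} {A = lev I} {B = lev (suc I)} E-sym)))
        (≡-sym (trans (∑-cong (λ u → ∑-+ (λ v → ι (lev I u ∧ (lev (suc I) v ∧ E u v))) (λ v → ι (lev (suc I) u ∧ (lev I v ∧ E u v)))))
          (∑-+ (λ u → sumFin λ v → ι (lev I u ∧ (lev (suc I) v ∧ E u v))) (λ u → sumFin λ v → ι (lev (suc I) u ∧ (lev I v ∧ E u v))))))))
      (∑-mono λ u → ∑-mono λ v → pointwise u v)
      where p = pairs E (lev I) (lev (suc I))

  -- The choice depends on the level and the vertex alone, so branches that meet never part again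
  -- (`up-agree`); the value `u` in the absence of a parent makes the function total.
  par : ℕ → V → V
  par i u with any? (λ x → (lev i x ∧ E x u) Bool.≟ true)
  ... | yes (x , _) = x
  ... | no _        = u

  par-spec : ∀ i u → lev (suc i) u ≡ true → lev i (par i u) ≡ true × E (par i u) u ≡ true
  par-spec i u h with any? (λ x → (lev i x ∧ E x u) Bool.≟ true)
  ... | yes (x , t) = ∧-elimˡ t , ∧-elimʳ {lev i x} t
  ... | no none     = let (x , l , e) = parent i u h in ⊥-elim (none (x , ∧-intro l e))

  up : ℕ → V → V
  up zero    u = u
  up (suc s) u = par (I ∸ suc s) (up s u)

  up-lev : ∀ s u → s ≤ I → lev I u ≡ true → lev (I ∸ s) (up s u) ≡ true
  up-lev zero    u le h = h
  up-lev (suc s) u le h = proj₁ (par-spec (I ∸ suc s) (up s u)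
    (subst (λ i → lev i (up s u) ≡ true) (∸-step le) (up-lev s u (<⇒≤ le) h)))

  up-edge : ∀ s u → s < I → lev I u ≡ true → E (up (suc s) u) (up s u) ≡ true
  up-edge s u le h = proj₂ (par-spec (I ∸ suc s) (up s u)
    (subst (λ i → lev i (up s u) ≡ true) (∸-step le) (up-lev s u (<⇒≤ le) h)))

  up-agree : ∀ a x u u' → up a u ≡ up a u' → up (x + a) u ≡ up (x + a) u'
  up-agree a zero    u u' e = e
  up-agree a (suc x) u u' e = cong (par (I ∸ suc (x + a))) (up-agree a x u u' e)

  CycIn : ℕ → Set
  CycIn L = ∃ λ l → length l ≡ L × (IsCyc L l × All (λ v → W v ≡ true) l)

  cycIn? : ∀ L → Dec (CycIn L)
  cycIn? L = search L (λ l → isCyc? L l ×-dec All.all? (λ v → W v Bool.≟ true) l)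

  -- Two branches of the tree that separate just below their common ancestor at height suc h,
  -- joined at the bottom by a path inside the two lowest levels.
  fork : ∀ h j f → h < I → IsPath F₀ f (suc (suc j)) → lev I (f 0) ≡ true → lev I (f (suc (suc j))) ≡ true →
    up (suc h) (f 0) ≡ up (suc h) (f (suc (suc j))) → up h (f 0) ≢ up h (f (suc (suc j))) →
    CycIn (suc (h + suc (j + suc (h + 1))))
  fork h j f h<I p lu lu' same differ = applyUpTo cyc (suc L)
    , length-applyUpTo cyc (suc L)
    , close G cyc L (record { step = λ s lt → E-adj _ _ (step P s lt) ; distinct = distinct P }) (E-adj _ _ closing)
    , AllP.applyUpTo⁺₁ cyc (suc L) (λ lt → values _ (≤-pred lt))
    where
    import Data.List.Relation.Unary.All.Properties as AllP
    u u' z : V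
    u = f 0
    u' = f (suc (suc j))
    z = up (suc h) u
    h≤I : h ≤ I
    h≤I = <⇒≤ h<I
    left middle right top rest₂ rest₁ cyc : ℕ → V
    left s = up (h ∸ s) u
    middle s = f (suc s)
    right s = up s u'
    top _ = z
    rest₂ = glue right h top
    rest₁ = glue middle j rest₂
    cyc = glue left h rest₁
    L = h + suc (j + suc (h + 1))
    middle-lev : ∀ s → s ≤ j → ∃ λ i → I ≤ i × lev i (middle s) ≡ true
    middle-lev s le with ∨-elim {lev I (f s) ∧ lev (suc I) (f (suc s))} (∧-elimʳ {E (f s) (f (suc s))} (step p s (≤-trans (s≤s le) (n≤1+n _))))
    ... | inj₁ t = suc I , n≤1+n I , ∧-elimʳ {lev I (f s)} t
    ... | inj₂ t = I , ≤-refl , ∧-elimʳ {lev (suc I) (f s)} t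
    -- Ancestors at positive height lie above level `I`, whereas the interior of `f` stays in levels
    -- `I` and `suc I`.
    tree-middle : ∀ a s x → a ≤ h → s ≤ j → lev I x ≡ true → x ≢ middle s → up a x ≢ middle s
    tree-middle zero    s x _ _  lx ne e = ne e
    tree-middle (suc a) s x le le' lx ne e with middle-lev s le'
    ... | i , I≤i , l = <⇒≱ (drop (≤-trans le h≤I))
          (≤-trans I≤i (≤-reflexive (lev-unique i _ _ l (subst (λ y → lev (I ∸ suc a) y ≡ true) e (up-lev (suc a) x (≤-trans le h≤I) lx)))))
      where
      drop : ∀ {a i} → suc a ≤ i → i ∸ suc a < i
      drop {a} {suc i} _ = s≤s (m∸n≤m i a)
    ∸-inj : ∀ {a b i} → a ≤ i → b ≤ i → i ∸ a ≡ i ∸ b → a ≡ b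
    ∸-inj {a} {b} {i} ha hb e = +-cancelˡ-≡ (i ∸ a) a b (trans (m∸n+n≡m ha) (trans (≡-sym (m∸n+n≡m hb)) (cong (_+ b) (≡-sym e))))
    tree-inj : ∀ a b x y → a ≤ I → b ≤ I → lev I x ≡ true → lev I y ≡ true → up a x ≡ up b y → a ≡ b
    tree-inj a b x y ha hb lx ly e = ∸-inj ha hb (lev-unique _ _ _ (up-lev a x ha lx) (subst (λ q → lev (I ∸ b) q ≡ true) (≡-sym e) (up-lev b y hb ly)))
    -- If the two branches met at or below height `h`, they would still coincide at `h`, against
    -- `differ`.
    left≢right : ∀ s t → s ≤ h → t ≤ h → left s ≢ right t
    left≢right s t hs ht e with tree-inj (h ∸ s) t u u' (≤-trans (m∸n≤m h s) h≤I) (≤-trans ht h≤I) lu lu' e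
    ... | refl = differ (subst (λ q → up q u ≡ up q u') (trans (+-comm s (h ∸ s)) (m∸n+n≡m hs)) (up-agree (h ∸ s) s u u' e))
    left-path : IsPath E left h
    left-path = record
      { step = λ s lt → subst (λ q → E (up q u) (up (h ∸ suc s) u) ≡ true) (≡-sym (∸-step lt))
          (up-edge (h ∸ suc s) u (≤-trans (≤-reflexive (≡-sym (∸-step lt))) (≤-trans (m∸n≤m h s) h≤I)) lu)
      ; distinct = λ s t lt le e → <⇒≢ lt (∸-inj (≤-trans (<⇒≤ lt) le) le
          (tree-inj (h ∸ s) (h ∸ t) u u (≤-trans (m∸n≤m h s) h≤I) (≤-trans (m∸n≤m h t) h≤I) lu lu e)) }
    right-path : IsPath E right h
    right-path = record
      { step = λ s lt → trans (E-sym _ _) (up-edge s u' (≤-trans lt h≤I) lu')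
      ; distinct = λ s t lt le e → <⇒≢ lt (tree-inj s t u' u' (≤-trans (<⇒≤ lt) (≤-trans le h≤I)) (≤-trans le h≤I) lu' lu' e) }
    middle-path : IsPath E middle j
    middle-path = record
      { step = λ s lt → ∧-elimˡ (step p (suc s) (s≤s (≤-trans lt (n≤1+n j))))
      ; distinct = λ s t lt le → distinct p (suc s) (suc t) (s≤s lt) (s≤s (≤-trans le (n≤1+n j))) }
    top-path : IsPath E top 0
    top-path = record { step = λ _ () ; distinct = λ { s .0 () z≤n } }
    below-top : ∀ a x → a ≤ h → lev I x ≡ true → up a x ≢ z
    below-top a x le lx e = 1+n≰n (≤-trans (≤-reflexive (≡-sym (tree-inj a (suc h) x u (≤-trans le h≤I) h<I lx lu e))) le)
    middle≢top : ∀ s → s ≤ j → middle s ≢ z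
    middle≢top s le e with middle-lev s le
    ... | i , I≤i , l = <⇒≱ (drop h<I) (≤-trans I≤i (≤-reflexive (lev-unique i _ _ l (subst (λ y → lev (I ∸ suc h) y ≡ true) (≡-sym e) (up-lev (suc h) u h<I lu)))))
      where
      drop : ∀ {a i} → suc a ≤ i → i ∸ suc a < i
      drop {a} {suc i} _ = s≤s (m∸n≤m i a)
    path₂ : IsPath E rest₂ (h + 1)
    path₂ = glue-path right h top 0 right-path top-path
      (trans (E-sym _ _) (subst (λ q → E q (up h u') ≡ true) (≡-sym same) (up-edge h u' h<I lu')))
      (λ s t le _ → below-top s u' le lu')
    path₁ : IsPath E rest₁ (j + suc (h + 1))
    path₁ = glue-path middle j rest₂ (h + 1) middle-path path₂
      (trans (cong (E (middle j)) (glue-left right h top z≤n)) (∧-elimˡ (step p (suc j) ≤-refl)))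
      (λ s t ls lt → glue-values right h top 0 {λ y → middle s ≢ y}
        (λ a la e → tree-middle a s u' la ls lu' (λ e' → distinct p (suc s) (suc (suc j)) (s≤s (s≤s ls)) ≤-refl (≡-sym e')) (≡-sym e))
        (λ _ _ → middle≢top s ls) t lt)
    P : IsPath E cyc L
    P = glue-path left h rest₁ (j + suc (h + 1)) left-path path₁
      (trans (cong₂ E (cong (λ q → up q u) (n∸n≡0 h)) (glue-left middle j rest₂ z≤n)) (∧-elimˡ (step p 0 (s≤s z≤n))))
      (λ s t ls lt → glue-values middle j rest₂ (h + 1) {λ y → left s ≢ y}
        (λ b lb → tree-middle (h ∸ s) b u (m∸n≤m h s) lb lu (distinct p 0 (suc b) (s≤s z≤n) (s≤s (≤-trans lb (n≤1+n j)))))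
        (λ b lb → glue-values right h top 0 {λ y → left s ≢ y} (λ a la → left≢right s a ls la)
          (λ _ _ → below-top (h ∸ s) u (m∸n≤m h s) lu) b lb) t lt)
    closing : E (cyc L) (cyc 0) ≡ true
    closing = trans (cong₂ E
        (trans (glue-end left h rest₁ (j + suc (h + 1))) (trans (glue-end middle j rest₂ (h + 1)) (glue-end right h top 0)))
        (glue-left left h rest₁ z≤n)) (up-edge h u h<I lu)
    inW : ∀ i x → lev i x ≡ true → W x ≡ true
    inW i x l = B⊆W x (lev-W i x l)
    values : ∀ s → s ≤ L → W (cyc s) ≡ true
    values = glue-values left h rest₁ (j + suc (h + 1)) {λ y → W y ≡ true}
      (λ s _ → inW (I ∸ (h ∸ s)) _ (up-lev (h ∸ s) u (≤-trans (m∸n≤m h s) h≤I) lu))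
      (glue-values middle j rest₂ (h + 1) {λ y → W y ≡ true}
        (λ s le → let (i , _ , l) = middle-lev s le in inW i _ l)
        (glue-values right h top 0 {λ y → W y ≡ true}
          (λ s le → inW (I ∸ s) _ (up-lev s u' (≤-trans le h≤I) lu'))
          (λ _ _ → inW (I ∸ suc h) _ (up-lev (suc h) u h<I lu))))

  module _ (Z : V → Bool) (1≤k : 1 ≤ k) where

    F : V → V → Bool
    F u v = Z u ∧ (Z v ∧ F₀ u v)

    F-sym : ∀ u v → F u v ≡ F v u
    F-sym u v = trans (cong (λ e → Z u ∧ (Z v ∧ e)) (F₀-sym u v)) (swap (Z u) (Z v) (F₀ v u))
      where
      swap : ∀ a b e → a ∧ (b ∧ e) ≡ b ∧ (a ∧ e)
      swap a b e = trans (≡-sym (Bool.∧-assoc a b e)) (trans (cong (_∧ e) (∧-comm a b)) (Bool.∧-assoc b a e))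

    F⇒F₀ : ∀ u v → F u v ≡ true → F₀ u v ≡ true
    F⇒F₀ u v e = ∧-elimʳ {Z v} (∧-elimʳ {Z u} e)

    not-both : ∀ u → lev I u ≡ true → lev (suc I) u ≡ true → ⊥
    not-both u h h' = 1+n≰n (≤-reflexive (lev-unique (suc I) I u h' h))

    upper⇒lower : ∀ u v → F u v ≡ true → lev I u ≡ true → lev (suc I) v ≡ true
    upper⇒lower u v e l with ∨-elim {lev I u ∧ lev (suc I) v} (∧-elimʳ {E u v} (F⇒F₀ u v e))
    ... | inj₁ t = ∧-elimʳ {lev I u} t
    ... | inj₂ t = ⊥-elim (not-both u l (∧-elimˡ t))

    lower⇒upper : ∀ u v → F u v ≡ true → lev (suc I) u ≡ true → lev I v ≡ true
    lower⇒upper u v e l with ∨-elim {lev I u ∧ lev (suc I) v} (∧-elimʳ {E u v} (F⇒F₀ u v e))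
    ... | inj₂ t = ∧-elimʳ {lev (suc I) u} t
    ... | inj₁ t = ⊥-elim (not-both u (∧-elimˡ t) l)

    upper-or-lower : ∀ u v → F u v ≡ true → lev I u ≡ true ⊎ lev (suc I) u ≡ true
    upper-or-lower u v e with ∨-elim {lev I u ∧ lev (suc I) v} (∧-elimʳ {E u v} (F⇒F₀ u v e))
    ... | inj₁ t = inj₁ (∧-elimˡ t)
    ... | inj₂ t = inj₂ (∧-elimˡ t)

    -- One `h` must serve all `i`, or the lengths would not be consecutive: `h` depends on where the
    -- theta graph branches in the tree, and the path inside the theta graph supplies `i`.
    Result : Set
    Result = ∃ λ h → h < I × (∀ i → i < k → CycIn (2 * (2 + h) + 2 * i))

    even-upper : ∀ {N q} (θ : Theta F N q) → lev I (Theta.w θ 0) ≡ true → ∀ t → lev I (Theta.w θ (2 * t)) ≡ true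
    even-upper θ l₀ zero    = l₀
    even-upper θ l₀ (suc t) = subst (λ s → lev I (Theta.w θ s) ≡ true) (lemma t)
        (lower⇒upper _ _ (Theta.w-step θ (suc (2 * t))) (upper⇒lower _ _ (Theta.w-step θ (2 * t)) (even-upper θ l₀ t)))
      where
      lemma : ∀ t → suc (suc (2 * t)) ≡ 2 * suc t
      lemma = solve-∀

    -- The upper vertices of the theta graph differ at height 0 and share the root at height `I`;
    -- `h` is a height at which they disagree just below agreement. Colour them by their ancestors
    -- at height `h`. If the cycle for some `i` is missing, `fork` forces equal colours on the ends
    -- of every path of length 2i + 2 between them, so the colouring is constant, against the choice
    -- of `h`.
    even-theta : ∀ m b (θ : Theta F (2 * m) (suc (2 * b))) → k ≤ b → b + k < m → lev I (Theta.w θ 0) ≡ true → Result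
    even-theta m b θ k≤b b+k<m l₀ = h , h<I , λ i lt → decidable-stable (cycIn? _) (λ none → ¬Ph (uniform i lt none))
      where
      open Theta θ
      open ThetaPaths F-sym {m} {b} θ using (monochromatic)
      open import Data.Nat.DivMod using (_/_; m%n<n; m≡m%n+[m/n]*n)
      even : ∀ t → lev I (w (2 * t)) ≡ true
      even = even-upper θ l₀
      odd : ∀ t → lev (suc I) (w (suc (2 * t))) ≡ true
      odd t = upper⇒lower _ _ (w-step (2 * t)) (even t)
      2<2m : 2 < 2 * m
      2<2m = ≤-trans (n≤1+n 3) (2 ⊗ ≤-trans (s≤s (≤-trans 1≤k (m≤n+m k b))) b+k<m)
      -- Confining `P` to one period keeps it decidable; `ancestor` extends it to all positions.
      P : ℕ → Set
      P s = ∀ (t : Fin (2 * m)) → lev I (w (toℕ t)) ≡ true → up s (w (toℕ t)) ≡ up s (w 0)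
      P? : ∀ s → Dec (P s)
      P? s = all? (λ t → (lev I (w (toℕ t)) Bool.≟ true) →-dec (up s (w (toℕ t)) ≟F up s (w 0)))
      ¬P0 : ¬ P 0
      ¬P0 p = w-inj 0 2 (s≤s z≤n) 2<2m (≡-sym (subst (λ t → w t ≡ w 0) (toℕ-fromℕ< 2<2m)
        (p (fromℕ< 2<2m) (subst (λ t → lev I (w t) ≡ true) (≡-sym (toℕ-fromℕ< 2<2m)) (even 1)))))
      at-root : ∀ u → lev I u ≡ true → up I u ≡ root
      at-root u l = ⌊⌋-sound (up I u ≟F root) (subst (λ i → lev i (up I u) ≡ true) (n∸n≡0 I) (up-lev I u ≤-refl l))
      split : ∃ λ h → h < I × ¬ P h × P (suc h)
      split = last-failure P? I ¬P0 (λ t l → trans (at-root _ l) (≡-sym (at-root _ l₀)))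
      h = proj₁ split
      h<I = proj₁ (proj₂ split)
      ¬Ph = proj₁ (proj₂ (proj₂ split))
      Psh = proj₂ (proj₂ (proj₂ split))
      w-mod : ∀ r q → w (r + q * (2 * m)) ≡ w r
      w-mod r zero    = cong w (+-identityʳ r)
      w-mod r (suc q) = trans (cong w (lemma r q (2 * m))) (trans (w-per (r + q * (2 * m))) (w-mod r q))
        where
        lemma : ∀ r q N → r + suc q * N ≡ r + q * N + N
        lemma = solve-∀
      instance
        2m≢0 : NonZero (2 * m)
        2m≢0 = >-nonZero (≤-trans (s≤s z≤n) 2<2m)
      ancestor : ∀ t → lev I (w t) ≡ true → up (suc h) (w t) ≡ up (suc h) (w 0)
      ancestor t l = trans (cong (up (suc h)) reduce) (trans (cong (up (suc h) ∘ w) (≡-sym (toℕ-fromℕ< (m%n<n t (2 * m)))))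
          (Psh (fromℕ< (m%n<n t (2 * m))) (subst (λ u → lev I u ≡ true) (trans reduce (cong w (≡-sym (toℕ-fromℕ< (m%n<n t (2 * m)))))) l)))
        where
        reduce : w t ≡ w (t % (2 * m))
        reduce = trans (cong w (m≡m%n+[m/n]*n t (2 * m))) (w-mod (t % (2 * m)) (t / (2 * m)))
      uniform : ∀ i → i < k → ¬ CycIn (2 * (2 + h) + 2 * i) → P h
      uniform i lt none t l with parity (toℕ t)
      ... | inj₂ (x , e) = ⊥-elim (not-both _ l (subst (λ s → lev (suc I) (w s) ≡ true) (≡-sym e) (odd x)))
      ... | inj₁ (x , e) = trans (cong (up h ∘ w) e)
          (monochromatic (up h) (suc i) (s≤s z≤n) (≤-trans lt k≤b) (≤-trans (s≤s (+-monoʳ-≤ b lt)) b+k<m) mono x)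
        where
        len : 2 * suc i ≡ suc (suc (2 * i))
        len = lemma i
          where
          lemma : ∀ i → 2 * suc i ≡ suc (suc (2 * i))
          lemma = solve-∀
        cyc-len : ∀ h i → suc (h + suc (2 * i + suc (h + 1))) ≡ 2 * (2 + h) + 2 * i
        cyc-len = solve-∀
        mono : ∀ f → IsPath F f (2 * suc i) → ∀ x y → f 0 ≡ w (2 * x) → f (2 * suc i) ≡ w (2 * y) → up h (f 0) ≡ up h (f (2 * suc i))
        mono f p x y e e' rewrite len = decidable-stable (_ ≟F _) λ ne → none (subst CycIn (cyc-len h i)
          (fork h (2 * i) f h<I (record { step = λ s lt → F⇒F₀ _ _ (step p s lt) ; distinct = distinct p })
            (subst (λ u → lev I u ≡ true) (≡-sym e) (even x)) (subst (λ u → lev I u ≡ true) (≡-sym e') (even y))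
            (trans (trans (cong (up (suc h)) e) (ancestor (2 * x) (even x))) (≡-sym (trans (cong (up (suc h)) e') (ancestor (2 * y) (even y))))) ne))

    -- Levels alternate along the walk and across the chord, so `q` is odd and `N` even; the bounds
    -- on the arcs become k ≤ b and b + k < m.
    from-upper : ∀ N q r → q + r ≡ N → 2 * k < q → 2 * k < r → (θ : Theta F N q) → lev I (Theta.w θ 0) ≡ true → Result
    from-upper N q r q+r≡N long long' θ l₀ with parity q | parity N
    ... | inj₁ (x , refl) | _ = ⊥-elim (not-both _ (even-upper θ l₀ x) (upper⇒lower _ _ chord l₀))
      where open Theta θ
    ... | inj₂ _ | inj₂ (x , refl) = ⊥-elim (not-both _ (subst (λ u → lev I u ≡ true) (≡-sym (w-per 0)) l₀) (upper⇒lower _ _ (w-step (2 * x)) (even-upper θ l₀ x)))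
      where open Theta θ
    ... | inj₂ (b , refl) | inj₁ (m , refl) = even-theta m b θ (*-cancelˡ-≤ 2 (≤-pred long))
          (*-cancelˡ-< 2 (b + k) m (le-by 1 (long' ⊕ ≤-reflexive q+r≡N) (lemma b k r (2 * m)))) l₀
      where
      lemma : ∀ b k r M → suc (2 * (b + k)) + (r + M) + 1 ≡ M + (suc (2 * k) + (suc (2 * b) + r))
      lemma = solve-∀

    long-theta⇒cycles : LongTheta F k → Result
    long-theta⇒cycles Θ with upper-or-lower _ _ (Theta.chord (LongTheta.theta Θ))
    ... | inj₁ l = from-upper _ _ _ (LongTheta.q+r≡N Θ) (LongTheta.long Θ) (LongTheta.long' Θ) (LongTheta.theta Θ) l
    ... | inj₂ l = from-upper _ _ _ (trans (+-comm r q) q+r≡N) long' long (rotate F-sym q+r≡N theta)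
          (subst (λ s → lev I (Theta.w theta s) ≡ true) (≡-sym (+-identityʳ q)) (lower⇒upper _ _ (Theta.chord theta) l))
      where open LongTheta Θ

    core⇒cycles : ∀ s → Z s ≡ true → (∀ u → Z u ≡ true → 2 * (2 * k + 1) < card (λ v → Z v ∧ F₀ u v)) → Result
    core⇒cycles s s∈ deg with maximal {F = F} F-sym n (λ _ → s) 0 (record { step = λ _ () ; distinct = λ { _ .0 () z≤n } }) ≤-refl
    ... | M , x , refl , why = long-theta⇒cycles (long-theta F-sym k M (≤-trans (deg x x∈) (card-mono {P = λ v → Z v ∧ F₀ x v} {Q = F x} (λ v → ∧-intro x∈))))
      where
      x∈ : Z x ≡ true
      x∈ = [ (λ e → subst (λ u → Z u ≡ true) (≡-sym e) s∈) , (λ { (y , e) → ∧-elimˡ e }) ]′ why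

-- Origin of the 20: a factor 5 for `Growth`, a factor 2 for the ordered pairs in `peel`, and a
-- factor 2 lost in making the graph bipartite.
halve : ∀ c w d e → 20 * c * w < d → d ≤ 2 * e → 2 * (5 * c) * w < e
halve c w d e h h' = *-cancelˡ-< 2 _ _ (≤-trans (s≤s (≤-reflexive (lemma c w))) (≤-trans h h'))
  where
  lemma : ∀ c w → 2 * (2 * (5 * c) * w) ≡ 20 * c * w
  lemma = solve-∀

LayerCycles : ∀ {n} → Graph n → (Fin n → Bool) → ℕ → ℕ → Set
LayerCycles G W k R = ∃ λ h → h < R × (∀ i → i < k → ∃ λ l → Cycles.IsCyc G (2 * (2 + h) + 2 * i) l × (∀ v → v ∈ l → W v ≡ true))

module FromCore {n : ℕ} (G : Graph n) (W : Fin n → Bool) (k c R : ℕ) (1≤k : 1 ≤ k) (big : n < 2 ^ suc R)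
  (1≤c : 1 ≤ c) (k≤c : 2 * (2 * k + 1) ≤ c)
  (E : Fin n → Fin n → Bool) (E-sym : ∀ u v → E u v ≡ E v u) (E-adj : ∀ u v → E u v ≡ true → adj G u v ≡ true)
  (side : Fin n → Bool) (bipartite : ∀ u v → E u v ≡ true → side u xor side v ≡ true)
  (K : Peel.Core E E-sym W (5 * c)) where

  open Peel.Core K
  open Levels E E-sym core seed seed∈ side bipartite

  from-layer : ∀ I → I ≤ R → Dense c I → LayerCycles G W k R
  from-layer I I≤R d = result (core⇒cycles (Peel.Core.core K') 1≤k (Peel.Core.seed K') (Peel.Core.seed∈ K')
      (λ u h → ≤-<-trans k≤c (Peel.Core.core-deg K' u h)))
    where
    open DenseLevels G W E E-sym E-adj core core⊆ seed seed∈ side bipartite k I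
    -- A second peeling, inside the dense pair of levels, restores the minimum degree that a long
    -- theta graph requires.
    K' : Peel.Core F₀ F₀-sym layer c
    K' = Peel.peel F₀ F₀-sym c n layer (card≤n layer) (dense-layer c d)
    result : (∃ λ h → h < I × (∀ i → i < k → CycIn (2 * (2 + h) + 2 * i))) → LayerCycles G W k R
    result (h , h<I , cyc) = h , ≤-trans h<I I≤R , λ i lt → let (l , _ , isc , all) = cyc i lt in l , isc , (λ v m → All.lookup all m)

  from-core : LayerCycles G W k R
  from-core = let (I , I≤R , d) = Growth.dense-level c 1≤c core-deg R big in from-layer I I≤R d

module Restricted {n : ℕ} (G : Graph n) (W : Fin n → Bool) where

  E₀ : Fin n → Fin n → Bool
  E₀ u v = W u ∧ (W v ∧ adj G u v)

  E₀-sym : ∀ u v → E₀ u v ≡ E₀ v u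
  E₀-sym u v = trans (cong (λ e → W u ∧ (W v ∧ e)) (sym G u v)) (trans (≡-sym (Bool.∧-assoc (W u) (W v) _))
    (trans (cong (_∧ adj G v u) (∧-comm (W u) (W v))) (Bool.∧-assoc (W v) (W u) _)))

  E₀-irrefl : ∀ v → E₀ v v ≡ false
  E₀-irrefl v = trans (cong (λ e → W v ∧ (W v ∧ e)) (irrefl G v)) (trans (cong (W v ∧_) (Bool.∧-zeroʳ (W v))) (Bool.∧-zeroʳ (W v)))

  from-cut : ∀ k c R → 1 ≤ k → n < 2 ^ suc R → 1 ≤ c → 2 * (2 * k + 1) ≤ c → 20 * c * card W < pairs (adj G) W W →
    (side : Fin n → Bool) → pairs (adj G) W W ≤ 2 * sumFin (λ u → sumFin λ v → ι (E₀ u v ∧ (side u xor side v))) → LayerCycles G W k R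
  from-cut k c R 1≤k big 1≤c k≤c dense side half =
    FromCore.from-core G W k c R 1≤k big 1≤c k≤c E E-sym
      (λ u v t → ∧-elimʳ {W v} (∧-elimʳ {W u} (∧-elimˡ t))) side (λ u v t → ∧-elimʳ {E₀ u v} t)
      (Peel.peel E E-sym (5 * c) n W (card≤n W) (halve c (card W) _ _ dense (≤-trans half (*-monoʳ-≤ 2 inside))))
    where
    E : Fin n → Fin n → Bool
    E u v = E₀ u v ∧ (side u xor side v)
    E-sym : ∀ u v → E u v ≡ E v u
    E-sym u v = cong₂ _∧_ (E₀-sym u v) (xor-comm (side u) (side v))
    inside : sumFin (λ u → sumFin λ v → ι (E u v)) ≤ pairs E W W
    inside = ∑-mono λ u → ∑-mono λ v → ι-mono λ t →
      ∧-intro (∧-elimˡ {W u} (∧-elimˡ t)) (∧-intro (∧-elimˡ {W v} (∧-elimʳ {W u} (∧-elimˡ t))) t)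

dense⇒cycles : ∀ {n} (G : Graph n) (W : Fin n → Bool) k c R → 1 ≤ k → n < 2 ^ suc R →
  1 ≤ c → 2 * (2 * k + 1) ≤ c → 20 * c * card W < pairs (adj G) W W → LayerCycles G W k R
dense⇒cycles G W k c R 1≤k big 1≤c k≤c dense =
  let (side , half) = cut E₀ E₀-sym E₀-irrefl in from-cut k c R 1≤k big 1≤c k≤c dense side half
  where open Restricted G W

-- Enlarging S

-- The g longest cycles use more than slack k vertices of S; g = 42 works.
record Split (k : ℕ) : Set where
  field
    j g     : ℕ
    sum     : j + g ≡ k
    top     : slack k ≤ total (λ i → 2 + (j + i)) g
    numeric : 6 * (total (λ i → 2 + (j + i)) g + slack k) + 2 * (k * k + 7 * k) ≤ 3 * (k * k + 3 * k)

-- As T ≤ 42(k + 1), `numeric` follows from 497k + 378 ≤ k², and `top` asks for k ≥ 420; 1000 is a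
-- round number beyond both. The variable `g`, tied to 42 by an equation, keeps the sum from
-- unfolding.
split-at : ∀ k j g → g ≡ 42 → j + 42 ≡ k → 1000 ≤ k → Split k
split-at k j g g≡42 j+42≡k 1000≤k = record
  { j = j ; g = g ; sum = trans (cong (j +_) g≡42) j+42≡k
  ; top = subst (λ x → slack x ≤ T) j+42≡k (top-total j T large closed)
  ; numeric = le-by 125 (6 ⊗ top-total≤ j T closed ⊕ ≤-reflexive j+42≡k ⊗ʳ 252 ⊕ *-monoʳ-≤ k 1000≤k ⊕ ≤-trans (s≤s z≤n) 1000≤k ⊗ʳ 503)
      (lemma T j k (k * k)) }
  where
  T : ℕ
  T = total (λ i → 2 + (j + i)) g
  closed : 2 * T + 42 ≡ 2 * (2 + j) * 42 + 42 * 42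
  closed = subst (λ x → 2 * T + x ≡ 2 * (2 + j) * x + x * x) g≡42 (total-arith (2 + j) g)
  large : 378 ≤ j
  large = le-by 580 (1000≤k ⊕ ≤-reflexive (≡-sym j+42≡k)) (lemma' j k)
    where
    lemma' : ∀ j k → 378 + (k + (j + 42)) + 580 ≡ j + (1000 + k)
    lemma' = solve-∀
  lemma : ∀ T j k x → 6 * (T + (k * 40 + 21)) + 2 * (x + 7 * k) + (6 * ((j + 43) * 42) + k * 252 + x + k * 503) + 125
    ≡ 3 * (x + 3 * k) + (6 * T + (j + 42) * 252 + k * 1000 + 503)
  lemma = solve-∀

split-off : ∀ k → 1000 ≤ k → Split k
split-off k 1000≤k = split-at k (k ∸ 42) 42 refl (m∸n+n≡m (≤-trans (m≤m+n 42 958) 1000≤k)) 1000≤k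

-- Classes of connectors and cycles, and their hitting sets

data Task (n : ℕ) : Set where
  conn : Fin n → Fin n → ℕ → Task n
  cyc  : ℕ → Task n

module Tasks {n : ℕ} (G : Graph n) (S : List (Fin n)) (N : ℕ) where

  open Cycles G
  open Linked G S N

  Goal : Task n → List V → Set
  Goal (conn a b m) l = Conn a b l
  Goal (cyc L)      l = IsCyc L l

  goal? : ∀ t l → Dec (Goal t l)
  goal? (conn a b m) l = conn? a b l
  goal? (cyc L)      l = isCyc? L l

  size : Task n → ℕ
  size (conn a b m) = m
  size (cyc L)      = L

  Rich : Task n → Set
  Rich t = Hitting.Rich (Goal t) (goal? t) (size t) N S

  Handled : List V → Task n → Set
  Handled U t = ∀ l → length l ≡ size t → Goal t l → Avoids (S ++ U) l → Rich t

  avoids-later : ∀ X U {l : List V} → Avoids (S ++ (X ++ U)) l → Avoids (S ++ U) l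
  avoids-later X U h v m x with ∈-++⁻ S x
  ... | inj₁ s = h v m (∈-++⁺ˡ s)
  ... | inj₂ u = h v m (∈-++⁺ʳ S (∈-++⁺ʳ X u))

  handle : ∀ ts → ∃ λ U → length U ≤ N * length ts × (∀ t → t ∈ ts → Handled U t)
  handle [] = [] , z≤n , λ _ ()
  handle (t ∷ ts) with handle ts | Hitting.rich-or-hit (Goal t) (goal? t) (size t) N S
  ... | U , len , h | inj₁ rich = U , ≤-trans len (*-monoʳ-≤ N (n≤1+n _)) , λ
        { _ (here refl) _ _ _ _ → rich ; t' (there m) → h t' m }
  ... | U , len , h | inj₂ (X , lenX , ¬wit) = X ++ U
        , ≤-trans (≤-reflexive (length-++ X)) (≤-trans (lenX ⊕ len) (≤-reflexive (lemma N (length ts))))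
        , λ { _ (here refl) l e g av → ⊥-elim (¬wit (l , e , g , avoids-++ˡ S av , avoids-++ˡ X (avoids-++ʳ S av)))
            ; t' (there m) l e g av → h t' m l e g (avoids-later X U av) }
    where
    lemma : ∀ N t → N + N * t ≡ N * suc t
    lemma = solve-∀

  fam-rich : ∀ f c M X → (∀ i → i < c → f i ≤ M × Rich (cyc (f i))) → length X + c * M ≤ N → Fam X f c
  fam-rich f zero    M X rich budget = tt
  fam-rich f (suc c) M X rich budget with proj₂ (rich 0 (s≤s z≤n)) X (≤-trans (m≤m+n _ _) budget)
  ... | l , len , isc , avS , avX = l , isc , avX , fam-rich (f ∘ suc) c M (l ++ X) (λ i lt → rich (suc i) (s≤s lt))
        (≤-trans (+-monoˡ-≤ (c * M) (≤-trans (≤-reflexive (trans (length-++ l) (cong (_+ length X) len))) (+-monoˡ-≤ (length X) (proj₁ (rich 0 (s≤s z≤n))))))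
          (≤-trans (≤-reflexive (lemma M (length X) (c * M))) budget))
    where
    lemma : ∀ M x y → M + x + y ≡ x + (M + y)
    lemma = solve-∀

  conns : ℕ → List (Task n)
  conns m = cartesianProductWith (λ a b → conn a b m) S S

  allTasks : ℕ → List (Task n)
  allTasks M = (conns 1 ++ (conns 2 ++ conns 3)) ++ map cyc (upTo M)

  length-cartesian : ∀ {A B C : Set} (f : A → B → C) xs ys → length (cartesianProductWith f xs ys) ≡ length xs * length ys
  length-cartesian f []       ys = refl
  length-cartesian f (x ∷ xs) ys = trans (length-++ (map (f x) ys)) (cong₂ _+_ (length-map (f x) ys) (length-cartesian f xs ys))

  length-tasks : ∀ M → length (allTasks M) ≡ 3 * (length S * length S) + M
  length-tasks M = trans (length-++ (conns 1 ++ (conns 2 ++ conns 3)))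
    (cong₂ _+_ (trans (length-++ (conns 1)) (cong₂ _+_ (len 1) (trans (length-++ (conns 2)) (cong₂ _+_ (len 2) (trans (len 3) (≡-sym (+-identityʳ _)))))))
      (trans (length-map cyc (upTo M)) (length-applyUpTo id M)))
    where
    len : ∀ m → length (conns m) ≡ length S * length S
    len m = length-cartesian (λ a b → conn a b m) S S

  conn∈ : ∀ M a b m → a ∈ S → b ∈ S → 1 ≤ m → m ≤ 3 → conn a b m ∈ allTasks M
  conn∈ M a b m ha hb 1≤m m≤3 = ∈-++⁺ˡ (cases m 1≤m m≤3)
    where
    member : ∀ m → conn a b m ∈ conns m
    member m = ∈-cartesianProductWith⁺ (λ a b → conn a b m) ha hb
    cases : ∀ m → 1 ≤ m → m ≤ 3 → conn a b m ∈ conns 1 ++ (conns 2 ++ conns 3)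
    cases 1 _ _ = ∈-++⁺ˡ (member 1)
    cases 2 _ _ = ∈-++⁺ʳ (conns 1) (∈-++⁺ˡ (member 2))
    cases 3 _ _ = ∈-++⁺ʳ (conns 1) (∈-++⁺ʳ (conns 2) (member 3))
    cases (suc (suc (suc (suc m)))) _ (s≤s (s≤s (s≤s ())))

  cyc∈ : ∀ M L → L < M → cyc L ∈ allTasks M
  cyc∈ M L lt = ∈-++⁺ʳ (conns 1 ++ (conns 2 ++ conns 3)) (∈-map⁺ cyc (∈-upTo⁺ lt))

-- Grows by p n / 4 q in every stage without a win, but stays below (halfTotal k + 1) n.
potential : ∀ {n} → Graph n → List (Fin n) → ℕ
potential G S = pairs (adj G) (λ _ → true) (memb S)

-- One stage: cycles, or edges gained at S

module Stage {n : ℕ} (G : Graph n) (k R : ℕ) (1000≤k : 1000 ≤ k) (big : n < 2 ^ suc R) (S : List (Fin n)) where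

  open Cycles G

  -- `M` exceeds every length `2 * (2 + h) + 2 * i` with h < R and i < k, so `N` covers all vertices
  -- of a family, both in the dense case and for the lengths 4, ..., 2k + 2.
  M N : ℕ
  M = 2 * R + 2 * k + 4
  N = k * M

  open Tasks G S N

  U : List V
  U = proj₁ (handle (allTasks M))

  U-length : length U ≤ N * (3 * (length S * length S) + M)
  U-length = ≤-trans (proj₁ (proj₂ (handle (allTasks M)))) (≤-reflexive (cong (N *_) (length-tasks M)))

  handled : ∀ t → t ∈ allTasks M → Handled U t
  handled = proj₂ (proj₂ (handle (allTasks M)))

  open Linked G S N
  open Structured G S U N k (slack k)

  linked : ∀ a b m l → a ∈ S → b ∈ S → 1 ≤ m → m ≤ 3 → length l ≡ m → Conn a b l → Avoids (S ++ U) l → RichConn a b m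
  linked a b m l ha hb 1≤m m≤3 len c av = handled (conn a b m) (conn∈ M a b m ha hb 1≤m m≤3) l len c av

  enough : total evenLen k ≤ N
  enough = ≤-trans (≤-reflexive (trans (total-evenLen k) (halfTotal-closed k)))
    (le-by (k * k + k * (2 * R) + k) (z≤n {0}) (lemma k R))
    where
    lemma : ∀ k R → k * k + 3 * k + 0 + (k * k + k * (2 * R) + k) ≡ k * (2 * R + 2 * k + 4) + 0
    lemma = solve-∀

  P : V → Bool
  P v = not (memb (S ++ U) v)

  P-avoids : ∀ {v} → P v ≡ true → v ∉ S ++ U
  P-avoids {v} h m = true≢false (memb-true m) (not-elim h)

  K : ℕ
  K = halfTotal k

  dS : V → ℕ
  dS v = card (λ a → memb S a ∧ adj G v a)

  adj-sym' : ∀ {u v} → adj G u v ≡ true → adj G v u ≡ true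
  adj-sym' {u} {v} h = trans (sym G v u) h

  adj-≢ : ∀ {u v} → adj G u v ≡ true → u ≢ v
  adj-≢ {u} h refl = true≢false h (irrefl G u)

  big? : ∀ v → Dec (K ≤ dS v + slack k)
  big? v = K ≤? dS v + slack k

  B W : V → Bool
  B v = P v ∧ ⌊ big? v ⌋
  W v = P v ∧ not ⌊ big? v ⌋

  Win : Set
  Win = HasConsecutiveEvenCycles G k

  win : Fam [] evenLen k → Win
  win = fam-result k 2 ≤-refl

  win-star : ∀ v → P v ≡ true → K ≤ dS v → Win
  win-star v Pv h = win (star enough linked v (P-avoids Pv) h)

  win-two : ∀ m → Saving m → ∀ b b' → B b ≡ true → B b' ≡ true →
    (∀ a a' → memb S a ∧ adj G b a ≡ true → memb S a' ∧ adj G b' a' ≡ true → RichConn a a' m) → Win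
  win-two m s b b' hb hb' across = win (twoBig enough linked m s (Split.j sp) (Split.g sp) b b' (Split.sum sp)
      (P-avoids (∧-elimˡ hb)) (P-avoids (∧-elimˡ hb')) (⌊⌋-sound (big? b) (∧-elimʳ {P b} hb)) (⌊⌋-sound (big? b') (∧-elimʳ {P b'} hb'))
      (Split.top sp) (Split.numeric sp) across)
    where
    sp : Split k
    sp = split-off k 1000≤k

  win-edge : ∀ b b' → B b ≡ true → B b' ≡ true → adj G b b' ≡ true → Win
  win-edge b b' hb hb' e = win-two 2 saving₂ b b' hb hb' λ a a' h h' →
    linked a a' 2 (b ∷ b' ∷ []) (memb-sound (∧-elimˡ h)) (memb-sound (∧-elimˡ h')) (s≤s z≤n) (s≤s (s≤s z≤n)) refl
      (unique-∷ (λ { (here eq) → adj-≢ e eq }) (unique-∷ (λ ()) AllPairs.[])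
      , adj-sym' (∧-elimʳ {memb S a} h) , e , ∧-elimʳ {memb S a'} h')
      (λ { _ (here refl) → P-avoids (∧-elimˡ hb) ; _ (there (here refl)) → P-avoids (∧-elimˡ hb') })

  win-cherry : ∀ w b b' → P w ≡ true → B b ≡ true → B b' ≡ true → adj G w b ≡ true → adj G w b' ≡ true → b ≢ b' → Win
  win-cherry w b b' hw hb hb' e e' ne = win-two 3 saving₃ b b' hb hb' λ a a' h h' →
    linked a a' 3 (b ∷ w ∷ b' ∷ []) (memb-sound (∧-elimˡ h)) (memb-sound (∧-elimˡ h')) (s≤s z≤n) ≤-refl refl
      (unique-∷ (λ { (here eq) → adj-≢ e (≡-sym eq) ; (there (here eq)) → ne eq })
        (unique-∷ (λ { (here eq) → adj-≢ e' eq }) (unique-∷ (λ ()) AllPairs.[]))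
      , adj-sym' (∧-elimʳ {memb S a} h) , adj-sym' e , e' , ∧-elimʳ {memb S a'} h')
      (λ { _ (here refl) → P-avoids (∧-elimˡ hb) ; _ (there (here refl)) → P-avoids hw ; _ (there (there (here refl))) → P-avoids (∧-elimˡ hb') })

  c : ℕ
  c = 2 * (2 * k + 1)

  1≤k : 1 ≤ k
  1≤k = ≤-trans (s≤s z≤n) 1000≤k

  win-dense : 20 * c * card W < pairs (adj G) W W → Win
  win-dense dense = from-layer (dense⇒cycles G W k c R 1≤k big (≤-trans (s≤s z≤n) (2 ⊗ m≤n+m 1 (2 * k))) ≤-refl dense)
    where
    length-cyc : ∀ L l → IsCyc L l → length l ≡ L
    length-cyc L (a ∷ l) (e , _) = e
    from-layer : LayerCycles G W k R → Win
    from-layer (h , h<R , cycles) = fam-result k (2 + h) (s≤s (s≤s z≤n))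
      (fam-rich (λ i → 2 * (2 + h) + 2 * i) k M [] (λ i lt → <⇒≤ (short i lt) , rich i lt) ≤-refl)
      where
      short : ∀ i → i < k → 2 * (2 + h) + 2 * i < M
      short i lt = le-by 3 (2 ⊗ h<R ⊕ 2 ⊗ lt) (lemma h i R k)
        where
        lemma : ∀ h i R k → suc (2 * (2 + h) + 2 * i) + (2 * R + 2 * k) + 3 ≡ 2 * R + 2 * k + 4 + (2 * suc h + 2 * suc i)
        lemma = solve-∀
      rich : ∀ i → i < k → Rich (cyc (2 * (2 + h) + 2 * i))
      rich i lt with cycles i lt
      ... | l , isc , inW = handled (cyc _) (cyc∈ M _ (short i lt)) l (length-cyc _ l isc) isc
            (λ v m → P-avoids (∧-elimˡ (inW v m)))

  SmallDegrees : Set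
  SmallDegrees = ∀ v → P v ≡ true → dS v < K

  record Stuck : Set where
    field
      small   : SmallDegrees
      no-edge : ∀ b b' → B b ≡ true → B b' ≡ true → adj G b b' ≡ false
      no-cherry : ∀ w b b' → P w ≡ true → B b ≡ true → B b' ≡ true → adj G w b ≡ true → adj G w b' ≡ true → b ≡ b'
      sparse  : pairs (adj G) W W ≤ 20 * c * card W

  win-or-stuck : Win ⊎ Stuck
  win-or-stuck with any? (λ v → (P v Bool.≟ true) ×-dec (K ≤? dS v))
  ... | yes (v , Pv , h) = inj₁ (win-star v Pv h)
  ... | no no-star with any? (λ b → any? (λ b' → (B b Bool.≟ true) ×-dec ((B b' Bool.≟ true) ×-dec (adj G b b' Bool.≟ true))))
  ...   | yes (b , b' , hb , hb' , e) = inj₁ (win-edge b b' hb hb' e)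
  ...   | no no-edge' with any? (λ w → any? (λ b → any? (λ b' → (P w Bool.≟ true) ×-dec ((B b Bool.≟ true) ×-dec ((B b' Bool.≟ true) ×-dec ((adj G w b Bool.≟ true) ×-dec ((adj G w b' Bool.≟ true) ×-dec ¬? (b ≟F b'))))))))
  ...     | yes (w , b , b' , hw , hb , hb' , e , e' , ne) = inj₁ (win-cherry w b b' hw hb hb' e e' ne)
  ...     | no no-cherry' with 20 * c * card W <? pairs (adj G) W W
  ...       | yes dense = inj₁ (win-dense dense)
  ...       | no ¬dense = inj₂ record
    { small = λ v Pv → ≰⇒> (λ h → no-star (v , Pv , h))
    ; no-edge = λ b b' hb hb' → not-true (λ e → no-edge' (b , b' , hb , hb' , e))
    ; no-cherry = λ w b b' hw hb hb' e e' → decidable-stable (b ≟F b') (λ ne → no-cherry' (w , b , b' , hw , hb , hb' , e , e' , ne))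
    ; sparse = ≮⇒≥ ¬dense }

  module Counting (stuck : Stuck) where

    open Stuck stuck

    E : V → V → Bool
    E = adj G

    E-sym : ∀ u v → E u v ≡ E v u
    E-sym = sym G

    P-split : ∀ v → P v ≡ true → W v ∨ B v ≡ true
    P-split v h with bool-cases ⌊ big? v ⌋
    ... | inj₁ b = ∨-introʳ {W v} (∧-intro h b)
    ... | inj₂ b = ∨-introˡ (∧-intro h (not-intro b))

    pairs-≤ʳ : ∀ {A C C'} → (∀ v → C v ≡ true → C' v ≡ true) → pairs E A C ≤ pairs E A C'
    pairs-≤ʳ {A} {C} {C'} h = pairs-mono {E = E} {E} {A} {A} {C} {C'} (λ u v a c e → ∧-intro a (∧-intro (h v c) e))

    comm : ∀ A C → pairs E A C ≡ pairs E C A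
    comm A C = pairs-sym {E = E} {A} {C} E-sym

    WB : pairs E W B ≤ card W
    WB = ≤-trans (pairs-≤ E W B 1 (λ w hw → card≤1 (λ b → B b ∧ E w b)
        (λ b b' t t' → no-cherry w b b' (∧-elimˡ hw) (∧-elimˡ t) (∧-elimˡ t') (∧-elimʳ {B b} t) (∧-elimʳ {B b'} t'))))
      (≤-reflexive (+-identityʳ (card W)))

    BB : pairs E B B ≤ 0
    BB = pairs-≤ E B B 0 (λ b hb → ≤-trans (card-mono {Q = λ _ → false}
          (λ b' t → ⊥-elim (true≢false (∧-elimʳ {B b'} t) (no-edge b b' hb (∧-elimˡ t))))) (≤-reflexive (∑-zero n)))

    -- `W` spans few edges, each of its vertices has at most one neighbour in `B`, and `B` spans
    -- none; so all is charged to `W`, at `20 * c + 2` per vertex.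
    PP : pairs E P P ≤ 20 * c * card W + 2 * card W
    PP = ≤-trans (pairs-≤ʳ {P} P-split) (≤-trans (pairs-∨ E P W B)
      (≤-trans (≤-trans (≤-reflexive (comm P W)) (≤-trans (pairs-≤ʳ {W} P-split) (pairs-∨ E W W B))
          ⊕ ≤-trans (≤-reflexive (comm P B)) (≤-trans (pairs-≤ʳ {B} P-split) (pairs-∨ E B W B)))
        (le-by 0 (sparse ⊕ WB ⊕ WB ⊕ ≤-reflexive (comm B W) ⊕ BB)
          (lemma (pairs E W W) (pairs E W B) (pairs E B W) (pairs E B B) (card W) (20 * c * card W)))))
      where
      lemma : ∀ ww wb bw bb w d → ww + wb + (bw + bb) + (d + w + w + wb + 0) + 0 ≡ d + 2 * w + (ww + wb + wb + bw + bb)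
      lemma = solve-∀

    -- Each vertex of `P` has at most K - 1 neighbours in S, and in `W` even `slack k` fewer. The
    -- coefficient `k * 80 + 42` is `2 * slack k`, exactly the charge per vertex in `PP`.
    PS : 2 * pairs E P (memb S) + 2 * card P + (k * 80 + 42) * card W ≤ 2 * K * card P
    PS = ≤-trans (≤-reflexive (≡-sym lhs)) (≤-trans (∑-mono pointwise) (≤-reflexive (∑-* (2 * K) (λ v → ι (P v)))))
      where
      f : V → ℕ
      f v = 2 * (ι (P v) * dS v) + 2 * ι (P v) + (k * 80 + 42) * ι (W v)
      lhs : sumFin f ≡ 2 * pairs E P (memb S) + 2 * card P + (k * 80 + 42) * card W
      lhs = trans (∑-+ (λ v → 2 * (ι (P v) * dS v) + 2 * ι (P v)) (λ v → (k * 80 + 42) * ι (W v)))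
        (cong₂ _+_ (trans (∑-+ (λ v → 2 * (ι (P v) * dS v)) (λ v → 2 * ι (P v)))
          (cong₂ _+_ (trans (∑-* 2 (λ v → ι (P v) * dS v)) (cong (2 *_) (≡-sym (pairs-row E P (memb S))))) (∑-* 2 (λ v → ι (P v)))))
          (∑-* (k * 80 + 42) (λ v → ι (W v))))
      pointwise : ∀ v → f v ≤ 2 * K * ι (P v)
      pointwise v with P v in eqP | big? v
      ... | false | _ = ≤-reflexive (trans (*-zeroʳ (k * 80 + 42)) (≡-sym (*-zeroʳ (2 * K))))
      ... | true | yes _ = le-by 0 (2 ⊗ small v eqP) (lemma (dS v) (k * 80 + 42) K)
        where
        lemma : ∀ d x K → 2 * (d + 0) + 2 * 1 + x * 0 + 2 * K + 0 ≡ 2 * K * 1 + 2 * suc d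
        lemma = solve-∀
      ... | true | no ¬b = le-by 0 (2 ⊗ ≰⇒> ¬b) (lemma (dS v) k K)
        where
        lemma : ∀ d k K → 2 * (d + 0) + 2 * 1 + (k * 80 + 42) * 1 + 2 * K + 0 ≡ 2 * K * 1 + 2 * suc (d + (k * 40 + 21))
        lemma = solve-∀

    inner : 2 * pairs E P (memb S) + pairs E P P + 2 * card P ≤ 2 * K * card P
    inner = le-by 0 (PS ⊕ PP) (lemma (pairs E P (memb S)) (pairs E P P) (card P) (card W) (2 * K * card P) k)
      where
      lemma : ∀ s p c w r k → 2 * s + p + 2 * c + (r + (20 * (2 * (2 * k + 1)) * w + 2 * w)) + 0
        ≡ r + (2 * s + 2 * c + (k * 80 + 42) * w + p)
      lemma = solve-∀

    SU U' : V → Bool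
    SU = memb (S ++ U)
    U' v = memb U v ∧ not (memb S v)

    everything : V → Bool
    everything _ = true

    s : ℕ
    s = length (S ++ U)

    SU-SU : pairs E SU SU ≤ s * s
    SU-SU = ≤-trans (pairs-≤ E SU SU s (λ u _ → ≤-trans (card-mono {Q = SU} (λ v → ∧-elimˡ)) (card-memb (S ++ U)))) (*-monoʳ-≤ s (card-memb (S ++ U)))

    cover : ∀ v → everything v ≡ true → P v ∨ SU v ≡ true
    cover v _ with SU v
    ... | true  = refl
    ... | false = refl

    SU⊆ : ∀ v → SU v ≡ true → memb S v ∨ U' v ≡ true
    SU⊆ v h with ∈-++⁻ S (memb-sound h)
    ... | inj₁ m = ∨-introˡ (memb-true m)
    ... | inj₂ m = go (memb S v) (memb U v) (memb-true m)
      where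
      go : ∀ a b → b ≡ true → a ∨ (b ∧ not a) ≡ true
      go true  b     _ = refl
      go false true  _ = refl

    degreeSum≤ : degreeSum G ≤ pairs E P P + 2 * pairs E P (memb S) + 2 * pairs E P U' + s * s
    degreeSum≤ = ≤-trans (≤-reflexive (∑-cong (λ v → countTrue≡card (adj G v))))
      (≤-trans (pairs-≤ʳ {everything} cover) (≤-trans (pairs-∨ E everything P SU)
        (≤-trans (≤-trans (≤-reflexive (comm everything P)) (≤-trans (pairs-≤ʳ {P} cover) (pairs-∨ E P P SU))
            ⊕ ≤-trans (≤-reflexive (comm everything SU)) (≤-trans (pairs-≤ʳ {SU} cover) (pairs-∨ E SU P SU)))
          (le-by 0 (PSU ⊕ PSU ⊕ ≤-reflexive (comm SU P) ⊕ SU-SU)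
            (lemma (pairs E P P) (pairs E P SU) (pairs E SU P) (pairs E SU SU) (pairs E P (memb S)) (pairs E P U') (s * s))))))
      where
      PSU : pairs E P SU ≤ pairs E P (memb S) + pairs E P U'
      PSU = ≤-trans (pairs-≤ʳ {P} SU⊆) (pairs-∨ E P (memb S) U')
      lemma : ∀ pp ps sp ss x y z → pp + ps + (sp + ss) + (x + y + (x + y) + ps + z) + 0 ≡ pp + 2 * x + 2 * y + z + (ps + ps + sp + ss)
      lemma = solve-∀

    potential-grows : potential G S + pairs E P U' ≤ potential G (S ++ U)
    potential-grows = ≤-trans (≤-reflexive (≡-sym (trans (∑-cong (λ u → ∑-+ (λ v → ι (memb S v ∧ E u v)) (λ v → ι (P u ∧ (U' v ∧ E u v)))))
        (∑-+ (λ u → sumFin λ v → ι (memb S v ∧ E u v)) (λ u → sumFin λ v → ι (P u ∧ (U' v ∧ E u v)))))))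
      (∑-mono λ u → ∑-mono λ v → go (memb S v) (memb U v) (SU v) (P u) (E u v)
        (λ h → memb-true (∈-++⁺ˡ (memb-sound h))) (λ h → memb-true (∈-++⁺ʳ S (memb-sound h))))
      where
      go : ∀ x y z p e → (x ≡ true → z ≡ true) → (y ≡ true → z ≡ true) → ι (x ∧ e) + ι (p ∧ ((y ∧ not x) ∧ e)) ≤ ι (z ∧ e)
      go true  true  z true  e hx hy rewrite hx refl = ≤-reflexive (+-identityʳ (ι e))
      go true  true  z false e hx hy rewrite hx refl = ≤-reflexive (+-identityʳ (ι e))
      go true  false z true  e hx hy rewrite hx refl = ≤-reflexive (+-identityʳ (ι e))
      go true  false z false e hx hy rewrite hx refl = ≤-reflexive (+-identityʳ (ι e))
      go false true  z true  e hx hy rewrite hy refl = ≤-refl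
      go false true  z false e hx hy = z≤n
      go false false z true  e hx hy = z≤n
      go false false z false e hx hy = z≤n

    1≤K : 1 ≤ K
    1≤K = *-cancelˡ-≤ 2 (≤-trans (≤-trans (≤-trans (n≤1+n 2) (3 ⊗ 1≤k)) (m≤n+m (3 * k) (k * k))) (≤-reflexive (≡-sym (halfTotal-closed k))))

    degree-bound : 2 * pairs E P (memb S) + pairs E P P + 2 * n ≤ 2 * K * n
    degree-bound with m≤n⇒∃[o]m+o≡n (card≤n P)
    ... | x , e = subst (λ z → 2 * pairs E P (memb S) + pairs E P P + 2 * z ≤ 2 * K * z) e
      (le-by 0 (inner ⊕ 2 ⊗ *-monoˡ-≤ x 1≤K) (lemma (pairs E P (memb S)) (pairs E P P) (card P) x K))
      where
      lemma : ∀ a b c x K → 2 * a + b + 2 * (c + x) + (2 * K * c + 2 * (K * x)) + 0 ≡ 2 * K * (c + x) + (2 * a + b + 2 * c + 2 * (1 * x))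
      lemma = solve-∀

    -- By `degree-bound`, the excess `p * n` comes from edges between `P` and `U'`, counted twice,
    -- and from the at most s² pairs inside S ∪ U. The assumption on s leaves at least half of it to
    -- the former, hence the factor `4 * q`.
    growth : ∀ p q → ((k * k + 3 * k) * q + p) * n ≤ q * degreeSum G + 2 * q * n → 2 * (q * (s * s)) ≤ p * n →
      4 * q * potential G S + p * n ≤ 4 * q * potential G (S ++ U)
    growth p q avg small-s = le-by 0
        (2 ⊗ avg ⊕ small-s ⊕ 2 ⊗ (q ⊗ degreeSum≤) ⊕ 2 ⊗ (q ⊗ degree-bound) ⊕ (4 * q) ⊗ potential-grows
          ⊕ 2 ⊗ ≤-reflexive (cong (λ z → z * q * n) (halfTotal-closed k)))
        (lemma p q n (k * k + 3 * k) K (degreeSum G) (pairs E P P) (pairs E P (memb S)) (pairs E P U') (s * s) (potential G S) (potential G (S ++ U)))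
      where
      lemma : ∀ p q n k2 K D pp ps pu ss x y →
        4 * q * x + p * n + (2 * (q * D + 2 * q * n) + p * n + 2 * (q * (pp + 2 * ps + 2 * pu + ss)) + 2 * (q * (2 * K * n)) + 4 * q * y + 2 * (k2 * q * n)) + 0
        ≡ 4 * q * y + (2 * ((k2 * q + p) * n) + 2 * (q * ss) + 2 * (q * D) + 2 * (q * (2 * ps + pp + 2 * n)) + 4 * q * (x + pu) + 2 * (2 * K * q * n))
      lemma = solve-∀

    -- Vertices outside S ∪ U have fewer than K neighbours in S; the at most s others have at most s
    -- each.
    potential-bounded : potential G S ≤ K * n + s * s
    potential-bounded = ≤-trans (∑-mono bound) (≤-trans (≤-reflexive (trans (∑-+ (λ _ → K) (λ v → s * ι (SU v)))
        (cong₂ _+_ (trans (∑-const n K) (*-comm n K)) (∑-* s (λ v → ι (SU v)))))) (+-monoʳ-≤ (K * n) (*-monoʳ-≤ s (card-memb (S ++ U)))))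
      where
      bound : ∀ v → dS v ≤ K + s * ι (SU v)
      bound v with bool-cases (SU v)
      ... | inj₂ e = ≤-trans (<⇒≤ (small v (not-intro e))) (m≤m+n K _)
      ... | inj₁ e rewrite e = ≤-trans (≤-trans (card-mono {Q = SU} (λ a t → memb-true (∈-++⁺ˡ (memb-sound {l = S} (∧-elimˡ t)))))
          (≤-trans (card-memb (S ++ U)) (≤-reflexive (≡-sym (*-identityʳ s))))) (m≤n+m (s * 1) K)

  -- `bounded` concerns the old S: degrees into S are known to be small only once its own stage is
  -- stuck.
  record Progress (p q : ℕ) : Set where
    field
      U⁺        : List V
      U⁺-length : length U⁺ ≤ N * (3 * (length S * length S) + M)
      grows     : 4 * q * potential G S + p * n ≤ 4 * q * potential G (S ++ U⁺)
      bounded   : potential G S ≤ halfTotal k * n + length (S ++ U⁺) * length (S ++ U⁺)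

  win-or-progress : ∀ p q → ((k * k + 3 * k) * q + p) * n ≤ q * degreeSum G + 2 * q * n →
    2 * (q * (length (S ++ U) * length (S ++ U))) ≤ p * n → Win ⊎ Progress p q
  win-or-progress p q avg small-s with win-or-stuck
  ... | inj₁ w = inj₁ w
  ... | inj₂ stuck = inj₂ record { U⁺ = U ; U⁺-length = U-length
                                 ; grows = Counting.growth stuck p q avg small-s ; bounded = Counting.potential-bounded stuck }

-- Polynomials against powers of two

2^-pos : ∀ x → 1 ≤ 2 ^ x
2^-pos zero    = ≤-refl
2^-pos (suc x) = ≤-trans (2^-pos x) (m≤m+n _ _)

n<2^n : ∀ n → suc n ≤ 2 ^ n
n<2^n zero    = ≤-refl
n<2^n (suc n) = le-by 0 (n<2^n n ⊕ 2^-pos n) (lemma n (2 ^ n))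
  where
  lemma : ∀ n x → suc (suc n) + (x + x) + 0 ≡ 2 * x + (suc n + 1)
  lemma = solve-∀

-- At `d = 0` both sides are separated by (c + 1)³; each further step doubles the right side and at
-- most doubles the left.
linear≤2^ : ∀ c d → c * suc (3 * c + d) ≤ 2 ^ (3 * c + d)
linear≤2^ c zero = ≤-trans (≤-trans poly (*-mono-≤ (n<2^n c) (*-mono-≤ (n<2^n c) (n<2^n c)))) (≤-reflexive powers)
  where
  poly : c * suc (3 * c + 0) ≤ suc c * (suc c * suc c)
  poly = le-by (c * (c * c) + 2 * c + 1) (z≤n {0}) (lemma c)
    where
    lemma : ∀ c → c * suc (3 * c + 0) + 0 + (c * (c * c) + 2 * c + 1) ≡ suc c * (suc c * suc c) + 0
    lemma = solve-∀
  powers : 2 ^ c * (2 ^ c * 2 ^ c) ≡ 2 ^ (3 * c + 0)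
  powers = trans (cong (2 ^ c *_) (≡-sym (^-distribˡ-+-* 2 c c)))
    (trans (≡-sym (^-distribˡ-+-* 2 c (c + c))) (cong (2 ^_) (lemma c)))
    where
    lemma : ∀ c → c + (c + c) ≡ 3 * c + 0
    lemma = solve-∀
linear≤2^ c (suc d) = ≤-trans (≤-reflexive (cong (λ z → c * suc z) (+-suc (3 * c) d)))
  (≤-trans (le-by (c * (3 * c + d)) (2 ⊗ linear≤2^ c d) (lemma c (3 * c + d) (2 ^ (3 * c + d))))
    (≤-reflexive (cong (2 ^_) (≡-sym (+-suc (3 * c) d)))))
  where
  lemma : ∀ c x y → c * suc (suc x) + 2 * y + c * x ≡ 2 * y + 2 * (c * suc x)
  lemma = solve-∀

-- With a the integer quotient of R by e + 1, R + 2 ≤ (e + 3)(a + 1) ≤ 2^a by `linear≤2^`; then take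
-- powers.
power≤2^ : ∀ e R → suc e * (3 * (3 + e)) ≤ R → (2 + R) ^ suc e ≤ 2 ^ R
power≤2^ e R large = ≤-trans (^-monoˡ-≤ (suc e) base)
    (≤-trans (≤-reflexive (^-*-assoc 2 a (suc e))) (^-monoʳ-≤ 2 (≤-trans (m≤n+m _ (R % suc e)) (≤-reflexive (≡-sym (m≡m%n+[m/n]*n R (suc e)))))))
  where
  open import Data.Nat.DivMod using (_/_; m%n<n; m≡m%n+[m/n]*n)
  a : ℕ
  a = R / suc e
  R< : R < suc e + a * suc e
  R< = ≤-trans (s≤s (≤-reflexive (m≡m%n+[m/n]*n R (suc e)))) (+-monoˡ-≤ (a * suc e) (m%n<n R (suc e)))
  a-large : 3 * (3 + e) ≤ a
  a-large = ≤-pred (*-cancelˡ-< (suc e) _ _ (≤-trans (s≤s large) (≤-trans R< (≤-reflexive (lemma (suc e) a)))))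
    where
    lemma : ∀ e a → e + a * e ≡ e * suc a
    lemma = solve-∀
  base : 2 + R ≤ 2 ^ a
  base with m≤n⇒∃[o]m+o≡n a-large
  ... | d , eq = ≤-trans (≤-trans (le-by (suc (2 * a)) R< (lemma R a e)) (≤-reflexive (cong (λ z → (3 + e) * suc z) (≡-sym eq))))
        (≤-trans (linear≤2^ (3 + e) d) (≤-reflexive (cong (2 ^_) eq)))
    where
    lemma : ∀ R a e → 2 + R + (suc e + a * suc e) + suc (2 * a) ≡ (3 + e) * suc a + suc R
    lemma = solve-∀

-- The base is at least 2 for every R, so constants and sums are absorbed by a larger exponent.
Poly : (ℕ → ℕ) → Set
Poly f = ∃ λ e → ∀ R → f R ≤ (2 + R) ^ e

poly-const : ∀ c → Poly (λ _ → c)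
poly-const c = c , λ R → ≤-trans (≤-trans (n≤1+n c) (n<2^n c)) (^-monoˡ-≤ c (m≤m+n 2 R))

poly-id : Poly (λ R → R)
poly-id = 1 , λ R → ≤-trans (m≤n+m R 2) (≤-reflexive (≡-sym (*-identityʳ (2 + R))))

poly-* : ∀ {f g} → Poly f → Poly g → Poly (λ R → f R * g R)
poly-* (e , hf) (e' , hg) = e + e' , λ R → ≤-trans (*-mono-≤ (hf R) (hg R)) (≤-reflexive (≡-sym (^-distribˡ-+-* (2 + R) e e')))

poly-+ : ∀ {f g} → Poly f → Poly g → Poly (λ R → f R + g R)
poly-+ (e , hf) (e' , hg) = suc (e + e') , λ R → ≤-trans
  (≤-trans (hf R) (^-monoʳ-≤ (2 + R) (m≤m+n e e')) ⊕ ≤-trans (hg R) (^-monoʳ-≤ (2 + R) (m≤n+m e' e)))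
  (≤-trans (≤-reflexive (cong ((2 + R) ^ (e + e') +_) (≡-sym (+-identityʳ _)))) (*-monoˡ-≤ ((2 + R) ^ (e + e')) (m≤m+n 2 R)))

poly-beaten : ∀ {f} → Poly f → ∃ λ R₀ → ∀ R → R₀ ≤ R → f R ≤ 2 ^ R
poly-beaten (e , h) = suc e * (3 * (3 + e)) , λ R le →
  ≤-trans (h R) (≤-trans (^-monoʳ-≤ (2 + R) (n≤1+n e)) (power≤2^ e R le))

log : ∀ n → 1 ≤ n → ∃ λ R → 2 ^ R ≤ n × n < 2 ^ suc R
log (suc zero)    _ = 0 , ≤-refl , ≤-refl
log (suc (suc n)) _ with log (suc n) (s≤s z≤n)
... | R , le , lt with suc (suc n) <? 2 ^ suc R
...   | yes h = R , ≤-trans le (n≤1+n _) , h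
...   | no ¬h = suc R , ≮⇒≥ ¬h , ≤-trans (s≤s lt) (le-by 0 (2^-pos (suc R)) (lemma (2 ^ suc R)))
  where
  lemma : ∀ x → suc x + x + 0 ≡ 2 * x + 1
  lemma = solve-∀

-- k (2R + 2k + 4) bounds the number of vertices on k cycles of the lengths considered, hence the size
-- of a hitting set; the last factor is the number of tasks.
stageSize : ℕ → ℕ → ℕ → ℕ
stageSize k zero    R = 0
stageSize k (suc i) R = stageSize k i R + k * (2 * R + 2 * k + 4) * (3 * (stageSize k i R * stageSize k i R) + (2 * R + 2 * k + 4))

stageSize-poly : ∀ k i → Poly (stageSize k i)
stageSize-poly k zero    = poly-const 0
stageSize-poly k (suc i) = poly-+ rec (poly-* (poly-* (poly-const k) M) (poly-+ (poly-* (poly-const 3) (poly-* rec rec)) M))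
  where
  rec : Poly (stageSize k i)
  rec = stageSize-poly k i
  M : Poly (λ R → 2 * R + 2 * k + 4)
  M = poly-+ (poly-+ (poly-* (poly-const 2) poly-id) (poly-const (2 * k))) (poly-const 4)

stageSize-mono : ∀ k R {i j} → i ≤ j → stageSize k i R ≤ stageSize k j R
stageSize-mono k R {i} {zero} z≤n = z≤n
stageSize-mono k R {i} {suc j} le with m≤n⇒m<n∨m≡n le
... | inj₁ (s≤s h) = ≤-trans (stageSize-mono k R h) (m≤m+n _ _)
... | inj₂ refl    = ≤-refl

-- Iterating the stages

module Iterate {n : ℕ} (G : Graph n) (p q k R : ℕ) (1000≤k : 1000 ≤ k) (big : n < 2 ^ suc R)
  (1≤p : 1 ≤ p) (1≤q : 1 ≤ q) (1≤n : 1 ≤ n)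
  (avg : ((k * k + 3 * k) * q + p) * n ≤ q * degreeSum G + 2 * q * n)
  (room : 2 * (q * (stageSize k (suc (4 * q * (2 + halfTotal k))) R * stageSize k (suc (4 * q * (2 + halfTotal k))) R)) ≤ n) where

  open Stage G k R 1000≤k big using (Win; Progress; win-or-progress; M; N; U; U-length)

  -- Every stage adds at least n to `4 * q * potential`, whereas a stuck stage bounds this by 4q(K +
  -- 1)n; K + 2 instead of K + 1 makes the contradiction.
  last : ℕ
  last = 4 * q * (2 + halfTotal k)

  extended : ∀ S i (X : List (Fin n)) → length S ≤ stageSize k i R → length X ≤ N S * (3 * (length S * length S) + M S) →
    length (S ++ X) ≤ stageSize k (suc i) R
  extended S i X hS hX = ≤-trans (≤-reflexive (length-++ S))
    (hS ⊕ ≤-trans hX (*-monoʳ-≤ (N S) (+-monoˡ-≤ (M S) (3 ⊗ *-mono-≤ hS hS))))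

  fits-room : ∀ i l → i ≤ last → l ≤ stageSize k (suc i) R → 2 * (q * (l * l)) ≤ n
  fits-room i l le h = ≤-trans (2 ⊗ (q ⊗ *-mono-≤ h' h')) room
    where
    h' : l ≤ stageSize k (suc last) R
    h' = ≤-trans h (stageSize-mono k R (s≤s le))

  n≤pn : n ≤ p * n
  n≤pn = ≤-trans (≤-reflexive (≡-sym (+-identityʳ n))) (*-monoˡ-≤ n 1≤p)

  advance : ∀ i S → i ≤ last → length S ≤ stageSize k i R → Win S ⊎ Progress S p q
  advance i S le hS = win-or-progress S p q avg
    (≤-trans (fits-room i _ le (extended S i (U S) hS (U-length S))) n≤pn)

  Reached : ℕ → Set
  Reached i = ∃ λ S → length S ≤ stageSize k i R × i * (p * n) ≤ 4 * q * potential G S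

  iterate : ∀ i → i ≤ last → HasConsecutiveEvenCycles G k ⊎ Reached i
  iterate zero    _  = inj₂ ([] , z≤n , z≤n)
  iterate (suc i) le with iterate i (≤-trans (n≤1+n i) le)
  ... | inj₁ w = inj₁ w
  ... | inj₂ (S , hS , pot) with advance i S (≤-trans (n≤1+n i) le) hS
  ...   | inj₁ w  = inj₁ w
  ...   | inj₂ pr = inj₂ (S ++ U⁺ , extended S i U⁺ hS U⁺-length
            , ≤-trans (≤-trans (≤-reflexive (+-comm (p * n) (i * (p * n)))) (+-monoˡ-≤ (p * n) pot)) grows)
    where open Stage.Progress pr

  conclusion : HasConsecutiveEvenCycles G k
  conclusion with iterate last ≤-refl
  ... | inj₁ w = w
  -- This extra stage wins or bounds the potential of the final S; it accounts for the `suc` in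
  -- `room`.
  ... | inj₂ (S , hS , pot) with advance last S ≤-refl hS
  ...   | inj₁ w  = w
  ...   | inj₂ pr = ⊥-elim (<⇒≱ 1≤n (*-cancelˡ-≤ (4 * q) ⦃ >-nonZero (≤-trans 1≤q (m≤m+n q _)) ⦄
            (le-by 0 (pot ⊕ last ⊗ n≤pn ⊕ (4 * q) ⊗ bounded ⊕ (4 * q) ⊗ square)
              (lemma q (halfTotal k) n (p * n) (potential G S) (length (S ++ U⁺) * length (S ++ U⁺))))))
    where
    open Stage.Progress pr
    square : length (S ++ U⁺) * length (S ++ U⁺) ≤ n
    square = ≤-trans (≤-trans (≤-trans (≤-reflexive (≡-sym (+-identityʳ _))) (*-monoˡ-≤ _ 1≤q)) (m≤m+n _ _))
      (fits-room last _ ≤-refl (extended S last U⁺ hS U⁺-length))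
    lemma : ∀ q K n pn x y → 4 * q * n + (4 * q * x + 4 * q * (2 + K) * pn + 4 * q * (K * n + y) + 4 * q * n) + 0
      ≡ 4 * q * 0 + (4 * q * (2 + K) * pn + 4 * q * (2 + K) * n + 4 * q * x + 4 * q * y)
    lemma = solve-∀

-- A positive real ε may be lowered to a rational `p / q`; multiplying by `q * n` and moving the -2
-- across avoids division and subtraction. The threshold on k comes from `split-off`, and ε enters
-- `nk` through the number of stages.
theorem1p3 : (p q : ℕ) → 0 < p → 0 < q →
    Σ ℕ λ kε → (k : ℕ) → kε ≤ k →
      Σ ℕ λ nk → (n : ℕ) → nk ≤ n → (G : Graph n) →
        ((k * k + 3 * k) * q + p) * n ≤ q * degreeSum G + 2 * q * n →
        HasConsecutiveEvenCycles G k
theorem1p3 p q 1≤p 1≤q = 1000 , for-large-k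
  where
  for-large-k : (k : ℕ) → 1000 ≤ k → Σ ℕ λ nk → (n : ℕ) → nk ≤ n → (G : Graph n) →
    ((k * k + 3 * k) * q + p) * n ≤ q * degreeSum G + 2 * q * n → HasConsecutiveEvenCycles G k
  -- A power of two, so that n ≥ `2 ^ R₀` puts the integer part of log₂ n at or above `R₀`.
  for-large-k k 1000≤k = 2 ^ R₀ , for-large-n
    where
    stages : ℕ
    stages = suc (4 * q * (2 + halfTotal k))
    size : ℕ → ℕ
    size = stageSize k stages
    beaten : ∃ λ R₀ → ∀ R → R₀ ≤ R → 2 * (q * (size R * size R)) ≤ 2 ^ R
    beaten = poly-beaten (poly-* (poly-const 2) (poly-* (poly-const q) (poly-* (stageSize-poly k stages) (stageSize-poly k stages))))
    R₀ : ℕ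
    R₀ = proj₁ beaten
    for-large-n : (n : ℕ) → 2 ^ R₀ ≤ n → (G : Graph n) →
      ((k * k + 3 * k) * q + p) * n ≤ q * degreeSum G + 2 * q * n → HasConsecutiveEvenCycles G k
    for-large-n n nk≤n G avg with log n (≤-trans (2^-pos R₀) nk≤n)
    ... | R , 2^R≤n , n<2^ = Iterate.conclusion G p q k R 1000≤k n<2^ 1≤p 1≤q (≤-trans (2^-pos R₀) nk≤n) avg
          (≤-trans (proj₂ beaten R R₀≤R) 2^R≤n)
      where
      R₀≤R : R₀ ≤ R
      R₀≤R = ≮⇒≥ (λ lt → <⇒≱ n<2^ (≤-trans (^-monoʳ-≤ 2 lt) nk≤n))
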